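{- Let $\mathbb{K}$ be any field, let $n\in\mathbb{Z}_{>0}$ and $r\in\mathbb{Z}$ with $1\le r\le n$, and let $\mathcal{U}_{[n]}^r=\{F\subseteq[n] : \#F\le r\}$ be the uniform matroid of rank $r$ on $[n]=\{1,\dots,n\}$. For every $\mathbf{b}\in\{0,1\}^n$, with $\#\mathbf{b}$ denoting the cardinality of its support, $$\dim_{\mathbb{K}}T^2_{ -\mathbf{b}}(\mathcal{U}_{[n]}^r)=\begin{cases}0 & \text{if }\#\mathbf{b}\neq 2\text{ or }r\ge n-1,\\ r\binom{n-2}{r}-\binom{n-2}{r-1} & \text{if }\#\mathbf{b}=2\text{ and }r\le n-2.\end{cases}$$ In particular, $T^2_{ -\mathbf{b}}(\mathcal{U}_{[n]}^r)=0$ for all $\mathbf{b}\in\{0,1\}^n$ if and only if $r\ge n-2$, that is, if and only if the matroid is a full simplex, the boundary of a full simplex, or the uniform matroid $\mathcal{U}_{[n]}^{n-2}$.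
   Context: For a simplicial complex $\Delta$ on $[n]$ (a family of subsets of $[n]$ closed under taking subsets), $T^2(\Delta)$ is the second cotangent cohomology module of the Stanley-Reisner ring $S/I_\Delta$, where $S=\mathbb{K}[x_1,\dots,x_n]$ and $I=I_\Delta=\langle\prod_{i\in F}x_i : F\subseteq[n],\ F\notin\Delta\rangle$. Explicitly: let $m$ be the number of minimal monomial generators of $I$, let $d:S^m\to S$ be the $S$-linear map sending the canonical basis to these generators, $\operatorname{Syz}(I)=\ker d$, and $\operatorname{Kosz}(I)\subseteq\operatorname{Syz}(I)$ the submodule generated by all $d(f)g-d(g)f$ with $f,g\in S^m$. The quotient $\operatorname{Syz}(I)/\operatorname{Kosz}(I)$ is an $S/I$-module, and $T^2(\Delta)$ is the cokernel of the induced (restriction) map $\operatorname{Hom}_S(S^m,S/I)\to\operatorname{Hom}_{S/I}(\operatorname{Syz}(I)/\operatorname{Kosz}(I),S/I)$. Since $I$ is a monomial ideal, all these modules are $\mathbb{Z}^n$-graded ($\deg x_i=e_i$, with the basis elements of $S^m$ placed in degrees making $d$ homogeneous of degree $0$, and a homomorphism having degree $\mathbf{c}$ if it shifts degrees by $\mathbf{c}$). $T^2_{\mathbf{c}}(\Delta)$ denotes the component of degree $\mathbf{c}\in\mathbb{Z}^n$. The binomial coefficient $\binom{k}{i}$ is the number of $i$-subsets of a $k$-element set. -}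

module Defs where

open import Level using (Level; _⊔_; suc; 0ℓ)
open import Function.Base using (id; _∘_)
open import Data.Bool.Base using (if_then_else_)
import Data.Bool.Properties as Bool
open import Data.Unit.Base using (tt) renaming (⊤ to Unit)
open import Data.Nat.Base as ℕ using (ℕ; zero)
import Data.Nat.Properties as ℕₚ
open import Data.Integer.Base as ℤ using (ℤ; +_)
open import Data.Fin.Base as Fin using (Fin)
import Data.Fin.Properties as Finₚ
open import Data.Fin.Subset using (Subset; inside; outside; _⊆_; _⊂_; ∣_∣; ⊤)
import Data.Fin.Subset.Properties as Subsetₚ
open import Data.Vec.Base as Vec using (Vec; []; _∷_)
import Data.Vec.Properties as Vecₚ
open import Data.List.Base as List using (List; []; _∷_; _++_; length; filter; lookup)
import Data.List.Properties as Listₚ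
open import Data.List.Membership.Propositional using () renaming (_∈_ to _∈ˡ_)
open import Data.List.Membership.Propositional.Properties using (∈-filter⁺; ∈-map⁺; ∈-++⁺ˡ; ∈-++⁺ʳ; ∈-lookup)
open import Data.List.Relation.Unary.Any as Any using (here)
import Data.List.Relation.Unary.Any.Properties as Anyₚ
open import Data.List.Relation.Unary.All as All using ()
open import Data.List.Relation.Unary.All.Properties using (all-filter)
open import Data.Product.Base using (Σ; ∃; _×_; _,_; proj₁; proj₂)
open import Relation.Nullary using (¬_; Dec; yes; no; does; contradiction)
open import Relation.Nullary.Decidable as Dec using (¬?; _×-dec_; decidable-stable)
open import Relation.Unary using (Pred; Decidable; _≐_)
open import Relation.Binary.Structures using (IsEquivalence)
open import Relation.Binary.PropositionalEquality as ≡ using (_≡_; _≢_)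
open import Algebra.Bundles using (CommutativeRing; AbelianGroup)
import Algebra.Definitions as AlgebraDefinitions
open import Algebra.Core using (Op₁; Op₂)
open import Algebra.Structures using (IsAbelianGroup; IsCommutativeRing)
open import Algebra.Module.Core using (Opₗ)
open import Algebra.Module.Structures using (IsModule)
open import Relation.Binary.Core using (Rel)
open import Algebra.Module.Bundles using (Module)
open import Algebra.Module.Bundles.Raw using (RawModule)
open import Algebra.Module.Structures.Biased using (IsModuleFromLeft)
open import Algebra.Module.Morphism.Structures using (module ModuleMorphisms)
import Algebra.Module.Construct.TensorUnit as TensorUnit
open import Algebra.Morphism.Structures using (module RingMorphisms)
import Algebra.Morphism.Construct.Composition as Composition
import Algebra.Properties.AbelianGroup as AbelianGroupProperties
import Algebra.Properties.Ring as RingProperties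
import Algebra.Properties.CommutativeSemigroup as CommutativeSemigroupProperties
import Algebra.Properties.CommutativeMonoid.Sum as MonoidSum
import Algebra.Properties.Semiring.Sum as SemiringSum

-- Neither decidable equality nor an apartness relation is assumed.
record Field (c ℓ : Level) : Set (suc (c ⊔ ℓ)) where
  field
    commutativeRing : CommutativeRing c ℓ
  open CommutativeRing commutativeRing public
  open AlgebraDefinitions _≈_ using (Invertible)
  field
    1≉0        : 1# ≉ 0#
    invertible : ∀ x → x ≉ 0# → Invertible 1# _*_ x

-- The proofs of the module and ring laws of the constructions below are
-- abstract, so that comparing two modules never unfolds them.

module _ {r ℓr : Level} {R : CommutativeRing r ℓr} where
  open CommutativeRing R hiding (zero)

  -- The laws that suffice; the right action is the left one.
  module _ {m ℓm : Level} {A : Set m} {_≈ᴬ_ : Rel A ℓm} {_∙_ : Op₂ A} {ε : A} {_⁻¹ : Op₁ A}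
           {_·_ : Opₗ Carrier A} where

    makeIsModule :
      IsAbelianGroup _≈ᴬ_ _∙_ ε _⁻¹ →
      (∀ {a b x y} → a ≈ b → x ≈ᴬ y → (a · x) ≈ᴬ (b · y)) →
      (∀ a x y → (a · (x ∙ y)) ≈ᴬ ((a · x) ∙ (a · y))) →
      (∀ x a b → ((a + b) · x) ≈ᴬ ((a · x) ∙ (b · x))) →
      (∀ a b x → ((a * b) · x) ≈ᴬ (a · (b · x))) →
      (∀ x → (1# · x) ≈ᴬ x) →
      IsModule R _≈ᴬ_ _∙_ ε _⁻¹ _·_ (λ x a → a · x)
    makeIsModule isAbelianGroup ·-cong ·-distribˡ ·-distribʳ ·-assoc ·-identity =
      IsModuleFromLeft.isModule {commutativeRing = R} (record
        { isLeftModule = record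
          { isLeftSemimodule = record
            { +ᴹ-isCommutativeMonoid = G.isCommutativeMonoid
            ; isPreleftSemimodule = record
              { *ₗ-cong = ·-cong
              ; *ₗ-zeroˡ = λ x → identityʳ-unique (0# · x) (0# · x)
                  (G.trans (G.sym (·-distribʳ x 0# 0#)) (·-cong (+-identityˡ 0#) G.refl))
              ; *ₗ-distribʳ = ·-distribʳ
              ; *ₗ-identityˡ = ·-identity
              ; *ₗ-assoc = ·-assoc
              ; *ₗ-zeroʳ = λ a → identityʳ-unique (a · ε) (a · ε)
                  (G.trans (G.sym (·-distribˡ a ε ε)) (·-cong refl (G.identityˡ ε)))
              ; *ₗ-distribˡ = ·-distribˡ
              }
            }
          ; -ᴹ‿cong = G.⁻¹-cong
          ; -ᴹ‿inverse = G.inverse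
          }
        })
      where
      G : AbelianGroup m ℓm
      G = record { isAbelianGroup = isAbelianGroup }
      module G = AbelianGroup G
      open AbelianGroupProperties G using (identityʳ-unique)

  IsModuleOn : ∀ {m ℓm} → RawModule Carrier m ℓm → Set (r ⊔ ℓr ⊔ m ⊔ ℓm)
  IsModuleOn X = IsModule R _≈ᴹ_ _+ᴹ_ 0ᴹ -ᴹ_ _*ₗ_ _*ᵣ_
    where open RawModule X

  fromRaw : ∀ {m ℓm} (X : RawModule Carrier m ℓm) → IsModuleOn X → Module R m ℓm
  fromRaw X X-isModule = record { RawModule X ; isModule = X-isModule }

  -1*ₗ : ∀ {m ℓm} (M : Module R m ℓm) → let open Module M in
         ∀ x → (- 1# *ₗ x) ≈ᴹ (-ᴹ x)
  -1*ₗ M x = inverseʳ-unique x (- 1# *ₗ x)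
    (≈ᴹ-trans (+ᴹ-congʳ (≈ᴹ-sym (*ₗ-identityˡ x)))
    (≈ᴹ-trans (≈ᴹ-sym (*ₗ-distribʳ x 1# (- 1#)))
    (≈ᴹ-trans (*ₗ-cong (-‿inverseʳ 1#) ≈ᴹ-refl) (*ₗ-zeroˡ x))))
    where
    open Module M
    open AbelianGroupProperties +ᴹ-abelianGroup using (inverseʳ-unique)

  record Submodule {m ℓm : Level} (M : Module R m ℓm) (p : Level)
                   : Set (r ⊔ m ⊔ ℓm ⊔ suc p) where
    no-eta-equality
    open Module M
    field
      Contains : Carrierᴹ → Set p
      resp     : ∀ {x y} → x ≈ᴹ y → Contains x → Contains y
      0-closed : Contains 0ᴹ
      +-closed : ∀ {x y} → Contains x → Contains y → Contains (x +ᴹ y)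
      *-closed : ∀ a {x} → Contains x → Contains (a *ₗ x)

    neg-closed : ∀ {x} → Contains x → Contains (-ᴹ x)
    neg-closed {x} x∈ = resp (-1*ₗ M x) (*-closed (- 1#) x∈)

  open Submodule public using (Contains)

  module _ {m ℓm p : Level} {M : Module R m ℓm} (N : Submodule M p) where
    private
      module M = Module M
      module N = Submodule N

    submoduleRaw : RawModule Carrier (m ⊔ p) ℓm
    submoduleRaw .RawModule.Carrierᴹ = Σ M.Carrierᴹ N.Contains
    submoduleRaw .RawModule._≈ᴹ_ x y = proj₁ x M.≈ᴹ proj₁ y
    submoduleRaw .RawModule._+ᴹ_ x y = proj₁ x M.+ᴹ proj₁ y , N.+-closed (proj₂ x) (proj₂ y)
    submoduleRaw .RawModule._*ₗ_ a x = a M.*ₗ proj₁ x , N.*-closed a (proj₂ x)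
    submoduleRaw .RawModule._*ᵣ_ x a = a M.*ₗ proj₁ x , N.*-closed a (proj₂ x)
    submoduleRaw .RawModule.0ᴹ       = M.0ᴹ , N.0-closed
    submoduleRaw .RawModule.-ᴹ_ x    = M.-ᴹ proj₁ x , N.neg-closed (proj₂ x)

    abstract
      submodule-isModule : IsModuleOn submoduleRaw
      submodule-isModule = makeIsModule
        (record
          { isGroup = record
            { isMonoid = record
              { isSemigroup = record
                { isMagma = record
                  { isEquivalence = record { refl = M.≈ᴹ-refl ; sym = M.≈ᴹ-sym ; trans = M.≈ᴹ-trans }
                  ; ∙-cong = M.+ᴹ-cong
                  }
                ; assoc = λ x y z → M.+ᴹ-assoc (proj₁ x) (proj₁ y) (proj₁ z)
                }
              ; identity = (λ x → M.+ᴹ-identityˡ (proj₁ x)) , (λ x → M.+ᴹ-identityʳ (proj₁ x))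
              }
            ; inverse = (λ x → M.-ᴹ‿inverseˡ (proj₁ x)) , (λ x → M.-ᴹ‿inverseʳ (proj₁ x))
            ; ⁻¹-cong = M.-ᴹ‿cong
            }
          ; comm = λ x y → M.+ᴹ-comm (proj₁ x) (proj₁ y)
          })
        M.*ₗ-cong
        (λ a x y → M.*ₗ-distribˡ a (proj₁ x) (proj₁ y))
        (λ x a b → M.*ₗ-distribʳ (proj₁ x) a b)
        (λ a b x → M.*ₗ-assoc a b (proj₁ x))
        (λ x → M.*ₗ-identityˡ (proj₁ x))

    submodule : Module R (m ⊔ p) ℓm
    submodule = fromRaw submoduleRaw submodule-isModule

  data Span {m ℓm j : Level} (M : Module R m ℓm) {J : Set j} (g : J → Module.Carrierᴹ M)
            : Module.Carrierᴹ M → Set (r ⊔ m ⊔ ℓm ⊔ j) where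
    gen   : ∀ i → Span M g (g i)
    zero  : Span M g (Module.0ᴹ M)
    plus  : ∀ {x y} → Span M g x → Span M g y → Span M g (Module._+ᴹ_ M x y)
    scale : ∀ a {x} → Span M g x → Span M g (Module._*ₗ_ M a x)
    resp  : ∀ {x y} → Module._≈ᴹ_ M x y → Span M g x → Span M g y

  span : ∀ {m ℓm j} (M : Module R m ℓm) {J : Set j} →
         (J → Module.Carrierᴹ M) → Submodule M (r ⊔ m ⊔ ℓm ⊔ j)
  span M g .Submodule.Contains = Span M g
  span M g .Submodule.resp     = resp
  span M g .Submodule.0-closed = zero
  span M g .Submodule.+-closed = plus
  span M g .Submodule.*-closed = scale

  span⊆ : ∀ {m ℓm j p} {M : Module R m ℓm} {J : Set j} {g : J → Module.Carrierᴹ M}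
          (N : Submodule M p) → (∀ i → Contains N (g i)) →
          ∀ {x} → Span M g x → Contains N x
  span⊆ N g∈N (gen i)      = g∈N i
  span⊆ N g∈N zero         = Submodule.0-closed N
  span⊆ N g∈N (plus s t)   = Submodule.+-closed N (span⊆ N g∈N s) (span⊆ N g∈N t)
  span⊆ N g∈N (scale a s)  = Submodule.*-closed N a (span⊆ N g∈N s)
  span⊆ N g∈N (resp x≈y s) = Submodule.resp N x≈y (span⊆ N g∈N s)

  -- Equality in M / N, whose elements are those of M.
  record Congruent {m ℓm p : Level} {M : Module R m ℓm} (N : Submodule M p)
                   (x y : Module.Carrierᴹ M) : Set p where
    constructor congruent
    open Module M
    field
      difference : Contains N (x +ᴹ -ᴹ y)

  open Congruent public

  module _ {m ℓm p : Level} {M : Module R m ℓm} (N : Submodule M p) where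
    open Module M
    open AbelianGroupProperties +ᴹ-abelianGroup
      using (x≈y⇒x∙y⁻¹≈ε; ⁻¹-anti-homo‿-; ⁻¹-∙-comm)
    open CommutativeSemigroupProperties
      (AbelianGroup.commutativeSemigroup +ᴹ-abelianGroup)
      using (interchange)
    private module N = Submodule N

    ≈⇒congruent : ∀ {x y} → x ≈ᴹ y → Congruent N x y
    ≈⇒congruent x≈y = congruent (N.resp (≈ᴹ-sym (x≈y⇒x∙y⁻¹≈ε x≈y)) N.0-closed)

    congruent-isEquivalence : IsEquivalence (Congruent N)
    congruent-isEquivalence = record
      { refl  = ≈⇒congruent ≈ᴹ-refl
      ; sym   = λ {x} {y} e → congruent (N.resp (⁻¹-anti-homo‿- x y) (N.neg-closed (difference e)))
      ; trans = λ {x} {y} {z} e f → congruent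
          (N.resp (telescope x y z) (N.+-closed (difference e) (difference f)))
      }
      where
      telescope : ∀ x y z → ((x +ᴹ -ᴹ y) +ᴹ (y +ᴹ -ᴹ z)) ≈ᴹ (x +ᴹ -ᴹ z)
      telescope x y z =
        ≈ᴹ-trans (+ᴹ-assoc x (-ᴹ y) (y +ᴹ -ᴹ z)) (+ᴹ-congˡ
        (≈ᴹ-trans (≈ᴹ-sym (+ᴹ-assoc (-ᴹ y) y (-ᴹ z)))
        (≈ᴹ-trans (+ᴹ-congʳ (-ᴹ‿inverseˡ y)) (+ᴹ-identityˡ (-ᴹ z)))))

    quotient-isAbelianGroup : IsAbelianGroup (Congruent N) _+ᴹ_ 0ᴹ -ᴹ_
    quotient-isAbelianGroup = record
      { isGroup = record
        { isMonoid = record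
          { isSemigroup = record
            { isMagma = record
              { isEquivalence = congruent-isEquivalence
              ; ∙-cong = λ {x} {y} {u} {v} e f → congruent (N.resp
                  (≈ᴹ-trans (interchange x (-ᴹ y) u (-ᴹ v)) (+ᴹ-congˡ (⁻¹-∙-comm y v)))
                  (N.+-closed (difference e) (difference f)))
              }
            ; assoc = λ x y z → ≈⇒congruent (+ᴹ-assoc x y z)
            }
          ; identity = (λ x → ≈⇒congruent (+ᴹ-identityˡ x)) , (λ x → ≈⇒congruent (+ᴹ-identityʳ x))
          }
        ; inverse = (λ x → ≈⇒congruent (-ᴹ‿inverseˡ x)) , (λ x → ≈⇒congruent (-ᴹ‿inverseʳ x))
        ; ⁻¹-cong = λ {x} {y} e → congruent
            (N.resp (≈ᴹ-sym (⁻¹-∙-comm x (-ᴹ y))) (N.neg-closed (difference e)))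
        }
      ; comm = λ x y → ≈⇒congruent (+ᴹ-comm x y)
      }

    private
      *ₗ-sub : ∀ a x y → (a *ₗ (x +ᴹ -ᴹ y)) ≈ᴹ ((a *ₗ x) +ᴹ -ᴹ (a *ₗ y))
      *ₗ-sub a x y = ≈ᴹ-trans (*ₗ-distribˡ a x (-ᴹ y)) (+ᴹ-congˡ
        (≈ᴹ-trans (*ₗ-cong refl (≈ᴹ-sym (-1*ₗ M y)))
        (≈ᴹ-trans (≈ᴹ-sym (*ₗ-assoc a (- 1#) y))
        (≈ᴹ-trans (*ₗ-cong (*-comm a (- 1#)) ≈ᴹ-refl)
        (≈ᴹ-trans (*ₗ-assoc (- 1#) a y) (-1*ₗ M (a *ₗ y)))))))

    congruent-*ₗ : ∀ {a b x y} → a ≈ b → Congruent N x y → Congruent N (a *ₗ x) (b *ₗ y)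
    congruent-*ₗ {a} {b} {x} {y} a≈b e = congruent (N.resp
      (≈ᴹ-trans (*ₗ-sub a x y) (+ᴹ-congˡ (-ᴹ‿cong (*ₗ-cong a≈b ≈ᴹ-refl))))
      (N.*-closed a (difference e)))

    quotientRaw : RawModule Carrier m p
    quotientRaw .RawModule.Carrierᴹ = Module.Carrierᴹ M
    quotientRaw .RawModule._≈ᴹ_     = Congruent N
    quotientRaw .RawModule._+ᴹ_     = Module._+ᴹ_ M
    quotientRaw .RawModule._*ₗ_     = Module._*ₗ_ M
    quotientRaw .RawModule._*ᵣ_ x a = Module._*ₗ_ M a x
    quotientRaw .RawModule.0ᴹ       = Module.0ᴹ M
    quotientRaw .RawModule.-ᴹ_      = Module.-ᴹ_ M

    abstract
      quotient-isModule : IsModuleOn quotientRaw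
      quotient-isModule = makeIsModule quotient-isAbelianGroup congruent-*ₗ
        (λ a x y → ≈⇒congruent (*ₗ-distribˡ a x y))
        (λ x a b → ≈⇒congruent (*ₗ-distribʳ x a b))
        (λ a b x → ≈⇒congruent (*ₗ-assoc a b x))
        (λ x → ≈⇒congruent (*ₗ-identityˡ x))

    quotient : Module R m p
    quotient = fromRaw quotientRaw quotient-isModule

  module _ {m ℓm : Level} (M : Module R m ℓm) (k : ℕ) where
    private module M = Module M

    powerRaw : RawModule Carrier m ℓm
    powerRaw .RawModule.Carrierᴹ   = Fin k → M.Carrierᴹ
    powerRaw .RawModule._≈ᴹ_ f g   = ∀ i → f i M.≈ᴹ g i
    powerRaw .RawModule._+ᴹ_ f g i = f i M.+ᴹ g i
    powerRaw .RawModule._*ₗ_ a f i = a M.*ₗ f i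
    powerRaw .RawModule._*ᵣ_ f a i = a M.*ₗ f i
    powerRaw .RawModule.0ᴹ i       = M.0ᴹ
    powerRaw .RawModule.-ᴹ_ f i    = M.-ᴹ f i

    abstract
      power-isModule : IsModuleOn powerRaw
      power-isModule = makeIsModule
        (record
          { isGroup = record
            { isMonoid = record
              { isSemigroup = record
                { isMagma = record
                  { isEquivalence = record
                    { refl = λ _ → M.≈ᴹ-refl
                    ; sym = λ e i → M.≈ᴹ-sym (e i)
                    ; trans = λ e e′ i → M.≈ᴹ-trans (e i) (e′ i)
                    }
                  ; ∙-cong = λ e e′ i → M.+ᴹ-cong (e i) (e′ i)
                  }
                ; assoc = λ f g h i → M.+ᴹ-assoc (f i) (g i) (h i)
                }
              ; identity = (λ f i → M.+ᴹ-identityˡ (f i)) , (λ f i → M.+ᴹ-identityʳ (f i))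
              }
            ; inverse = (λ f i → M.-ᴹ‿inverseˡ (f i)) , (λ f i → M.-ᴹ‿inverseʳ (f i))
            ; ⁻¹-cong = λ e i → M.-ᴹ‿cong (e i)
            }
          ; comm = λ f g i → M.+ᴹ-comm (f i) (g i)
          })
        (λ e e′ i → M.*ₗ-cong e (e′ i))
        (λ a f g i → M.*ₗ-distribˡ a (f i) (g i))
        (λ f a b i → M.*ₗ-distribʳ (f i) a b)
        (λ a b f i → M.*ₗ-assoc a b (f i))
        (λ f i → M.*ₗ-identityˡ (f i))

    power : Module R m ℓm
    power = fromRaw powerRaw power-isModule

  record Hom {m ℓm n ℓn : Level} (M : Module R m ℓm) (N : Module R n ℓn)
             : Set (r ⊔ m ⊔ ℓm ⊔ n ⊔ ℓn) where
    no-eta-equality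
    private
      module M = Module M
      module N = Module N
    open ModuleMorphisms M.rawModule N.rawModule
    field
      ⟦_⟧   : M.Carrierᴹ → N.Carrierᴹ
      isHom : IsModuleHomomorphism ⟦_⟧
    open IsModuleHomomorphism isHom public

  open Hom public using (⟦_⟧)

  module _ {m ℓm n ℓn : Level} {M : Module R m ℓm} {N : Module R n ℓn} where
    private
      module M = Module M
      module N = Module N

    makeHom : (f : M.Carrierᴹ → N.Carrierᴹ) →
              (∀ {x y} → x M.≈ᴹ y → f x N.≈ᴹ f y) →
              (∀ x y → f (x M.+ᴹ y) N.≈ᴹ (f x N.+ᴹ f y)) →
              (∀ a x → f (a M.*ₗ x) N.≈ᴹ (a N.*ₗ f x)) →
              Hom M N
    makeHom f f-cong f-+ f-* = record
      { ⟦_⟧ = f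
      ; isHom = record
        { isBimoduleHomomorphism = record
          { +ᴹ-isGroupHomomorphism = record
            { isMonoidHomomorphism = record
              { isMagmaHomomorphism = record
                { isRelHomomorphism = record { cong = f-cong }
                ; homo = f-+
                }
              ; ε-homo = N.≈ᴹ-trans (f-cong (M.≈ᴹ-sym (M.*ₗ-zeroˡ M.0ᴹ)))
                  (N.≈ᴹ-trans (f-* 0# M.0ᴹ) (N.*ₗ-zeroˡ (f M.0ᴹ)))
              }
            ; ⁻¹-homo = λ x → N.≈ᴹ-trans (f-cong (M.≈ᴹ-sym (-1*ₗ M x)))
                (N.≈ᴹ-trans (f-* (- 1#) x) (-1*ₗ N (f x)))
            }
          ; *ₗ-homo = f-*
          ; *ᵣ-homo = λ a x → N.≈ᴹ-trans (f-cong (M.≈ᴹ-sym (M.*ₗ-*ᵣ-coincident a x)))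
              (N.≈ᴹ-trans (f-* a x) (N.*ₗ-*ᵣ-coincident a (f x)))
          }
        }
      }

    kernel : Hom M N → Submodule M ℓn
    kernel φ .Submodule.Contains x = ⟦ φ ⟧ x N.≈ᴹ N.0ᴹ
    kernel φ .Submodule.resp x≈y φx≈0 = N.≈ᴹ-trans (Hom.⟦⟧-cong φ (M.≈ᴹ-sym x≈y)) φx≈0
    kernel φ .Submodule.0-closed = Hom.0ᴹ-homo φ
    kernel φ .Submodule.+-closed {x} {y} e f = N.≈ᴹ-trans (Hom.+ᴹ-homo φ x y)
      (N.≈ᴹ-trans (N.+ᴹ-cong e f) (N.+ᴹ-identityˡ N.0ᴹ))
    kernel φ .Submodule.*-closed a {x} e = N.≈ᴹ-trans (Hom.*ₗ-homo φ a x)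
      (N.≈ᴹ-trans (N.*ₗ-cong refl e) (N.*ₗ-zeroʳ a))

  infix 4 _≈ʰ_
  record _≈ʰ_ {m ℓm n ℓn : Level} {M : Module R m ℓm} {N : Module R n ℓn} (φ ψ : Hom M N)
              : Set (m ⊔ ℓn) where
    constructor pointwise
    open Module N using (_≈ᴹ_)
    field
      agree : ∀ x → ⟦ φ ⟧ x ≈ᴹ ⟦ ψ ⟧ x

  open _≈ʰ_ public

  module _ {m ℓm n ℓn : Level} (M : Module R m ℓm) (N : Module R n ℓn) where
    private
      module M = Module M
      module N = Module N
    open CommutativeSemigroupProperties
      (AbelianGroup.commutativeSemigroup N.+ᴹ-abelianGroup) using (interchange)
    open AbelianGroupProperties N.+ᴹ-abelianGroup using (⁻¹-∙-comm)

    homModuleRaw : RawModule Carrier (r ⊔ m ⊔ ℓm ⊔ n ⊔ ℓn) (m ⊔ ℓn)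
    homModuleRaw .RawModule.Carrierᴹ = Hom M N
    homModuleRaw .RawModule._≈ᴹ_     = _≈ʰ_
    homModuleRaw .RawModule._+ᴹ_ φ ψ = makeHom (λ x → ⟦ φ ⟧ x N.+ᴹ ⟦ ψ ⟧ x)
      (λ e → N.+ᴹ-cong (φ.⟦⟧-cong e) (ψ.⟦⟧-cong e))
      (λ x y → N.≈ᴹ-trans (N.+ᴹ-cong (φ.+ᴹ-homo x y) (ψ.+ᴹ-homo x y))
        (interchange (⟦ φ ⟧ x) (⟦ φ ⟧ y) (⟦ ψ ⟧ x) (⟦ ψ ⟧ y)))
      (λ a x → N.≈ᴹ-trans (N.+ᴹ-cong (φ.*ₗ-homo a x) (ψ.*ₗ-homo a x))
        (N.≈ᴹ-sym (N.*ₗ-distribˡ a (⟦ φ ⟧ x) (⟦ ψ ⟧ x))))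
      where
      module φ = Hom φ
      module ψ = Hom ψ
    homModuleRaw .RawModule._*ₗ_ b φ = makeHom (λ x → b N.*ₗ ⟦ φ ⟧ x)
      (λ e → N.*ₗ-cong refl (φ.⟦⟧-cong e))
      (λ x y → N.≈ᴹ-trans (N.*ₗ-cong refl (φ.+ᴹ-homo x y)) (N.*ₗ-distribˡ b (⟦ φ ⟧ x) (⟦ φ ⟧ y)))
      (λ a x → N.≈ᴹ-trans (N.*ₗ-cong refl (φ.*ₗ-homo a x)) (N.*ₗ-comm b a (⟦ φ ⟧ x)))
      where module φ = Hom φ
    homModuleRaw .RawModule._*ᵣ_ φ b = homModuleRaw .RawModule._*ₗ_ b φ
    homModuleRaw .RawModule.0ᴹ       = makeHom (λ _ → N.0ᴹ) (λ _ → N.≈ᴹ-refl)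
      (λ _ _ → N.≈ᴹ-sym (N.+ᴹ-identityˡ N.0ᴹ)) (λ a _ → N.≈ᴹ-sym (N.*ₗ-zeroʳ a))
    homModuleRaw .RawModule.-ᴹ_ φ    = makeHom (λ x → N.-ᴹ (⟦ φ ⟧ x))
      (λ e → N.-ᴹ‿cong (φ.⟦⟧-cong e))
      (λ x y → N.≈ᴹ-trans (N.-ᴹ‿cong (φ.+ᴹ-homo x y)) (N.≈ᴹ-sym (⁻¹-∙-comm (⟦ φ ⟧ x) (⟦ φ ⟧ y))))
      (λ a x → N.≈ᴹ-trans (N.-ᴹ‿cong (φ.*ₗ-homo a x))
        (N.≈ᴹ-trans (N.≈ᴹ-sym (-1*ₗ N (a N.*ₗ ⟦ φ ⟧ x)))
        (N.≈ᴹ-trans (N.*ₗ-comm (- 1#) a (⟦ φ ⟧ x)) (N.*ₗ-cong refl (-1*ₗ N (⟦ φ ⟧ x))))))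
      where module φ = Hom φ

    abstract
      homModule-isModule : IsModuleOn homModuleRaw
      homModule-isModule = makeIsModule
        (record
          { isGroup = record
            { isMonoid = record
              { isSemigroup = record
                { isMagma = record
                  { isEquivalence = record
                    { refl = pointwise λ _ → N.≈ᴹ-refl
                    ; sym = λ e → pointwise λ x → N.≈ᴹ-sym (agree e x)
                    ; trans = λ e f → pointwise λ x → N.≈ᴹ-trans (agree e x) (agree f x)
                    }
                  ; ∙-cong = λ e f → pointwise λ x → N.+ᴹ-cong (agree e x) (agree f x)
                  }
                ; assoc = λ φ ψ χ → pointwise λ x → N.+ᴹ-assoc (⟦ φ ⟧ x) (⟦ ψ ⟧ x) (⟦ χ ⟧ x)
                }
              ; identity = (λ φ → pointwise λ x → N.+ᴹ-identityˡ (⟦ φ ⟧ x)) ,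
                  (λ φ → pointwise λ x → N.+ᴹ-identityʳ (⟦ φ ⟧ x))
              }
            ; inverse = (λ φ → pointwise λ x → N.-ᴹ‿inverseˡ (⟦ φ ⟧ x)) ,
                (λ φ → pointwise λ x → N.-ᴹ‿inverseʳ (⟦ φ ⟧ x))
            ; ⁻¹-cong = λ e → pointwise λ x → N.-ᴹ‿cong (agree e x)
            }
          ; comm = λ φ ψ → pointwise λ x → N.+ᴹ-comm (⟦ φ ⟧ x) (⟦ ψ ⟧ x)
          })
        (λ e f → pointwise λ x → N.*ₗ-cong e (agree f x))
        (λ a φ ψ → pointwise λ x → N.*ₗ-distribˡ a (⟦ φ ⟧ x) (⟦ ψ ⟧ x))
        (λ φ a b → pointwise λ x → N.*ₗ-distribʳ (⟦ φ ⟧ x) a b)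
        (λ a b φ → pointwise λ x → N.*ₗ-assoc a b (⟦ φ ⟧ x))
        (λ φ → pointwise λ x → N.*ₗ-identityˡ (⟦ φ ⟧ x))

    homModule : Module R (r ⊔ m ⊔ ℓm ⊔ n ⊔ ℓn) (m ⊔ ℓn)
    homModule = fromRaw homModuleRaw homModule-isModule

  IsZero : ∀ {m ℓm} → Module R m ℓm → Set (m ⊔ ℓm)
  IsZero M = ∀ x → x ≈ᴹ 0ᴹ
    where open Module M

  linearCombination : ∀ {m ℓm} (M : Module R m ℓm) {d : ℕ} →
                      (Fin d → Carrier) → (Fin d → Module.Carrierᴹ M) → Module.Carrierᴹ M
  linearCombination M k b = sum (λ i → k i *ₗ b i)
    where
    open Module M
    open MonoidSum +ᴹ-commutativeMonoid using (sum)

  record HasDimension {m ℓm : Level} (M : Module R m ℓm) (d : ℕ) : Set (r ⊔ ℓr ⊔ m ⊔ ℓm) where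
    open Module M
    field
      basis       : Fin d → Carrierᴹ
      spanning    : ∀ x → ∃ λ k → x ≈ᴹ linearCombination M k basis
      independent : ∀ k → linearCombination M k basis ≈ᴹ 0ᴹ → ∀ i → k i ≈ 0#

module _
  {a ℓa b ℓb m ℓm : Level} {A : CommutativeRing a ℓa} {B : CommutativeRing b ℓb}
  (f : CommutativeRing.Carrier A → CommutativeRing.Carrier B)
  (f-homo : RingMorphisms.IsRingHomomorphism (CommutativeRing.rawRing A) (CommutativeRing.rawRing B) f)
  (M : Module B m ℓm)
  where
  private
    module M = Module M
    module f = RingMorphisms.IsRingHomomorphism f-homo

  restrictScalarsRaw : RawModule (CommutativeRing.Carrier A) m ℓm
  restrictScalarsRaw .RawModule.Carrierᴹ = M.Carrierᴹ
  restrictScalarsRaw .RawModule._≈ᴹ_     = M._≈ᴹ_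
  restrictScalarsRaw .RawModule._+ᴹ_     = M._+ᴹ_
  restrictScalarsRaw .RawModule._*ₗ_ a x = f a M.*ₗ x
  restrictScalarsRaw .RawModule._*ᵣ_ x a = f a M.*ₗ x
  restrictScalarsRaw .RawModule.0ᴹ       = M.0ᴹ
  restrictScalarsRaw .RawModule.-ᴹ_      = M.-ᴹ_

  abstract
    restrictScalars-isModule : IsModuleOn {R = A} restrictScalarsRaw
    restrictScalars-isModule = makeIsModule {R = A} M.+ᴹ-isAbelianGroup
      (λ e e′ → M.*ₗ-cong (f.⟦⟧-cong e) e′)
      (λ a x y → M.*ₗ-distribˡ (f a) x y)
      (λ x a b → M.≈ᴹ-trans (M.*ₗ-cong (f.+-homo a b) M.≈ᴹ-refl) (M.*ₗ-distribʳ x (f a) (f b)))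
      (λ a b x → M.≈ᴹ-trans (M.*ₗ-cong (f.*-homo a b) M.≈ᴹ-refl) (M.*ₗ-assoc (f a) (f b) x))
      (λ x → M.≈ᴹ-trans (M.*ₗ-cong f.1#-homo M.≈ᴹ-refl) (M.*ₗ-identityˡ x))

  restrictScalars : Module A m ℓm
  restrictScalars = fromRaw {R = A} restrictScalarsRaw restrictScalars-isModule

module _ {r ℓr : Level} {R : CommutativeRing r ℓr} where
  open CommutativeRing R hiding (zero)

  abstract
    regular-isModule : IsModule R _≈_ _+_ 0# -_ _*_ _*_
    regular-isModule = Module.isModule TensorUnit.⟨module⟩

  regular : Module R r ℓr
  regular .Module.Carrierᴹ = Carrier
  regular .Module._≈ᴹ_     = _≈_
  regular .Module._+ᴹ_     = _+_
  regular .Module._*ₗ_     = _*_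
  regular .Module._*ᵣ_     = _*_
  regular .Module.0ᴹ       = 0#
  regular .Module.-ᴹ_      = -_
  regular .Module.isModule = regular-isModule

  Ideal : (p : Level) → Set (r ⊔ ℓr ⊔ suc p)
  Ideal p = Submodule regular p

  module _ {p : Level} (I : Ideal p) where
    open RingProperties ring using ([y-z]x≈yx-zx)
    private
      module I = Submodule I

      congruent-*-right : ∀ {x y} z → Congruent I x y → Congruent I (x * z) (y * z)
      congruent-*-right {x} {y} z e = congruent (I.resp
        (trans (*-comm z (x - y)) ([y-z]x≈yx-zx z x y))
        (I.*-closed z (difference e)))

    abstract
      quotientRing-isCommutativeRing : IsCommutativeRing (Congruent I) _+_ _*_ -_ 0# 1#
      quotientRing-isCommutativeRing = record
        { isRing = record
          { +-isAbelianGroup = quotient-isAbelianGroup I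
          ; *-cong = λ {x} {y} {u} {v} e f → IsEquivalence.trans (congruent-isEquivalence I)
              (congruent-*-right u e) (congruent-*ₗ I refl f)
          ; *-assoc = λ x y z → ≈⇒congruent I (*-assoc x y z)
          ; *-identity = (λ x → ≈⇒congruent I (*-identityˡ x)) , (λ x → ≈⇒congruent I (*-identityʳ x))
          ; distrib = (λ x y z → ≈⇒congruent I (distribˡ x y z)) , (λ x y z → ≈⇒congruent I (distribʳ x y z))
          }
        ; *-comm = λ x y → ≈⇒congruent I (*-comm x y)
        }

    quotientRing : CommutativeRing r p
    quotientRing .CommutativeRing.Carrier = Carrier
    quotientRing .CommutativeRing._≈_     = Congruent I
    quotientRing .CommutativeRing._+_     = _+_
    quotientRing .CommutativeRing._*_     = _*_
    quotientRing .CommutativeRing.-_      = -_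
    quotientRing .CommutativeRing.0#      = 0#
    quotientRing .CommutativeRing.1#      = 1#
    quotientRing .CommutativeRing.isCommutativeRing = quotientRing-isCommutativeRing

    abstract
      projection-isRingHomomorphism :
        RingMorphisms.IsRingHomomorphism rawRing (CommutativeRing.rawRing quotientRing) id
      projection-isRingHomomorphism = record
        { isSemiringHomomorphism = record
          { isNearSemiringHomomorphism = record
            { +-isMonoidHomomorphism = record
              { isMagmaHomomorphism = record
                { isRelHomomorphism = record { cong = ≈⇒congruent I }
                ; homo = λ x y → Q.refl {x + y}
                }
              ; ε-homo = Q.refl {0#}
              }
            ; *-homo = λ x y → Q.refl {x * y}
            }
          ; 1#-homo = Q.refl {1#}
          }
        ; -‿homo = λ x → Q.refl { - x }
        }
        where module Q = CommutativeRing quotientRing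

    Annihilates : ∀ {m ℓm} → Module R m ℓm → Set (r ⊔ p ⊔ m ⊔ ℓm)
    Annihilates M = ∀ a → Contains I a → ∀ x → a *ₗ x ≈ᴹ 0ᴹ
      where open Module M

    -- An R-module annihilated by I, regarded as an R/I-module.
    descendRaw : ∀ {m ℓm} (M : Module R m ℓm) → Annihilates M → RawModule Carrier m ℓm
    descendRaw M IM≈0 .RawModule.Carrierᴹ = Module.Carrierᴹ M
    descendRaw M IM≈0 .RawModule._≈ᴹ_     = Module._≈ᴹ_ M
    descendRaw M IM≈0 .RawModule._+ᴹ_     = Module._+ᴹ_ M
    descendRaw M IM≈0 .RawModule._*ₗ_     = Module._*ₗ_ M
    descendRaw M IM≈0 .RawModule._*ᵣ_ x a = Module._*ₗ_ M a x
    descendRaw M IM≈0 .RawModule.0ᴹ       = Module.0ᴹ M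
    descendRaw M IM≈0 .RawModule.-ᴹ_      = Module.-ᴹ_ M

    abstract
      descend-isModule : ∀ {m ℓm} (M : Module R m ℓm) (IM≈0 : Annihilates M) →
        IsModuleOn {R = quotientRing} (descendRaw M IM≈0)
      descend-isModule M IM≈0 = makeIsModule {R = quotientRing} M.+ᴹ-isAbelianGroup
        (λ e e′ → M.≈ᴹ-trans (scalars e _) (M.*ₗ-cong refl e′))
        M.*ₗ-distribˡ M.*ₗ-distribʳ M.*ₗ-assoc M.*ₗ-identityˡ
        where
        module M = Module M
        scalars : ∀ {a b} → Congruent I a b → ∀ x → a M.*ₗ x M.≈ᴹ b M.*ₗ x
        scalars {a} {b} e x =
          M.≈ᴹ-trans (M.*ₗ-cong (sym (trans (+-assoc a (- b) b)
                     (trans (+-congˡ (-‿inverseˡ b)) (+-identityʳ a)))) M.≈ᴹ-refl)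
          (M.≈ᴹ-trans (M.*ₗ-distribʳ x (a - b) b)
          (M.≈ᴹ-trans (M.+ᴹ-congʳ (IM≈0 (a - b) (difference e) x)) (M.+ᴹ-identityˡ (b M.*ₗ x))))

    descend : ∀ {m ℓm} (M : Module R m ℓm) → Annihilates M → Module quotientRing m ℓm
    descend M IM≈0 = fromRaw {R = quotientRing} (descendRaw M IM≈0) (descend-isModule M IM≈0)

-- A is an algebra over K through ι, and a grading of an A-module is its
-- family of homogeneous components, which are K-subspaces.
module Graded
  {k ℓk a ℓa : Level} {K : CommutativeRing k ℓk} {A : CommutativeRing a ℓa}
  (ι : CommutativeRing.Carrier K → CommutativeRing.Carrier A)
  (ι-homo : RingMorphisms.IsRingHomomorphism (CommutativeRing.rawRing K) (CommutativeRing.rawRing A) ι)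
  (n : ℕ)
  where
  private
    module A = CommutativeRing A

  Degree : Set
  Degree = Vec ℤ n

  _+ᵈ_ : Degree → Degree → Degree
  _+ᵈ_ = Vec.zipWith ℤ._+_

  _-ᵈ_ : Degree → Degree → Degree
  _-ᵈ_ = Vec.zipWith ℤ._-_

  underlying : ∀ {m ℓm} → Module A m ℓm → Module K m ℓm
  underlying = restrictScalars ι ι-homo

  record Grading {m ℓm : Level} (M : Module A m ℓm) (p : Level) : Set (k ⊔ m ⊔ ℓm ⊔ suc p) where
    no-eta-equality
    constructor grading
    field
      component : Degree → Submodule (underlying M) p

  open Grading public

  -- The basis element i of the free module is placed in degree `shift i`.
  shiftedPowerGrading : ∀ {m ℓm p j} {M : Module A m ℓm} → (Fin j → Degree) →
                        Grading M p → Grading (power M j) p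
  shiftedPowerGrading shift Γ = grading λ c → record
    { Contains = λ f → ∀ i → Contains (component Γ (c -ᵈ shift i)) (f i)
    ; resp     = λ e f∈ i → Submodule.resp (component Γ (c -ᵈ shift i)) (e i) (f∈ i)
    ; 0-closed = λ i → Submodule.0-closed (component Γ (c -ᵈ shift i))
    ; +-closed = λ f∈ g∈ i → Submodule.+-closed (component Γ (c -ᵈ shift i)) (f∈ i) (g∈ i)
    ; *-closed = λ b f∈ i → Submodule.*-closed (component Γ (c -ᵈ shift i)) b (f∈ i)
    }

  submoduleGrading : ∀ {m ℓm p q} {M : Module A m ℓm} (N : Submodule M q) →
                     Grading M p → Grading (submodule N) p
  submoduleGrading N Γ = grading λ c → record
    { Contains = λ x → Contains (component Γ c) (proj₁ x)
    ; resp     = λ e x∈ → Submodule.resp (component Γ c) e x∈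
    ; 0-closed = Submodule.0-closed (component Γ c)
    ; +-closed = λ x∈ y∈ → Submodule.+-closed (component Γ c) x∈ y∈
    ; *-closed = λ b {x} x∈ → Submodule.*-closed (component Γ c) b x∈
    }

  -- A class is homogeneous when it has a homogeneous representative.
  quotientGrading : ∀ {m ℓm p q} {M : Module A m ℓm} (N : Submodule M q) →
                    Grading M p → Grading (quotient N) (m ⊔ p ⊔ q)
  quotientGrading N Γ = grading λ c → record
    { Contains = λ x → ∃ λ y → Contains (component Γ c) y × Congruent N y x
    ; resp     = λ { e (y , y∈ , e′) → y , y∈ , Q.≈ᴹ-trans e′ e }
    ; 0-closed = _ , Submodule.0-closed (component Γ c) , Q.≈ᴹ-refl
    ; +-closed = λ { (y , y∈ , e) (z , z∈ , e′) →
        _ , Submodule.+-closed (component Γ c) y∈ z∈ , Q.+ᴹ-cong e e′ }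
    ; *-closed = λ { b (y , y∈ , e) →
        _ , Submodule.*-closed (component Γ c) b y∈ , Q.*ₗ-cong A.refl e }
    }
    where module Q = Module (quotient N)

  homGrading : ∀ {m ℓm n ℓn p q} {M : Module A m ℓm} {N : Module A n ℓn} →
               Grading M p → Grading N q → Grading (homModule M N) (m ⊔ p ⊔ q)
  homGrading Γ Δ = grading λ c → record
    { Contains = λ φ → ∀ a x → Contains (component Γ a) x → Contains (component Δ (a +ᵈ c)) (⟦ φ ⟧ x)
    ; resp     = λ e φ∈ a x x∈ → Submodule.resp (component Δ (a +ᵈ c)) (agree e x) (φ∈ a x x∈)
    ; 0-closed = λ a x x∈ → Submodule.0-closed (component Δ (a +ᵈ c))
    ; +-closed = λ φ∈ ψ∈ a x x∈ → Submodule.+-closed (component Δ (a +ᵈ c)) (φ∈ a x x∈) (ψ∈ a x x∈)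
    ; *-closed = λ b φ∈ a x x∈ → Submodule.*-closed (component Δ (a +ᵈ c)) b (φ∈ a x x∈)
    }

-- Gradings of A-modules annihilated by an ideal I, viewed as A/I-modules.
module _
  {k ℓk a ℓa p : Level} {K : CommutativeRing k ℓk} {A : CommutativeRing a ℓa}
  (ι : CommutativeRing.Carrier K → CommutativeRing.Carrier A)
  (ι-homo : RingMorphisms.IsRingHomomorphism (CommutativeRing.rawRing K) (CommutativeRing.rawRing A) ι)
  (n : ℕ) (I : Ideal {R = A} p)
  where

  abstract
    quotient-ι-homo : RingMorphisms.IsRingHomomorphism
      (CommutativeRing.rawRing K) (CommutativeRing.rawRing (quotientRing I)) ι
    quotient-ι-homo = Composition.isRingHomomorphism
      (CommutativeRing.trans (quotientRing I)) ι-homo (projection-isRingHomomorphism I)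

  private
    module G  = Graded {K = K} {A = A} ι ι-homo n
    module G/ = Graded {K = K} {A = quotientRing I} ι quotient-ι-homo n

  descendGrading : ∀ {m ℓm q} (M : Module A m ℓm) (ann : Annihilates I M) →
                   G.Grading M q → G/.Grading (descend I M ann) q
  descendGrading M ann Γ = G/.grading λ c → record
    { Contains = Contains (G.component Γ c)
    ; resp     = λ e x∈ → Submodule.resp (G.component Γ c) e x∈
    ; 0-closed = Submodule.0-closed (G.component Γ c)
    ; +-closed = λ x∈ y∈ → Submodule.+-closed (G.component Γ c) x∈ y∈
    ; *-closed = λ b {x} x∈ → Submodule.*-closed (G.component Γ c) b x∈
    }

  quotientRingGrading : ∀ {q} → G.Grading regular q → G/.Grading regular (a ⊔ p ⊔ q)
  quotientRingGrading Γ = G/.grading λ c → record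
    { Contains = λ x → ∃ λ y → Contains (G.component Γ c) y × Congruent I y x
    ; resp     = λ { e (y , y∈ , e′) → y , y∈ , A/I.trans e′ e }
    ; 0-closed = A.0# , Submodule.0-closed (G.component Γ c) , A/I.refl
    ; +-closed = λ { (y , y∈ , e) (z , z∈ , e′) →
        y A.+ z , Submodule.+-closed (G.component Γ c) y∈ z∈ , A/I.+-cong e e′ }
    ; *-closed = λ { b (y , y∈ , e) →
        ι b A.* y , Submodule.*-closed (G.component Γ c) b y∈ , A/I.*-congˡ e }
    }
    where
    module A = CommutativeRing A
    module A/I = CommutativeRing (quotientRing I)

-- A polynomial is a list of terms, in any order and possibly with
-- repeated exponents; polynomials are equal when their coefficients are.
module Polynomials {c ℓ : Level} (K : CommutativeRing c ℓ) (n : ℕ) where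
  private
    module K = CommutativeRing K
  open RingProperties K.ring using (-‿distribˡ-*; -0#≈0#)
  open AbelianGroupProperties K.+-abelianGroup using (⁻¹-∙-comm)
  open CommutativeSemigroupProperties K.+-commutativeSemigroup using (interchange)
  open CommutativeSemigroupProperties K.*-commutativeSemigroup using (x∙yz≈y∙xz)

  Exponent : Set
  Exponent = Vec ℕ n

  _+ᵉ_ : Exponent → Exponent → Exponent
  _+ᵉ_ = Vec.zipWith ℕ._+_

  0ᵉ : Exponent
  0ᵉ = Vec.replicate n 0

  _≟ᵉ_ : (e f : Exponent) → Dec (e ≡ f)
  _≟ᵉ_ = Vecₚ.≡-dec ℕₚ._≟_

  Polynomial : Set c
  Polynomial = List (K.Carrier × Exponent)

  -- The K-linear extension to polynomials of a function on monomials.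
  extend : (Exponent → K.Carrier) → Polynomial → K.Carrier
  extend w []            = K.0#
  extend w ((k , e) ∷ p) = (k K.* w e) K.+ extend w p

  δ : Exponent → Exponent → K.Carrier
  δ a e = if does (e ≟ᵉ a) then K.1# else K.0#

  coefficient : Polynomial → Exponent → K.Carrier
  coefficient p a = extend (δ a) p

  infix 4 _≈ᵖ_
  record _≈ᵖ_ (p q : Polynomial) : Set ℓ where
    constructor coefficientwise
    field
      coefficients : ∀ a → coefficient p a K.≈ coefficient q a
  open _≈ᵖ_ public

  infixl 6 _+ᵖ_
  infixl 7 _*ᵖ_

  _+ᵖ_ : Polynomial → Polynomial → Polynomial
  _+ᵖ_ = _++_

  -ᵖ_ : Polynomial → Polynomial
  -ᵖ_ = List.map (λ (k , e) → K.- k , e)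

  _*ᵗ_ : K.Carrier × Exponent → K.Carrier × Exponent → K.Carrier × Exponent
  (k , e) *ᵗ (l , f) = k K.* l , e +ᵉ f

  _*ᵖ_ : Polynomial → Polynomial → Polynomial
  []      *ᵖ q = []
  (t ∷ p) *ᵖ q = List.map (t *ᵗ_) q +ᵖ p *ᵖ q

  constant : K.Carrier → Polynomial
  constant k = (k , 0ᵉ) ∷ []

  monomial : Exponent → Polynomial
  monomial e = (K.1# , e) ∷ []

  extend-+ : ∀ w p q → extend w (p +ᵖ q) K.≈ extend w p K.+ extend w q
  extend-+ w []            q = K.sym (K.+-identityˡ (extend w q))
  extend-+ w ((k , e) ∷ p) q =
    K.trans (K.+-congˡ (extend-+ w p q)) (K.sym (K.+-assoc (k K.* w e) (extend w p) (extend w q)))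

  extend-neg : ∀ w p → extend w (-ᵖ p) K.≈ K.- extend w p
  extend-neg w []            = K.sym -0#≈0#
  extend-neg w ((k , e) ∷ p) =
    K.trans (K.+-cong (K.sym (-‿distribˡ-* k (w e))) (extend-neg w p)) (⁻¹-∙-comm (k K.* w e) (extend w p))

  extend-cong : ∀ {w w′} → (∀ e → w e K.≈ w′ e) → ∀ p → extend w p K.≈ extend w′ p
  extend-cong w≈w′ []            = K.refl
  extend-cong w≈w′ ((k , e) ∷ p) = K.+-cong (K.*-congˡ (w≈w′ e)) (extend-cong w≈w′ p)

  extend-zero : ∀ p → extend (λ _ → K.0#) p K.≈ K.0#
  extend-zero []            = K.refl
  extend-zero ((k , e) ∷ p) =
    K.trans (K.+-cong (K.zeroʳ k) (extend-zero p)) (K.+-identityˡ K.0#)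

  extend-linear : ∀ w w′ k p → extend (λ f → (k K.* w f) K.+ w′ f) p K.≈ (k K.* extend w p) K.+ extend w′ p
  extend-linear w w′ k []            =
    K.sym (K.trans (K.+-identityʳ (k K.* K.0#)) (K.zeroʳ k))
  extend-linear w w′ k ((l , e) ∷ p) =
    K.trans (K.+-cong (K.distribˡ l (k K.* w e) (w′ e)) (extend-linear w w′ k p))
    (K.trans (K.+-congʳ (K.+-congʳ (x∙yz≈y∙xz l k (w e))))
    (K.trans (interchange (k K.* (l K.* w e)) (l K.* w′ e) (k K.* extend w p) (extend w′ p))
    (K.+-congʳ (K.sym (K.distribˡ k (l K.* w e) (extend w p))))))

  extend-term : ∀ w k e q → extend w (List.map ((k , e) *ᵗ_) q) K.≈ k K.* extend (λ f → w (e +ᵉ f)) q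
  extend-term w k e []            = K.sym (K.zeroʳ k)
  extend-term w k e ((l , f) ∷ q) =
    K.trans (K.+-cong (K.*-assoc k l (w (e +ᵉ f))) (extend-term w k e q))
    (K.sym (K.distribˡ k (l K.* w (e +ᵉ f)) (extend (λ f → w (e +ᵉ f)) q)))

  extend-* : ∀ w p q → extend w (p *ᵖ q) K.≈ extend (λ e → extend (λ f → w (e +ᵉ f)) q) p
  extend-* w []            q = K.refl
  extend-* w ((k , e) ∷ p) q =
    K.trans (extend-+ w (List.map ((k , e) *ᵗ_) q) (p *ᵖ q))
    (K.+-cong (extend-term w k e q) (extend-* w p q))

  extend-swap : ∀ (w : Exponent → Exponent → K.Carrier) p q →
                extend (λ e → extend (w e) q) p K.≈ extend (λ f → extend (λ e → w e f) p) q
  extend-swap w []            q = K.sym (extend-zero q)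
  extend-swap w ((k , e) ∷ p) q =
    K.trans (K.+-congˡ (extend-swap w p q))
    (K.sym (extend-linear (w e) (λ f → extend (λ e′ → w e′ f) p) k q))

  +ᵉ-assoc : ∀ e f g → (e +ᵉ f) +ᵉ g ≡ e +ᵉ (f +ᵉ g)
  +ᵉ-assoc = Vecₚ.zipWith-assoc ℕₚ.+-assoc

  +ᵉ-comm : ∀ e f → e +ᵉ f ≡ f +ᵉ e
  +ᵉ-comm = Vecₚ.zipWith-comm ℕₚ.+-comm

  +ᵉ-identityˡ : ∀ e → 0ᵉ +ᵉ e ≡ e
  +ᵉ-identityˡ = Vecₚ.zipWith-identityˡ ℕₚ.+-identityˡ

  cancel : ∀ {m} (e f : Vec ℕ m) → Vec.zipWith ℕ._∸_ (Vec.zipWith ℕ._+_ e f) e ≡ f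
  cancel []      []      = ≡.refl
  cancel (x ∷ e) (y ∷ f) = ≡.cong₂ _∷_ (ℕₚ.m+n∸m≡n x y) (cancel e f)

  δ-hit : ∀ a → δ a a K.≈ K.1#
  δ-hit a with a ≟ᵉ a
  ... | yes _  = K.refl
  ... | no a≢a = contradiction ≡.refl a≢a

  δ-miss : ∀ {a e} → e ≢ a → δ a e K.≈ K.0#
  δ-miss {a} {e} e≢a with e ≟ᵉ a
  ... | yes e≡a = contradiction e≡a e≢a
  ... | no _    = K.refl

  extend-shift : ∀ {p q} → p ≈ᵖ q → ∀ a e →
                 extend (λ f → δ a (e +ᵉ f)) p K.≈ extend (λ f → δ a (e +ᵉ f)) q
  extend-shift {p} {q} p≈q a e with (e +ᵉ Vec.zipWith ℕ._∸_ a e) ≟ᵉ a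
  ... | yes e+g≡a = K.trans (extend-cong shift p)
    (K.trans (coefficients p≈q g) (K.sym (extend-cong shift q)))
    where
    g = Vec.zipWith ℕ._∸_ a e
    shift : ∀ f → δ a (e +ᵉ f) K.≈ δ g f
    shift f with f ≟ᵉ g
    ... | yes f≡g = K.trans (K.reflexive (≡.cong (δ a) (≡.trans (≡.cong (e +ᵉ_) f≡g) e+g≡a))) (δ-hit a)
    ... | no  f≢g = δ-miss (λ e+f≡a → f≢g
      (≡.trans (≡.sym (cancel e f)) (≡.cong (λ h → Vec.zipWith ℕ._∸_ h e) e+f≡a)))
  ... | no e+g≢a = K.trans (extend-cong miss p) (K.trans (extend-zero p)
    (K.sym (K.trans (extend-cong miss q) (extend-zero q))))
    where
    miss : ∀ f → δ a (e +ᵉ f) K.≈ K.0#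
    miss f = δ-miss (λ e+f≡a → e+g≢a
      (≡.trans (≡.cong (e +ᵉ_) (≡.trans (≡.cong (λ h → Vec.zipWith ℕ._∸_ h e) (≡.sym e+f≡a)) (cancel e f))) e+f≡a))

  extends⇒≈ᵖ : ∀ {p q} → (∀ w → extend w p K.≈ extend w q) → p ≈ᵖ q
  extends⇒≈ᵖ p≈q = coefficientwise (λ a → p≈q (δ a))

  extend-reindex : ∀ (w : Exponent → K.Carrier) {e e′} → e ≡ e′ → w e K.≈ w e′
  extend-reindex w e≡e′ = K.reflexive (≡.cong w e≡e′)

  ≈ᵖ-isEquivalence : IsEquivalence _≈ᵖ_
  ≈ᵖ-isEquivalence = record
    { refl  = coefficientwise (λ _ → K.refl)
    ; sym   = λ e → coefficientwise (λ a → K.sym (coefficients e a))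
    ; trans = λ e f → coefficientwise (λ a → K.trans (coefficients e a) (coefficients f a))
    }

  private module E = IsEquivalence ≈ᵖ-isEquivalence

  +ᵖ-cong : ∀ {p q r s} → p ≈ᵖ q → r ≈ᵖ s → p +ᵖ r ≈ᵖ q +ᵖ s
  +ᵖ-cong {p} {q} {r} {s} e f = coefficientwise (λ a →
    K.trans (extend-+ (δ a) p r)
    (K.trans (K.+-cong (coefficients e a) (coefficients f a)) (K.sym (extend-+ (δ a) q s))))

  +ᵖ-comm : ∀ p q → p +ᵖ q ≈ᵖ q +ᵖ p
  +ᵖ-comm p q = extends⇒≈ᵖ (λ w → K.trans (extend-+ w p q)
    (K.trans (K.+-comm (extend w p) (extend w q)) (K.sym (extend-+ w q p))))

  -ᵖ-cong : ∀ {p q} → p ≈ᵖ q → -ᵖ p ≈ᵖ -ᵖ q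
  -ᵖ-cong {p} {q} e = coefficientwise (λ a → K.trans (extend-neg (δ a) p)
    (K.trans (K.-‿cong (coefficients e a)) (K.sym (extend-neg (δ a) q))))

  -ᵖ-inverseʳ : ∀ p → p +ᵖ -ᵖ p ≈ᵖ []
  -ᵖ-inverseʳ p = extends⇒≈ᵖ (λ w → K.trans (extend-+ w p (-ᵖ p))
    (K.trans (K.+-congˡ (extend-neg w p)) (K.-‿inverseʳ (extend w p))))

  *ᵖ-comm : ∀ p q → p *ᵖ q ≈ᵖ q *ᵖ p
  *ᵖ-comm p q = extends⇒≈ᵖ (λ w → K.trans (extend-* w p q)
    (K.trans (extend-swap (λ e f → w (e +ᵉ f)) p q)
    (K.trans (extend-cong (λ f → extend-cong (λ e → extend-reindex w (+ᵉ-comm e f)) p) q)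
    (K.sym (extend-* w q p)))))

  *ᵖ-congˡ : ∀ p {q r} → q ≈ᵖ r → p *ᵖ q ≈ᵖ p *ᵖ r
  *ᵖ-congˡ p {q} {r} e = coefficientwise (λ a → K.trans (extend-* (δ a) p q)
    (K.trans (extend-cong (extend-shift e a) p) (K.sym (extend-* (δ a) p r))))

  *ᵖ-cong : ∀ {p q r s} → p ≈ᵖ q → r ≈ᵖ s → p *ᵖ r ≈ᵖ q *ᵖ s
  *ᵖ-cong {p} {q} {r} {s} e f =
    E.trans (*ᵖ-congˡ p f) (E.trans (*ᵖ-comm p s) (E.trans (*ᵖ-congˡ s e) (*ᵖ-comm s q)))

  *ᵖ-assoc : ∀ p q r → (p *ᵖ q) *ᵖ r ≈ᵖ p *ᵖ (q *ᵖ r)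
  *ᵖ-assoc p q r = extends⇒≈ᵖ (λ w → K.trans (extend-* w (p *ᵖ q) r)
    (K.trans (extend-* (λ e → extend (λ g → w (e +ᵉ g)) r) p q)
    (K.trans (extend-cong (λ e → K.trans
        (extend-cong (λ f → extend-cong (λ g → extend-reindex w (+ᵉ-assoc e f g)) r) q)
        (K.sym (extend-* (λ h → w (e +ᵉ h)) q r))) p)
    (K.sym (extend-* w p (q *ᵖ r))))))

  *ᵖ-identityˡ : ∀ p → constant K.1# *ᵖ p ≈ᵖ p
  *ᵖ-identityˡ p = extends⇒≈ᵖ (λ w → K.trans (extend-* w (constant K.1#) p)
    (K.trans (K.+-identityʳ _) (K.trans (K.*-identityˡ _)
    (extend-cong (λ e → extend-reindex w (+ᵉ-identityˡ e)) p))))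

  *ᵖ-distribʳ : ∀ p q r → (q +ᵖ r) *ᵖ p ≈ᵖ q *ᵖ p +ᵖ r *ᵖ p
  *ᵖ-distribʳ p q r = extends⇒≈ᵖ (λ w → K.trans (extend-* w (q +ᵖ r) p)
    (K.trans (extend-+ (λ e → extend (λ f → w (e +ᵉ f)) p) q r)
    (K.trans (K.+-cong (K.sym (extend-* w q p)) (K.sym (extend-* w r p)))
    (K.sym (extend-+ w (q *ᵖ p) (r *ᵖ p))))))

  *ᵖ-distribˡ : ∀ p q r → p *ᵖ (q +ᵖ r) ≈ᵖ p *ᵖ q +ᵖ p *ᵖ r
  *ᵖ-distribˡ p q r = E.trans (*ᵖ-comm p (q +ᵖ r)) (E.trans (*ᵖ-distribʳ p q r)
    (+ᵖ-cong (*ᵖ-comm q p) (*ᵖ-comm r p)))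

  abstract
    polynomialRing-isCommutativeRing : IsCommutativeRing _≈ᵖ_ _+ᵖ_ _*ᵖ_ -ᵖ_ [] (constant K.1#)
    polynomialRing-isCommutativeRing = record
      { isRing = record
        { +-isAbelianGroup = record
          { isGroup = record
            { isMonoid = record
              { isSemigroup = record
                { isMagma = record { isEquivalence = ≈ᵖ-isEquivalence ; ∙-cong = +ᵖ-cong }
                ; assoc = λ p q r → E.reflexive (Listₚ.++-assoc p q r)
                }
              ; identity = (λ p → E.refl) , (λ p → E.reflexive (Listₚ.++-identityʳ p))
              }
            ; inverse = (λ p → E.trans (+ᵖ-comm (-ᵖ p) p) (-ᵖ-inverseʳ p)) , -ᵖ-inverseʳ
            ; ⁻¹-cong = -ᵖ-cong
            }
          ; comm = +ᵖ-comm
          }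
        ; *-cong = *ᵖ-cong
        ; *-assoc = *ᵖ-assoc
        ; *-identity = *ᵖ-identityˡ ,
            (λ p → E.trans (*ᵖ-comm p (constant K.1#)) (*ᵖ-identityˡ p))
        ; distrib = *ᵖ-distribˡ , *ᵖ-distribʳ
        }
      ; *-comm = *ᵖ-comm
      }

  polynomialRing : CommutativeRing c ℓ
  polynomialRing .CommutativeRing.Carrier = Polynomial
  polynomialRing .CommutativeRing._≈_     = _≈ᵖ_
  polynomialRing .CommutativeRing._+_     = _+ᵖ_
  polynomialRing .CommutativeRing._*_     = _*ᵖ_
  polynomialRing .CommutativeRing.-_      = -ᵖ_
  polynomialRing .CommutativeRing.0#      = []
  polynomialRing .CommutativeRing.1#      = constant K.1#
  polynomialRing .CommutativeRing.isCommutativeRing = polynomialRing-isCommutativeRing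

  abstract
    constant-isRingHomomorphism :
      RingMorphisms.IsRingHomomorphism K.rawRing (CommutativeRing.rawRing polynomialRing) constant
    constant-isRingHomomorphism .RingMorphisms.IsRingHomomorphism.isSemiringHomomorphism = record
      { isNearSemiringHomomorphism = record
        { +-isMonoidHomomorphism = record
          { isMagmaHomomorphism = record
            { isRelHomomorphism = record
              { cong = λ k≈l → extends⇒≈ᵖ (λ w → K.+-congʳ (K.*-congʳ k≈l)) }
            ; homo = λ k l → extends⇒≈ᵖ (λ w →
                K.trans (K.+-congʳ (K.distribʳ (w 0ᵉ) k l)) (K.+-assoc (k K.* w 0ᵉ) (l K.* w 0ᵉ) K.0#))
            }
          ; ε-homo = extends⇒≈ᵖ (λ w → K.trans (K.+-identityʳ _) (K.zeroˡ (w 0ᵉ)))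
          }
        ; *-homo = λ k l → extends⇒≈ᵖ (λ w →
            K.+-congʳ (K.*-congˡ (extend-reindex w (≡.sym (+ᵉ-identityˡ 0ᵉ)))))
        }
      ; 1#-homo = E.refl
      }
    constant-isRingHomomorphism .RingMorphisms.IsRingHomomorphism.-‿homo k = E.refl

  monomial-+ : ∀ e f → monomial e *ᵖ monomial f ≈ᵖ monomial (e +ᵉ f)
  monomial-+ e f = extends⇒≈ᵖ (λ w → K.+-congʳ (K.*-congʳ (K.*-identityˡ K.1#)))

  open Graded {K = K} {A = polynomialRing} constant constant-isRingHomomorphism n
    using (Degree; Grading; grading)

  degree : Exponent → Degree
  degree = Vec.map +_

  polynomialGrading : Grading regular ℓ
  polynomialGrading = grading λ a → record
    { Contains = λ p → ∀ e → degree e ≢ a → coefficient p e K.≈ K.0#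
    ; resp     = λ p≈q p∈ e e≢a → K.trans (K.sym (coefficients p≈q e)) (p∈ e e≢a)
    ; 0-closed = λ e e≢a → K.refl
    ; +-closed = λ {p} {q} p∈ q∈ e e≢a → K.trans (extend-+ (δ e) p q)
        (K.trans (K.+-cong (p∈ e e≢a) (q∈ e e≢a)) (K.+-identityˡ K.0#))
    ; *-closed = λ k {p} p∈ e e≢a → K.trans (extend-* (δ e) (constant k) p)
        (K.trans (K.+-identityʳ _) (K.trans (K.*-congˡ
          (extend-cong (λ f → extend-reindex (δ e) (+ᵉ-identityˡ f)) p))
        (K.trans (K.*-congˡ (p∈ e e≢a)) (K.zeroʳ k))))
    }

record SimplicialComplex (n : ℕ) : Set₁ where
  field
    Face     : Pred (Subset n) 0ℓ
    Face?    : Decidable Face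
    ⊆-closed : ∀ {F G} → F ⊆ G → Face G → Face F

  Nonface : Set
  Nonface = ∃ λ F → ¬ Face F

  -- Equivalently: x^F is minimal with respect to divisibility among the
  -- generators x^G, G not a face, of the Stanley-Reisner ideal.
  IsMinimalNonface : Pred (Subset n) 0ℓ
  IsMinimalNonface F = ¬ Face F × (∀ G → G ⊂ F → Face G)

  smallerNonface? : ∀ F → Dec (∃ λ G → G ⊂ F × ¬ Face G)
  smallerNonface? F = Subsetₚ.anySubset? (λ G → (G Subsetₚ.⊂? F) ×-dec ¬? (Face? G))

  isMinimalNonface? : Decidable IsMinimalNonface
  isMinimalNonface? F = ¬? (Face? F) ×-dec Dec.map′
    (λ none G G⊂F → decidable-stable (Face? G) (λ G∉ → none (G , G⊂F , G∉)))
    (λ { all (G , G⊂F , G∉) → G∉ (all G G⊂F) })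
    (¬? (smallerNonface? F))

open SimplicialComplex using (Face)

infix 4 _≐ᶜ_
_≐ᶜ_ : ∀ {n} → SimplicialComplex n → SimplicialComplex n → Set
Δ ≐ᶜ Δ′ = Face Δ ≐ Face Δ′

uniform : (n r : ℕ) → SimplicialComplex n
uniform n r = record
  { Face     = λ F → ∣ F ∣ ℕ.≤ r
  ; Face?    = λ F → ∣ F ∣ ℕₚ.≤? r
  ; ⊆-closed = λ F⊆G ∣G∣≤r → ℕₚ.≤-trans (Subsetₚ.p⊆q⇒∣p∣≤∣q∣ F⊆G) ∣G∣≤r
  }

fullSimplex : (n : ℕ) → SimplicialComplex n
fullSimplex n = record
  { Face     = λ _ → Unit
  ; Face?    = λ _ → yes tt
  ; ⊆-closed = λ _ _ → tt
  }

boundary : (n : ℕ) → SimplicialComplex n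
boundary n = record
  { Face     = λ F → F ≢ ⊤
  ; Face?    = λ F → ¬? (Vecₚ.≡-dec Bool._≟_ F ⊤)
  ; ⊆-closed = λ F⊆G G≢⊤ F≡⊤ → G≢⊤ (Subsetₚ.⊆-antisym Subsetₚ.⊆⊤ (≡.subst (_⊆ _) F≡⊤ F⊆G))
  }

allSubsets : (n : ℕ) → List (Subset n)
allSubsets zero        = [] ∷ []
allSubsets (ℕ.suc n) =
  List.map (outside ∷_) (allSubsets n) ++ List.map (inside ∷_) (allSubsets n)

∈-allSubsets : ∀ {n} (F : Subset n) → F ∈ˡ allSubsets n
∈-allSubsets []            = here ≡.refl
∈-allSubsets (outside ∷ F) = ∈-++⁺ˡ (∈-map⁺ (outside ∷_) (∈-allSubsets F))
∈-allSubsets (inside ∷ F)  = ∈-++⁺ʳ _ (∈-map⁺ (inside ∷_) (∈-allSubsets F))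

module StanleyReisner {c ℓ : Level} (𝕂 : Field c ℓ) {n : ℕ} (Δ : SimplicialComplex n) where
  open Field 𝕂 using () renaming (commutativeRing to K)
  private
    module Δ = SimplicialComplex Δ

  open Polynomials K n public renaming (polynomialRing to S)

  private
    module S = CommutativeRing S

  squarefree : Subset n → Exponent
  squarefree = Vec.map (λ s → if s then 1 else 0)

  I : Ideal {R = S} (c ⊔ ℓ)
  I = span regular (λ (F : Δ.Nonface) → monomial (squarefree (proj₁ F)))

  S/I : CommutativeRing c (c ⊔ ℓ)
  S/I = quotientRing I

  -- The list has no repetitions, since `allSubsets` has none.
  minimalNonfaces : List (Subset n)
  minimalNonfaces = filter Δ.isMinimalNonface? (allSubsets n)

  m : ℕ
  m = length minimalNonfaces

  generatorExponent : Fin m → Exponent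
  generatorExponent i = squarefree (lookup minimalNonfaces i)

  generator : Fin m → Polynomial
  generator i = monomial (generatorExponent i)

  Sᵐ : Module S c ℓ
  Sᵐ = power regular m

  open SemiringSum S.semiring using (sum; sum-cong-≋; ∑-distrib-+; *-distribˡ-sum)

  d : Hom Sᵐ regular
  d = makeHom (λ f → sum (λ i → f i *ᵖ generator i))
    (λ f≈g → sum-cong-≋ (λ i → S.*-congʳ (f≈g i)))
    (λ f g → S.trans (sum-cong-≋ (λ i → S.distribʳ (generator i) (f i) (g i)))
      (∑-distrib-+ (λ i → f i *ᵖ generator i) (λ i → g i *ᵖ generator i)))
    (λ a f → S.trans (sum-cong-≋ (λ i → S.*-assoc a (f i) (generator i)))
      (S.sym (*-distribˡ-sum a (λ i → f i *ᵖ generator i))))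

  Syz : Submodule Sᵐ ℓ
  Syz = kernel d

  private
    module Sᵐ = Module Sᵐ
    module Syz = Module (submodule Syz)

  koszulSyzygy : Sᵐ.Carrierᴹ × Sᵐ.Carrierᴹ → Syz.Carrierᴹ
  koszulSyzygy (f , g) = ((⟦ d ⟧ f Sᵐ.*ₗ g) Sᵐ.+ᴹ Sᵐ.-ᴹ (⟦ d ⟧ g Sᵐ.*ₗ f)) ,
    S.trans (d.+ᴹ-homo (⟦ d ⟧ f Sᵐ.*ₗ g) (Sᵐ.-ᴹ (⟦ d ⟧ g Sᵐ.*ₗ f)))
    (S.trans (S.+-cong (d.*ₗ-homo (⟦ d ⟧ f) g)
      (S.trans (d.-ᴹ-homo (⟦ d ⟧ g Sᵐ.*ₗ f)) (S.-‿cong (S.trans (d.*ₗ-homo (⟦ d ⟧ g) f)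
        (S.*-comm (⟦ d ⟧ g) (⟦ d ⟧ f))))))
    (S.-‿inverseʳ (⟦ d ⟧ f *ᵖ ⟦ d ⟧ g)))
    where module d = Hom d

  Kosz : Submodule (submodule Syz) (c ⊔ ℓ)
  Kosz = span (submodule Syz) koszulSyzygy

  -- Syz(I)/Kosz(I) as an S-module.
  Syz/Koszˢ : Module S (c ⊔ ℓ) (c ⊔ ℓ)
  Syz/Koszˢ = quotient Kosz

  private module Q = Module Syz/Koszˢ

  basisVector : Fin m → Sᵐ.Carrierᴹ
  basisVector j i = if does (i Finₚ.≟ j) then S.1# else S.0#

  sum-basisVector : ∀ {k} (j : Fin k) (g : Fin k → Polynomial) →
          sum (λ i → (if does (i Finₚ.≟ j) then S.1# else S.0#) *ᵖ g i) ≈ᵖ g j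
  sum-basisVector Fin.zero    g = S.trans (S.+-cong (S.*-identityˡ (g Fin.zero)) (sum-0 (λ i → g (Fin.suc i))))
                          (S.+-identityʳ (g Fin.zero))
    where
    sum-0 : ∀ {k} (g : Fin k → Polynomial) → sum (λ i → S.0# *ᵖ g i) ≈ᵖ S.0#
    sum-0 {zero}    g = S.refl
    sum-0 {ℕ.suc k} g = sum-0 (λ i → g (Fin.suc i))
  sum-basisVector (Fin.suc j) g = sum-basisVector j (λ i → g (Fin.suc i))

  d-basisVector : ∀ j → ⟦ d ⟧ (basisVector j) ≈ᵖ generator j
  d-basisVector j = sum-basisVector j generator

  annihilator : Syz.Carrierᴹ → Ideal {R = S} (c ⊔ ℓ)
  annihilator x = record
    { Contains = λ a → (a Q.*ₗ x) Q.≈ᴹ Q.0ᴹ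
    ; resp     = λ a≈b ax≈0 → Q.≈ᴹ-trans (Q.*ₗ-cong (S.sym a≈b) (Q.≈ᴹ-refl {x})) ax≈0
    ; 0-closed = Q.*ₗ-zeroˡ x
    ; +-closed = λ {a} {b} ax≈0 bx≈0 → Q.≈ᴹ-trans (Q.*ₗ-distribʳ x a b)
        (Q.≈ᴹ-trans (Q.+ᴹ-cong ax≈0 bx≈0) (Q.+ᴹ-identityˡ Q.0ᴹ))
    ; *-closed = λ a {b} bx≈0 → Q.≈ᴹ-trans (Q.*ₗ-assoc a b x)
        (Q.≈ᴹ-trans (Q.*ₗ-cong (S.refl {a}) bx≈0) (Q.*ₗ-zeroʳ a))
    }

  generator-annihilates : ∀ j x → Contains (annihilator x) (generator j)
  generator-annihilates j x = congruent (Span.resp (λ i → S.trans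
      (S.+-cong (S.*-congʳ (d-basisVector j)) (S.-‿cong (S.trans (S.*-congʳ (proj₂ x)) (S.zeroˡ (basisVector j i)))))
      S.refl)
    (gen (basisVector j , proj₁ x)))

  squarefree-+ : ∀ {F G} → F ⊆ G → ∃ λ f → f +ᵉ squarefree F ≡ squarefree G
  squarefree-+ {F} {G} F⊆G = Vec.zipWith ℕ._∸_ (squarefree G) (squarefree F) , go F G F⊆G
    where
    go : ∀ {k} (F G : Subset k) → F ⊆ G →
         Vec.zipWith ℕ._+_ (Vec.zipWith ℕ._∸_ (Vec.map (λ s → if s then 1 else 0) G)
           (Vec.map (λ s → if s then 1 else 0) F)) (Vec.map (λ s → if s then 1 else 0) F)
         ≡ Vec.map (λ s → if s then 1 else 0) G
    go []            []            F⊆G = ≡.refl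
    go (outside ∷ F) (outside ∷ G) F⊆G = ≡.cong (0 ∷_) (go F G (Subsetₚ.drop-∷-⊆ F⊆G))
    go (outside ∷ F) (inside  ∷ G) F⊆G = ≡.cong (1 ∷_) (go F G (Subsetₚ.drop-∷-⊆ F⊆G))
    go (inside  ∷ F) (inside  ∷ G) F⊆G = ≡.cong (1 ∷_) (go F G (Subsetₚ.drop-∷-⊆ F⊆G))
    go (inside  ∷ F) (outside ∷ G) F⊆G = contradiction (F⊆G Vec.here) λ ()

  minimalNonface⊆ : ∀ k F → ∣ F ∣ ℕ.≤ k → ¬ Face Δ F → ∃ λ j → lookup minimalNonfaces j ⊆ F
  minimalNonface⊆ k F ∣F∣≤k F∉ with Δ.smallerNonface? F
  minimalNonface⊆ k F ∣F∣≤k F∉ | no none =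
    Any.index F∈ , ≡.subst (_⊆ F) (Anyₚ.lookup-index F∈) id
    where
    F∈ : F ∈ˡ minimalNonfaces
    F∈ = ∈-filter⁺ Δ.isMinimalNonface? (∈-allSubsets F)
      (F∉ , λ G G⊂F → decidable-stable (Δ.Face? G) (λ G∉ → none (G , G⊂F , G∉)))
  minimalNonface⊆ zero F ∣F∣≤0 F∉ | yes (G , G⊂F , G∉) =
    contradiction (ℕₚ.<-≤-trans (Subsetₚ.p⊂q⇒∣p∣<∣q∣ G⊂F) ∣F∣≤0) λ ()
  minimalNonface⊆ (ℕ.suc k) F ∣F∣≤k F∉ | yes (G , G⊂F , G∉) =
    let j , j⊆G = minimalNonface⊆ k G (ℕₚ.≤-pred (ℕₚ.<-≤-trans (Subsetₚ.p⊂q⇒∣p∣<∣q∣ G⊂F) ∣F∣≤k)) G∉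
    in j , proj₁ G⊂F ∘ j⊆G

  I-annihilates-Syz/Kosz : Annihilates I Syz/Koszˢ
  I-annihilates-Syz/Kosz a a∈I x = span⊆ (annihilator x) nonface a∈I
    where
    nonface : (F : Δ.Nonface) → Contains (annihilator x) (monomial (squarefree (proj₁ F)))
    nonface (F , F∉) = Submodule.resp (annihilator x) {monomial f *ᵖ generator j} {monomial (squarefree F)}
      (S.trans (monomial-+ f (generatorExponent j)) (S.reflexive (≡.cong monomial (proj₂ quotient-exponent))))
      (Submodule.*-closed (annihilator x) (monomial f) {generator j} (generator-annihilates j x))
      where
      minimal = minimalNonface⊆ _ F ℕₚ.≤-refl F∉
      j = proj₁ minimal
      quotient-exponent = squarefree-+ (proj₂ minimal)
      f = proj₁ quotient-exponent

  Syz/Kosz : Module S/I (c ⊔ ℓ) (c ⊔ ℓ)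
  Syz/Kosz = descend I Syz/Koszˢ I-annihilates-Syz/Kosz

  Hom-S[Sᵐ,S/I] : Module S (c ⊔ ℓ) (c ⊔ ℓ)
  Hom-S[Sᵐ,S/I] = homModule Sᵐ (quotient I)

  Hom-S/I[Syz/Kosz,S/I] : Module S/I (c ⊔ ℓ) (c ⊔ ℓ)
  Hom-S/I[Syz/Kosz,S/I] = homModule Syz/Kosz regular

  private module S/I = Module (quotient I)

  d∈I : ∀ f → Contains I (⟦ d ⟧ f)
  d∈I f = sum∈I (λ i → f i) generator (λ i → gen (_ , generator-nonface i))
    where
    sum∈I : ∀ {k} (f g : Fin k → Polynomial) → (∀ i → Contains I (g i)) →
            Contains I (sum (λ i → f i *ᵖ g i))
    sum∈I {zero}    f g g∈I = Submodule.0-closed I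
    sum∈I {ℕ.suc k} f g g∈I = Submodule.+-closed I (Submodule.*-closed I (f Fin.zero) (g∈I Fin.zero))
      (sum∈I (λ i → f (Fin.suc i)) (λ i → g (Fin.suc i)) (λ i → g∈I (Fin.suc i)))
    generator-nonface : ∀ i → ¬ Face Δ (lookup minimalNonfaces i)
    generator-nonface i = proj₁ (All.lookup (all-filter Δ.isMinimalNonface? (allSubsets n))
      (∈-lookup i))

  restriction : Hom Sᵐ (quotient I) → Hom Syz/Kosz regular
  restriction ψ = makeHom (λ x → ⟦ ψ ⟧ (proj₁ x)) cong
    (λ x y → ψ.+ᴹ-homo (proj₁ x) (proj₁ y))
    (λ a x → ψ.*ₗ-homo a (proj₁ x))
    where
    module ψ = Hom ψ

    killed : Submodule (submodule Syz) (c ⊔ ℓ)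
    killed = record
      { Contains = λ x → ⟦ ψ ⟧ (proj₁ x) S/I.≈ᴹ S/I.0ᴹ
      ; resp     = Submodule.resp (kernel ψ)
      ; 0-closed = Submodule.0-closed (kernel ψ)
      ; +-closed = Submodule.+-closed (kernel ψ)
      ; *-closed = λ a x∈ → Submodule.*-closed (kernel ψ) a x∈
      }

    scaled : ∀ f g → ⟦ ψ ⟧ (⟦ d ⟧ f Sᵐ.*ₗ g) S/I.≈ᴹ S/I.0ᴹ
    scaled f g = S/I.≈ᴹ-trans (ψ.*ₗ-homo (⟦ d ⟧ f) g) (congruent (Submodule.resp I
      (S.trans (S.*-comm (⟦ ψ ⟧ g) (⟦ d ⟧ f)) (S.sym (S.+-identityʳ (⟦ d ⟧ f *ᵖ ⟦ ψ ⟧ g))))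
      (Submodule.*-closed I (⟦ ψ ⟧ g) (d∈I f))))

    cong : ∀ {x y} → Congruent Kosz x y → ⟦ ψ ⟧ (proj₁ x) S/I.≈ᴹ ⟦ ψ ⟧ (proj₁ y)
    cong {x} {y} x≈y = x∙y⁻¹≈ε⇒x≈y (⟦ ψ ⟧ (proj₁ x)) (⟦ ψ ⟧ (proj₁ y))
      (S/I.≈ᴹ-trans (S/I.+ᴹ-congˡ {⟦ ψ ⟧ (proj₁ x)} (S/I.≈ᴹ-sym (ψ.-ᴹ-homo (proj₁ y))))
      (S/I.≈ᴹ-trans (S/I.≈ᴹ-sym (ψ.+ᴹ-homo (proj₁ x) (Sᵐ.-ᴹ proj₁ y)))
      (span⊆ killed
        (λ (f , g) → Submodule.+-closed (kernel ψ) (scaled f g) (Submodule.neg-closed (kernel ψ) (scaled g f)))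
        (difference x≈y))))
      where open AbelianGroupProperties S/I.+ᴹ-abelianGroup using (x∙y⁻¹≈ε⇒x≈y)

  -- The image of Hom_S(Sᵐ,S/I) → Hom_{S/I}(Syz(I)/Kosz(I),S/I).
  restrictions : Submodule Hom-S/I[Syz/Kosz,S/I] (c ⊔ ℓ)
  restrictions = record
    { Contains = λ φ → ∃ λ ψ → restriction ψ ≈ʰ φ
    ; resp     = λ { φ≈φ′ (ψ , e) → ψ , pointwise λ x → R.trans (agree e x) (agree φ≈φ′ x) }
    ; 0-closed = H.0ᴹ , pointwise λ x → R.refl
    ; +-closed = λ { (ψ , e) (ψ′ , e′) → ψ H.+ᴹ ψ′ , pointwise λ x → R.+-cong (agree e x) (agree e′ x) }
    ; *-closed = λ { a (ψ , e) → a H.*ₗ ψ , pointwise λ x → R.*-congˡ {a} (agree e x) }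
    }
    where
    module H = Module Hom-S[Sᵐ,S/I]
    module R = CommutativeRing S/I

  T² : Module S/I (c ⊔ ℓ) (c ⊔ ℓ)
  T² = quotient {R = S/I} {M = Hom-S/I[Syz/Kosz,S/I]} restrictions

  private
    module Gˢ = Graded {K = K} {A = S} constant constant-isRingHomomorphism n
    module Gᵠ = Graded {K = K} {A = S/I} constant
      (quotient-ι-homo {K = K} {A = S} constant constant-isRingHomomorphism n I) n

  open Gᵠ public using (Degree)

  Sᵐ-grading : Gˢ.Grading (power regular m) ℓ
  Sᵐ-grading = Gˢ.shiftedPowerGrading {j = m} {M = regular} (λ i → degree (generatorExponent i)) polynomialGrading

  Syz-grading : Gˢ.Grading (submodule Syz) ℓ
  Syz-grading = Gˢ.submoduleGrading {M = Sᵐ} Syz Sᵐ-grading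

  Syz/Kosz-grading : Gᵠ.Grading Syz/Kosz (c ⊔ ℓ)
  Syz/Kosz-grading = descendGrading {K = K} {A = S} constant constant-isRingHomomorphism n I
    Syz/Koszˢ I-annihilates-Syz/Kosz (Gˢ.quotientGrading Kosz Syz-grading)

  S/I-grading : Gᵠ.Grading regular (c ⊔ ℓ)
  S/I-grading = quotientRingGrading {K = K} {A = S} constant constant-isRingHomomorphism n I polynomialGrading

  T²-grading : Gᵠ.Grading T² (c ⊔ ℓ)
  T²-grading = Gᵠ.quotientGrading restrictions (Gᵠ.homGrading Syz/Kosz-grading S/I-grading)

  T²-component : Degree → Module K (c ⊔ ℓ) (c ⊔ ℓ)
  T²-component a = submodule (Gᵠ.component T²-grading a)

-- T²_{-b}(Δ), where b ∈ {0,1}ⁿ is given by its support.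
T²₋ : ∀ {c ℓ n} (𝕂 : Field c ℓ) → SimplicialComplex n → Subset n →
      Module (Field.commutativeRing 𝕂) (c ⊔ ℓ) (c ⊔ ℓ)
T²₋ 𝕂 Δ b = StanleyReisner.T²-component 𝕂 Δ (Vec.map (λ s → if s then ℤ.-1ℤ else ℤ.0ℤ) b)

module Submission where

-- The minimal nonfaces F are the (r+1)-subsets, and the syzygies are generated by the binomials
-- x^(U−F) e_F − x^(U−G) e_G with F, G ⊂ U and |U| = r + 2. A homomorphism of degree −b into S/I can be
-- nonzero on such a binomial only if b ⊆ U and U − b is a face, which forces #b ≥ 2; because it kills
-- the Koszul relations, it then vanishes whenever neither F nor G contains b. So it amounts to scalars
-- θ(F,U) for b ⊆ F ⊂ U, and it extends to Sᵐ exactly when θ(F,U) depends on F only. If #b ≥ 3, this is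
-- forced by the syzygies in degree U ∪ U′. If #b = 2, all θ occur; there are C(n−2,r−1) sets F and
-- n−r−1 sets U over each of them, which leaves C(n−2,r−1)·(n−r−2) dimensions.

open import Defs
open import Level using (Level; _⊔_)
open import Data.Bool.Base using (true; false; if_then_else_)
import Data.Bool.Properties as Boolₚ
open import Data.Unit.Base using (tt)
open import Data.Nat.Base as ℕ using (ℕ; zero; suc; _+_; _*_; _∸_; _≤_; _<_; z≤n; s≤s)
import Data.Nat.Properties as ℕₚ
open import Data.Nat.Combinatorics
  using (_C_; nC1≡n; nCn≡1; nCk≡nC[n∸k]; nCk+nC[k+1]≡[n+1]C[k+1]; k>n⇒nCk≡0)
open import Data.Nat.Solver using (module +-*-Solver)
open import Data.Integer.Base as ℤ using (ℤ; +_)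
import Data.Integer.Properties as ℤₚ
open import Data.Fin.Base using (Fin; zero; suc)
import Data.Fin.Properties as Finₚ
open import Data.Fin.Subset
  using (Subset; inside; outside; _∈_; _∉_; _⊆_; _⊂_; _∪_; _∩_; _-_; ∣_∣; ⊤; ⁅_⁆; Nonempty)
open import Data.Fin.Subset.Properties
  using (_⊆?_; _∈?_; drop-∷-⊆; drop-there; p⊂q⇒∣p∣<∣q∣; p⊆q⇒∣p∣≤∣q∣; ⊆-refl; ⊆-trans; ⊆-antisym; ⊆⊤;
         out⊆; in⊆in; p─⊥≡p; p─q⊆p; p⊆p∪q; q⊆p∪q; x∈p∪q⁻; x∈p∩q⁺; x∈p⇒p-x⊂p; x∈p⇒∣p-x∣<∣p∣;
         x∈p∧x≢y⇒x∈p-y; ∣p∣≤n; ∣⊤∣≡n; ∣p∣≡n⇒p≡⊤)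
open import Data.Vec.Base as Vec using (Vec; []; _∷_; here; there)
import Data.Vec.Properties as Vecₚ
open import Data.List.Base as List using (List; []; _∷_; _++_; length; lookup; map; drop)
import Data.List.Properties as Listₚ
open import Data.List.Membership.Propositional using () renaming (_∈_ to _∈ˡ_)
open import Data.List.Membership.Propositional.Properties
  using (∈-filter⁺; ∈-lookup; ∈-map⁺; ∈-map⁻; ∈-++⁺ˡ; ∈-++⁺ʳ; ∈-++⁻)
open import Data.List.Relation.Unary.Any as Any using (here; there)
import Data.List.Relation.Unary.Any.Properties as Anyₚ
open import Data.List.Relation.Unary.All as All using ([]; _∷_)
open import Data.List.Relation.Unary.All.Properties using (all-filter)
open import Data.List.Relation.Unary.AllPairs using ([]; _∷_)
open import Data.List.Relation.Unary.Unique.Propositional using (Unique)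
import Data.List.Relation.Unary.Unique.Propositional.Properties as Uniqueₚ
open import Data.Product.Base using (Σ; ∃; _×_; _,_; proj₁; proj₂)
import Data.Product.Properties as Productₚ
open import Data.Sum.Base using (_⊎_; inj₁; inj₂; [_,_]′)
open import Function.Bundles using (_⇔_; mk⇔)
open import Relation.Nullary using (¬_; Dec; yes; no; does; contradiction)
open import Relation.Nullary.Decidable using (map′; dec-yes)
open import Relation.Binary.PropositionalEquality
  using (_≡_; _≢_; refl; sym; trans; cong; cong₂; subst; subst₂; module ≡-Reasoning)
open import Algebra.Bundles using (CommutativeRing)
open import Algebra.Module.Bundles using (Module)
import Algebra.Properties.AbelianGroup as AbelianGroupProperties
import Algebra.Properties.CommutativeSemigroup as CommutativeSemigroupProperties
import Algebra.Properties.Ring as RingProperties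
import Algebra.Properties.Semiring.Sum as SemiringSum

open SimplicialComplex using (Face; Face?; ⊆-closed)

-- The threshold between #b = 2 and #b ≥ 3 comes from unions. Two different sets U, U′ over the same
-- F have a union V with r + 3 elements, and V - b is a face exactly when #b ≥ 3. Then degree V
-- links θ(F,U) to θ(F,U′). If #b = 2, a face together with b covers at most r + 2 elements, so
-- different U never meet, and degrees with at most r + 1 elements in their support carry no
-- syzygies. The obstacle is to realise an arbitrary θ. It need not come from Sᵐ, so no S-linear
-- formula on Sᵐ is available. The formula used is defined on all of Sᵐ, but it is linear only on
-- Syz(I) and only modulo I. The closed form of the dimension follows from r·C(n-2,r) =
-- (n-r-1)·C(n-2,r-1). The factor n-r-2 vanishes at n = r + 2, which is why U of rank n - 2 joins
-- the simplex and its boundary in the classification. Equality in the field is not decidable.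
-- Polynomials are therefore never normalised: identities in S/I are checked on the coefficients at
-- exponents supported on faces, and case distinctions concern exponents and sets only.

private variable k : ℕ

-- Subsets and exponents

⊆∧∣≥∣⇒⊇ : ∀ {F G : Subset k} → F ⊆ G → ∣ G ∣ ≤ ∣ F ∣ → G ⊆ F
⊆∧∣≥∣⇒⊇ {F = F} {G} F⊆G ∣G∣≤∣F∣ {x} x∈G with x ∈? F
... | yes x∈F = x∈F
... | no  x∉F = contradiction ∣G∣≤∣F∣ (ℕₚ.<⇒≱ (p⊂q⇒∣p∣<∣q∣ (F⊆G , x , x∈G , x∉F)))

⊆∧∣≥∣⇒≡ : ∀ {F G : Subset k} → F ⊆ G → ∣ G ∣ ≤ ∣ F ∣ → F ≡ G
⊆∧∣≥∣⇒≡ F⊆G ∣G∣≤∣F∣ = ⊆-antisym F⊆G (⊆∧∣≥∣⇒⊇ F⊆G ∣G∣≤∣F∣)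

⊈⇒∃∉ : ∀ (b F : Subset k) → ¬ b ⊆ F → ∃ λ x → x ∈ b × x ∉ F
⊈⇒∃∉ []            []            b⊈F = contradiction (λ {x} → λ ()) b⊈F
⊈⇒∃∉ (inside  ∷ b) (outside ∷ F) b⊈F = zero , here , λ ()
⊈⇒∃∉ (outside ∷ b) (s       ∷ F) b⊈F = let x , x∈b , x∉F = ⊈⇒∃∉ b F (λ b⊆F → b⊈F (out⊆ b⊆F)) in
  suc x , there x∈b , λ x∈F → x∉F (drop-there x∈F)
⊈⇒∃∉ (inside  ∷ b) (inside  ∷ F) b⊈F = let x , x∈b , x∉F = ⊈⇒∃∉ b F (λ b⊆F → b⊈F (in⊆in b⊆F)) in
  suc x , there x∈b , λ x∈F → x∉F (drop-there x∈F)

∣p∪q∣+∣p∩q∣ : ∀ (p q : Subset k) → ∣ p ∪ q ∣ + ∣ p ∩ q ∣ ≡ ∣ p ∣ + ∣ q ∣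
∣p∪q∣+∣p∩q∣ []            []            = refl
∣p∪q∣+∣p∩q∣ (outside ∷ p) (outside ∷ q) = ∣p∪q∣+∣p∩q∣ p q
∣p∪q∣+∣p∩q∣ (outside ∷ p) (inside  ∷ q) =
  trans (cong suc (∣p∪q∣+∣p∩q∣ p q)) (sym (ℕₚ.+-suc ∣ p ∣ ∣ q ∣))
∣p∪q∣+∣p∩q∣ (inside  ∷ p) (outside ∷ q) = cong suc (∣p∪q∣+∣p∩q∣ p q)
∣p∪q∣+∣p∩q∣ (inside  ∷ p) (inside  ∷ q) = cong suc
  (trans (ℕₚ.+-suc ∣ p ∪ q ∣ ∣ p ∩ q ∣) (trans (cong suc (∣p∪q∣+∣p∩q∣ p q)) (sym (ℕₚ.+-suc ∣ p ∣ ∣ q ∣))))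

suc∣p-x∣ : ∀ (p : Subset k) {x} → x ∈ p → suc ∣ p - x ∣ ≡ ∣ p ∣
suc∣p-x∣ (inside  ∷ p) {zero}  here        = cong (λ q → suc ∣ q ∣) (p─⊥≡p p)
suc∣p-x∣ (inside  ∷ p) {suc x} (there x∈p) = cong suc (suc∣p-x∣ p x∈p)
suc∣p-x∣ (outside ∷ p) {suc x} (there x∈p) = suc∣p-x∣ p x∈p

nonempty : ∀ (p : Subset k) → 0 < ∣ p ∣ → Nonempty p
nonempty (inside  ∷ p) _     = zero , here
nonempty (outside ∷ p) 0<∣p∣ = let x , x∈p = nonempty p 0<∣p∣ in suc x , there x∈p

enlarge : ∀ (F A : Subset k) → F ⊆ A → ∣ F ∣ < ∣ A ∣ →
          ∃ λ G → F ⊆ G × G ⊆ A × ∣ G ∣ ≡ suc ∣ F ∣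
enlarge []            []            F⊆A ()
enlarge (inside  ∷ F) (outside ∷ A) F⊆A _ = contradiction (F⊆A here) λ ()
enlarge (outside ∷ F) (inside  ∷ A) F⊆A _ =
  inside ∷ F , out⊆ ⊆-refl , in⊆in (drop-∷-⊆ F⊆A) , refl
enlarge (outside ∷ F) (outside ∷ A) F⊆A F<A =
  let G , F⊆G , G⊆A , ∣G∣ = enlarge F A (drop-∷-⊆ F⊆A) F<A in
  outside ∷ G , out⊆ F⊆G , out⊆ G⊆A , ∣G∣
enlarge (inside  ∷ F) (inside  ∷ A) F⊆A (s≤s F<A) =
  let G , F⊆G , G⊆A , ∣G∣ = enlarge F A (drop-∷-⊆ F⊆A) F<A in
  inside ∷ G , in⊆in F⊆G , in⊆in G⊆A , cong suc ∣G∣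

shrink : ∀ {s} (F : Subset k) → ∣ F ∣ ≡ suc s → ∃ λ G → G ⊆ F × ∣ G ∣ ≡ s
shrink (inside  ∷ F) ∣F∣ = outside ∷ F , out⊆ ⊆-refl , ℕₚ.suc-injective ∣F∣
shrink (outside ∷ F) ∣F∣ = let G , G⊆F , ∣G∣ = shrink F ∣F∣ in outside ∷ G , out⊆ G⊆F , ∣G∣

-- Each step exchanges one element. For ∣F∣ = r + 1 the union of two consecutive sets then has r + 2
-- elements, so a step corresponds to a linear syzygy. All sets reached lie in `A`, which will be
-- the support of a monomial that their monomials have to divide.
data Chain (A : Subset k) : Subset k → Subset k → Set where
  done : ∀ {F} → Chain A F F
  step : ∀ {F F′ G} → F′ ⊆ A → ∣ F′ ∣ ≡ ∣ F ∣ → ∣ F ∪ F′ ∣ ≡ suc ∣ F ∣ →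
         Chain A F′ G → Chain A F G

outside∷ᶜ : ∀ {a} {A F G : Subset k} → Chain A F G → Chain (a ∷ A) (outside ∷ F) (outside ∷ G)
outside∷ᶜ done             = done
outside∷ᶜ (step F′⊆A e u c) = step (out⊆ F′⊆A) e u (outside∷ᶜ c)

inside∷ᶜ : ∀ {A F G : Subset k} → Chain A F G → Chain (inside ∷ A) (inside ∷ F) (inside ∷ G)
inside∷ᶜ done             = done
inside∷ᶜ (step F′⊆A e u c) = step (in⊆in F′⊆A) (cong suc e) (cong suc u) (inside∷ᶜ c)

p⊆q⇒p∪q≡q : ∀ {p q : Subset k} → p ⊆ q → p ∪ q ≡ q
p⊆q⇒p∪q≡q {p = p} {q} p⊆q =
  ⊆-antisym (λ x∈ → [ (λ x∈p → p⊆q x∈p) , (λ x∈q → x∈q) ]′ (x∈p∪q⁻ p q x∈)) (q⊆p∪q p q)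

p⊆q⇒q∪p≡q : ∀ {p q : Subset k} → p ⊆ q → q ∪ p ≡ q
p⊆q⇒q∪p≡q {p = p} {q} p⊆q =
  ⊆-antisym (λ x∈ → [ (λ x∈q → x∈q) , (λ x∈p → p⊆q x∈p) ]′ (x∈p∪q⁻ q p x∈)) (p⊆p∪q p)

-- Basis exchange in the uniform matroid on A.
chain : ∀ (A F G : Subset k) → F ⊆ A → G ⊆ A → ∣ F ∣ ≡ ∣ G ∣ → Chain A F G
chain []      []            []            F⊆A G⊆A e = done
chain (a ∷ A) (outside ∷ F) (outside ∷ G) F⊆A G⊆A e =
  outside∷ᶜ (chain A F G (drop-∷-⊆ F⊆A) (drop-∷-⊆ G⊆A) e)
chain (outside ∷ A) (outside ∷ F) (inside ∷ G) F⊆A G⊆A e = contradiction (G⊆A here) λ ()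
chain (outside ∷ A) (inside ∷ F) G F⊆A G⊆A e = contradiction (F⊆A here) λ ()
chain (inside ∷ A) (inside ∷ F) (inside ∷ G) F⊆A G⊆A e =
  inside∷ᶜ (chain A F G (drop-∷-⊆ F⊆A) (drop-∷-⊆ G⊆A) (ℕₚ.suc-injective e))
chain (inside ∷ A) (outside ∷ F) (inside ∷ G) F⊆A G⊆A e with shrink F e
... | F′ , F′⊆F , ∣F′∣ =
  step (in⊆in (⊆-trans F′⊆F (drop-∷-⊆ F⊆A))) (trans (cong suc ∣F′∣) (sym e))
    (cong (λ p → suc ∣ p ∣) (p⊆q⇒q∪p≡q F′⊆F))
    (inside∷ᶜ (chain A F′ G (⊆-trans F′⊆F (drop-∷-⊆ F⊆A)) (drop-∷-⊆ G⊆A) ∣F′∣))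
chain (inside ∷ A) (inside ∷ F) (outside ∷ G) F⊆A G⊆A e
  with enlarge F A (drop-∷-⊆ F⊆A) (ℕₚ.<-≤-trans (ℕₚ.≤-reflexive e) (p⊆q⇒∣p∣≤∣q∣ (drop-∷-⊆ G⊆A)))
... | F′ , F⊆F′ , F′⊆A , ∣F′∣ =
  step (out⊆ F′⊆A) ∣F′∣ (cong suc (trans (cong ∣_∣ (p⊆q⇒p∪q≡q F⊆F′)) ∣F′∣))
    (outside∷ᶜ (chain A F′ G F′⊆A (drop-∷-⊆ G⊆A) (trans ∣F′∣ e)))

-- Exponent vectors, divisibility and supports

infixl 6 _⊞_

-- This is `_+ᵉ_`, and `sq` is `squarefree`, for vectors of any length, so that lemmas about them
-- can recurse on the length.
_⊞_ : Vec ℕ k → Vec ℕ k → Vec ℕ k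
_⊞_ = Vec.zipWith _+_

sq : Subset k → Vec ℕ k
sq = Vec.map (λ s → if s then 1 else 0)

supp : Vec ℕ k → Subset k
supp = Vec.map λ { zero → outside ; (suc _) → inside }

_∣ᵉ_ : Vec ℕ k → Vec ℕ k → Set
f ∣ᵉ a = ∃ λ g → g ⊞ f ≡ a

⊞-comm : ∀ (e f : Vec ℕ k) → e ⊞ f ≡ f ⊞ e
⊞-comm = Vecₚ.zipWith-comm ℕₚ.+-comm

⊞-assoc : ∀ (e f g : Vec ℕ k) → (e ⊞ f) ⊞ g ≡ e ⊞ (f ⊞ g)
⊞-assoc = Vecₚ.zipWith-assoc ℕₚ.+-assoc

⊞-swapʳ : ∀ (e f g : Vec ℕ k) → e ⊞ f ⊞ g ≡ e ⊞ g ⊞ f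
⊞-swapʳ e f g = trans (⊞-assoc e f g) (trans (cong (e ⊞_) (⊞-comm f g)) (sym (⊞-assoc e g f)))

⊞-cancelʳ : ∀ (e e′ f : Vec ℕ k) → e ⊞ f ≡ e′ ⊞ f → e ≡ e′
⊞-cancelʳ []      []        []      eq = refl
⊞-cancelʳ (x ∷ e) (x′ ∷ e′) (y ∷ f) eq = cong₂ _∷_
  (ℕₚ.+-cancelʳ-≡ y x x′ (Vecₚ.∷-injectiveˡ eq)) (⊞-cancelʳ e e′ f (Vecₚ.∷-injectiveʳ eq))

-- Multiplicatively, a/s = (g/s)(a/g). For s = x^b, g = x^F and a = x^U it says that the cofactor
-- x^(U-F) carries x^(F-b) to x^(U-b).
quotient-shift : ∀ {e g a h s h′ : Vec ℕ k} → e ⊞ g ≡ a → h ⊞ s ≡ a → h′ ⊞ s ≡ g → h ≡ h′ ⊞ e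
quotient-shift {e = e} {g} {a} {h} {s} {h′} e+g h+s h′+s = ⊞-cancelʳ h (h′ ⊞ e) s
  (trans h+s (trans (sym e+g) (trans (cong (e ⊞_) (sym h′+s)) (trans (sym (⊞-assoc e h′ s))
  (cong (_⊞ s) (⊞-comm e h′))))))

-- If a/g divides a/s, then s divides g. Read backwards with s = x^b, the monomial x^(U-b) is no
-- multiple of the cofactor of a set that does not contain b.
quotient-∣ᵉ : ∀ {f g a h s : Vec ℕ k} → f ⊞ g ≡ a → h ⊞ s ≡ a → f ∣ᵉ h → s ∣ᵉ g
quotient-∣ᵉ {f = f} {g} {s = s} f+g h+s (u , refl) = u , ⊞-cancelʳ (u ⊞ s) g f
  (trans (⊞-swapʳ u s f) (trans h+s (trans (sym f+g) (⊞-comm f g))))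

∸-⊞ : ∀ (g f : Vec ℕ k) → Vec.zipWith _∸_ (g ⊞ f) f ≡ g
∸-⊞ []      []      = refl
∸-⊞ (x ∷ g) (y ∷ f) = cong₂ _∷_ (ℕₚ.m+n∸n≡m x y) (∸-⊞ g f)

_∣ᵉ?_ : ∀ (f a : Vec ℕ k) → Dec (f ∣ᵉ a)
f ∣ᵉ? a = map′ (λ e → _ , e)
  (λ { (g , refl) → cong (_⊞ f) (∸-⊞ g f) })
  (Vecₚ.≡-dec ℕₚ._≟_ (Vec.zipWith _∸_ a f ⊞ f) a)

supp-sq : ∀ (F : Subset k) → supp (sq F) ≡ F
supp-sq []            = refl
supp-sq (inside  ∷ F) = cong (inside ∷_) (supp-sq F)
supp-sq (outside ∷ F) = cong (outside ∷_) (supp-sq F)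

supp-⊞ : ∀ (e f : Vec ℕ k) → supp (e ⊞ f) ≡ supp e ∪ supp f
supp-⊞ []          []      = refl
supp-⊞ (zero  ∷ e) (y ∷ f) = cong (_ ∷_) (supp-⊞ e f)
supp-⊞ (suc x ∷ e) (y ∷ f) = cong (inside ∷_) (supp-⊞ e f)

supp-∣ᵉ : ∀ {f a : Vec ℕ k} → f ∣ᵉ a → supp f ⊆ supp a
supp-∣ᵉ {f = f} (g , refl) = subst (_ ⊆_) (sym (supp-⊞ g f)) (q⊆p∪q (supp g) (supp f))

sq-∣ᵉ⇒⊆ : ∀ {F : Subset k} {a} → sq F ∣ᵉ a → F ⊆ supp a
sq-∣ᵉ⇒⊆ {F = F} F∣a = subst (_⊆ _) (supp-sq F) (supp-∣ᵉ F∣a)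

⊆⇒sq-∣ᵉ : ∀ (F : Subset k) a → F ⊆ supp a → sq F ∣ᵉ a
⊆⇒sq-∣ᵉ []            []          F⊆a = [] , refl
⊆⇒sq-∣ᵉ (outside ∷ F) (x ∷ a)     F⊆a = let g , e = ⊆⇒sq-∣ᵉ F a (drop-∷-⊆ F⊆a) in
  x ∷ g , cong₂ _∷_ (ℕₚ.+-identityʳ x) e
⊆⇒sq-∣ᵉ (inside  ∷ F) (suc x ∷ a) F⊆a = let g , e = ⊆⇒sq-∣ᵉ F a (drop-∷-⊆ F⊆a) in
  x ∷ g , cong₂ _∷_ (ℕₚ.+-comm x 1) e
⊆⇒sq-∣ᵉ (inside  ∷ F) (zero ∷ a)  F⊆a = contradiction (F⊆a here) λ ()

sq-∣ᵉ-sq : ∀ {F U : Subset k} → F ⊆ U → sq F ∣ᵉ sq U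
sq-∣ᵉ-sq {F = F} {U} F⊆U = ⊆⇒sq-∣ᵉ F (sq U) (subst (F ⊆_) (sym (supp-sq U)) F⊆U)

-- The equation forces b ⊆ U and makes h the indicator of U - b. It is kept in terms of h because
-- the degree of a homomorphism is tested on exponents.
∣supp∣+∣b∣ : ∀ (h : Vec ℕ k) (b U : Subset k) → h ⊞ sq b ≡ sq U → ∣ supp h ∣ + ∣ b ∣ ≡ ∣ U ∣
∣supp∣+∣b∣ []            []            []            e = refl
∣supp∣+∣b∣ (zero  ∷ h)   (outside ∷ b) (outside ∷ U) e = ∣supp∣+∣b∣ h b U (Vecₚ.∷-injectiveʳ e)
∣supp∣+∣b∣ (zero  ∷ h)   (inside  ∷ b) (inside  ∷ U) e =
  trans (ℕₚ.+-suc ∣ supp h ∣ ∣ b ∣) (cong suc (∣supp∣+∣b∣ h b U (Vecₚ.∷-injectiveʳ e)))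
∣supp∣+∣b∣ (suc x ∷ h)   (outside ∷ b) (inside  ∷ U) e = cong suc (∣supp∣+∣b∣ h b U (Vecₚ.∷-injectiveʳ e))
∣supp∣+∣b∣ (suc x ∷ h)   (inside  ∷ b) (inside  ∷ U) e =
  contradiction (trans (sym (ℕₚ.+-suc x 0)) (ℕₚ.suc-injective (Vecₚ.∷-injectiveˡ e))) λ ()
∣supp∣+∣b∣ (zero  ∷ h)   (outside ∷ b) (inside  ∷ U) e = contradiction (Vecₚ.∷-injectiveˡ e) λ ()
∣supp∣+∣b∣ (zero  ∷ h)   (inside  ∷ b) (outside ∷ U) e = contradiction (Vecₚ.∷-injectiveˡ e) λ ()
∣supp∣+∣b∣ (suc x ∷ h)   (_       ∷ b) (outside ∷ U) e = contradiction (Vecₚ.∷-injectiveˡ e) λ ()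

x∈b⇒x∉supp : ∀ (h : Vec ℕ k) {b U : Subset k} → h ⊞ sq b ≡ sq U → ∀ {x} → x ∈ b → x ∉ supp h
x∈b⇒x∉supp (suc y ∷ h) {inside ∷ b} {inside  ∷ U} e here here =
  contradiction (trans (sym (ℕₚ.+-suc y 0)) (ℕₚ.suc-injective (Vecₚ.∷-injectiveˡ e))) λ ()
x∈b⇒x∉supp (suc y ∷ h) {inside ∷ b} {outside ∷ U} e here here = contradiction (Vecₚ.∷-injectiveˡ e) λ ()
x∈b⇒x∉supp (y ∷ h) {s ∷ b} {u ∷ U} e (there x∈b) (there x∈h) =
  x∈b⇒x∉supp h (Vecₚ.∷-injectiveʳ e) x∈b x∈h

-- Enumeration of flags

-- It is used twice: for the sets F over b, with j = r - 1 when #b = 2, and for the sets U over F,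
-- with j = 1.
over : Subset k → ℕ → List (Subset k)
over []            zero    = [] ∷ []
over []            (suc j) = []
over (inside  ∷ b) j       = map (inside ∷_) (over b j)
over (outside ∷ b) zero    = map (outside ∷_) (over b 0)
over (outside ∷ b) (suc j) = map (outside ∷_) (over b (suc j)) ++ map (inside ∷_) (over b j)

nC0≡1 : ∀ n → n C 0 ≡ 1
nC0≡1 n = trans (nCk≡nC[n∸k] {0} {n} z≤n) (nCn≡1 n)

length-over : ∀ (b : Subset k) j → length (over b j) ≡ (k ∸ ∣ b ∣) C j
length-over []            zero    = refl
length-over []            (suc j) = sym (k>n⇒nCk≡0 {0} {suc j} (s≤s z≤n))
length-over (inside  ∷ b) j       = trans (Listₚ.length-map (inside ∷_) (over b j)) (length-over b j)
length-over {suc k} (outside ∷ b) zero = trans (Listₚ.length-map (outside ∷_) (over b 0))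
  (trans (length-over b 0) (trans (nC0≡1 (k ∸ ∣ b ∣)) (sym (nC0≡1 (suc k ∸ ∣ b ∣)))))
length-over {suc k} (outside ∷ b) (suc j) = trans (Listₚ.length-++ (map (outside ∷_) (over b (suc j))))
  (trans (cong₂ _+_
    (trans (Listₚ.length-map (outside ∷_) (over b (suc j))) (length-over b (suc j)))
    (trans (Listₚ.length-map (inside ∷_) (over b j)) (length-over b j)))
  (trans (ℕₚ.+-comm ((k ∸ ∣ b ∣) C suc j) ((k ∸ ∣ b ∣) C j))
  (trans (nCk+nC[k+1]≡[n+1]C[k+1] (k ∸ ∣ b ∣) j)
    (cong (_C suc j) (sym (ℕₚ.+-∸-assoc 1 (∣p∣≤n b)))))))

∈-over⁻ : ∀ (b : Subset k) j {F} → F ∈ˡ over b j → b ⊆ F × ∣ F ∣ ≡ ∣ b ∣ + j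
∈-over⁻ []            zero    (here refl) = (λ x∈ → x∈) , refl
∈-over⁻ (inside  ∷ b) j       F∈ with ∈-map⁻ (inside ∷_) F∈
... | F , F∈′ , refl = let b⊆F , ∣F∣ = ∈-over⁻ b j F∈′ in in⊆in b⊆F , cong suc ∣F∣
∈-over⁻ (outside ∷ b) zero    F∈ with ∈-map⁻ (outside ∷_) F∈
... | F , F∈′ , refl = let b⊆F , ∣F∣ = ∈-over⁻ b 0 F∈′ in out⊆ b⊆F , ∣F∣
∈-over⁻ (outside ∷ b) (suc j) F∈ with ∈-++⁻ (map (outside ∷_) (over b (suc j))) F∈
... | inj₁ F∈ˡ with ∈-map⁻ (outside ∷_) F∈ˡ
...   | F , F∈′ , refl = let b⊆F , ∣F∣ = ∈-over⁻ b (suc j) F∈′ in out⊆ b⊆F , ∣F∣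
∈-over⁻ (outside ∷ b) (suc j) F∈ | inj₂ F∈ʳ with ∈-map⁻ (inside ∷_) F∈ʳ
...   | F , F∈′ , refl = let b⊆F , ∣F∣ = ∈-over⁻ b j F∈′ in
  out⊆ b⊆F , trans (cong suc ∣F∣) (sym (ℕₚ.+-suc ∣ b ∣ j))

∈-over⁺ : ∀ (b F : Subset k) j → b ⊆ F → ∣ F ∣ ≡ ∣ b ∣ + j → F ∈ˡ over b j
∈-over⁺ []            []            zero    b⊆F ∣F∣ = here refl
∈-over⁺ (inside  ∷ b) (outside ∷ F) j       b⊆F ∣F∣ = contradiction (b⊆F here) λ ()
∈-over⁺ (inside  ∷ b) (inside  ∷ F) j       b⊆F ∣F∣ =
  ∈-map⁺ (inside ∷_) (∈-over⁺ b F j (drop-∷-⊆ b⊆F) (ℕₚ.suc-injective ∣F∣))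
∈-over⁺ (outside ∷ b) (outside ∷ F) zero    b⊆F ∣F∣ = ∈-map⁺ (outside ∷_) (∈-over⁺ b F 0 (drop-∷-⊆ b⊆F) ∣F∣)
∈-over⁺ (outside ∷ b) (inside  ∷ F) zero    b⊆F ∣F∣ = contradiction
  (p⊆q⇒∣p∣≤∣q∣ (drop-∷-⊆ b⊆F))
  (ℕₚ.<⇒≱ (ℕₚ.≤-reflexive (trans ∣F∣ (ℕₚ.+-identityʳ ∣ b ∣))))
∈-over⁺ (outside ∷ b) (outside ∷ F) (suc j) b⊆F ∣F∣ =
  ∈-++⁺ˡ (∈-map⁺ (outside ∷_) (∈-over⁺ b F (suc j) (drop-∷-⊆ b⊆F) ∣F∣))
∈-over⁺ (outside ∷ b) (inside  ∷ F) (suc j) b⊆F ∣F∣ =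
  ∈-++⁺ʳ (map (outside ∷_) (over b (suc j))) (∈-map⁺ (inside ∷_) (∈-over⁺ b F j (drop-∷-⊆ b⊆F)
    (ℕₚ.suc-injective (trans ∣F∣ (ℕₚ.+-suc ∣ b ∣ j)))))

out∷≢in∷ : ∀ {k} {xs ys : List (Subset k)} {x : Subset (suc k)} →
           ¬ (x ∈ˡ map (outside ∷_) xs × x ∈ˡ map (inside ∷_) ys)
out∷≢in∷ (x∈ , x∈′) with ∈-map⁻ (outside ∷_) x∈ | ∈-map⁻ (inside ∷_) x∈′
... | _ , _ , refl | _ , _ , ()

over-unique : ∀ (b : Subset k) j → Unique (over b j)
over-unique []            zero    = [] ∷ []
over-unique []            (suc j) = []
over-unique (inside  ∷ b) j       = Uniqueₚ.map⁺ Vecₚ.∷-injectiveʳ (over-unique b j)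
over-unique (outside ∷ b) zero    = Uniqueₚ.map⁺ Vecₚ.∷-injectiveʳ (over-unique b 0)
over-unique (outside ∷ b) (suc j) = Uniqueₚ.++⁺
  (Uniqueₚ.map⁺ Vecₚ.∷-injectiveʳ (over-unique b (suc j)))
  (Uniqueₚ.map⁺ Vecₚ.∷-injectiveʳ (over-unique b j)) out∷≢in∷

length-over-1 : ∀ (F : Subset k) → length (over F 1) ≡ k ∸ ∣ F ∣
length-over-1 {k} F = trans (length-over F 1) (nC1≡n (k ∸ ∣ F ∣))

0<length-over : ∀ (F : Subset k) → ∣ F ∣ < k → 0 < length (over F 1)
0<length-over F ∣F∣<k = subst (0 <_) (sym (length-over-1 F)) (ℕₚ.m<n⇒0<n∸m ∣F∣<k)

module _ {a b} {A : Set a} {B : Set b} (f : A → List B) where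

  pairs : List A → List (A × B)
  pairs []       = []
  pairs (x ∷ xs) = map (x ,_) (f x) ++ pairs xs

  ∈-pairs⁺ : ∀ {xs x y} → x ∈ˡ xs → y ∈ˡ f x → (x , y) ∈ˡ pairs xs
  ∈-pairs⁺ {x′ ∷ xs} (here refl) y∈ = ∈-++⁺ˡ (∈-map⁺ (x′ ,_) y∈)
  ∈-pairs⁺ {x′ ∷ xs} (there x∈)  y∈ = ∈-++⁺ʳ (map (x′ ,_) (f x′)) (∈-pairs⁺ x∈ y∈)

  ∈-pairs⁻ : ∀ xs {x y} → (x , y) ∈ˡ pairs xs → x ∈ˡ xs × y ∈ˡ f x
  ∈-pairs⁻ (x′ ∷ xs) p∈ with ∈-++⁻ (map (x′ ,_) (f x′)) p∈
  ... | inj₂ p∈ʳ = let x∈ , y∈ = ∈-pairs⁻ xs p∈ʳ in there x∈ , y∈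
  ... | inj₁ p∈ˡ with ∈-map⁻ (x′ ,_) p∈ˡ
  ...   | _ , y∈ , refl = here refl , y∈

  pairs-unique : ∀ {xs} → Unique xs → (∀ x → Unique (f x)) → Unique (pairs xs)
  pairs-unique {[]}     []       f! = []
  pairs-unique {x ∷ xs} (x∉ ∷ u) f! = Uniqueₚ.++⁺ (Uniqueₚ.map⁺ (cong proj₂) (f! x)) (pairs-unique u f!)
    λ (p∈ , p∈′) → disjoint (∈-map⁻ (x ,_) p∈) p∈′
    where
    disjoint : ∀ {p} → ∃ (λ y → y ∈ˡ f x × p ≡ (x , y)) → ¬ p ∈ˡ pairs xs
    disjoint (_ , _ , refl) p∈′ = All.lookup x∉ (proj₁ (∈-pairs⁻ xs p∈′)) refl

  length-pairs : ∀ xs q → (∀ {x} → x ∈ˡ xs → length (f x) ≡ q) → length (pairs xs) ≡ length xs * q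
  length-pairs []       q lengths = refl
  length-pairs (x ∷ xs) q lengths = trans (Listₚ.length-++ (map (x ,_) (f x)))
    (cong₂ _+_ (trans (Listₚ.length-map (x ,_) (f x)) (lengths (here refl)))
      (length-pairs xs q (λ x∈ → lengths (there x∈))))

-- A homomorphism extends to Sᵐ when θ(F,U) depends on F only. Subtracting such homomorphisms makes
-- θ vanish at one chosen U over each F. This U is removed by `drop 1`, and the remaining pairs
-- index a basis.
flags : Subset k → ℕ → List (Subset k × Subset k)
flags b j = pairs (λ F → drop 1 (over F 1)) (over b j)

flags-unique : ∀ (b : Subset k) j → Unique (flags b j)
flags-unique b j = pairs-unique _ (over-unique b j) (λ F → Uniqueₚ.drop⁺ 1 (over-unique F 1))

length-flags : ∀ (b : Subset k) j → length (flags b j) ≡ ((k ∸ ∣ b ∣) C j) * (k ∸ (∣ b ∣ + j) ∸ 1)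
length-flags {k} b j = trans
  (length-pairs _ (over b j) (k ∸ (∣ b ∣ + j) ∸ 1) λ {F} F∈ → trans (Listₚ.length-drop 1 (over F 1))
    (cong (_∸ 1) (trans (length-over-1 F) (cong (k ∸_) (proj₂ (∈-over⁻ b j F∈))))))
  (cong (_* (k ∸ (∣ b ∣ + j) ∸ 1)) (length-over b j))

module _ {a} {A : Set a} where

  firstOf : (xs : List A) → 0 < length xs → A
  firstOf (x ∷ xs) _ = x

  firstOf-∈ : ∀ xs (0<∣xs∣ : 0 < length xs) → firstOf xs 0<∣xs∣ ∈ˡ xs
  firstOf-∈ (x ∷ xs) _ = here refl

  firstOf∉drop : ∀ {xs} → Unique xs → (0<∣xs∣ : 0 < length xs) → ¬ firstOf xs 0<∣xs∣ ∈ˡ drop 1 xs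
  firstOf∉drop (x∉ ∷ _) _ x∈ = All.lookup x∉ x∈ refl

  ∈⇒first⊎drop : ∀ {xs} (0<∣xs∣ : 0 < length xs) {x} → x ∈ˡ xs → x ≡ firstOf xs 0<∣xs∣ ⊎ x ∈ˡ drop 1 xs
  ∈⇒first⊎drop _ (here x≡)  = inj₁ x≡
  ∈⇒first⊎drop _ (there x∈) = inj₂ x∈

  ∈-drop : ∀ (xs : List A) {x} → x ∈ˡ drop 1 xs → x ∈ˡ xs
  ∈-drop (_ ∷ xs) x∈ = there x∈

-- The closed form of the dimension

-- This is (k+1)·C(n,k+1) = (n-k)·C(n,k) with the subtraction moved to the other side, so that it
-- can be proved in ℕ for all n and k by Pascal's rule.
absorption : ∀ n k → suc k * (n C suc k) + k * (n C k) ≡ n * (n C k)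
absorption zero    zero    = refl
absorption zero    (suc k) = cong₂ _+_
  (trans (cong (suc (suc k) *_) (k>n⇒nCk≡0 {0} {2 + k} (s≤s z≤n))) (ℕₚ.*-zeroʳ (suc (suc k))))
  (trans (cong (suc k *_) (k>n⇒nCk≡0 {0} {suc k} (s≤s z≤n))) (ℕₚ.*-zeroʳ (suc k)))
absorption (suc n) zero    = trans (ℕₚ.+-identityʳ _) (trans (ℕₚ.*-identityˡ _) (trans (nC1≡n (suc n))
  (sym (trans (cong (suc n *_) (nC0≡1 (suc n))) (ℕₚ.*-identityʳ (suc n))))))
absorption (suc n) (suc k) = begin
  (2 + k) * (suc n C (2 + k)) + suc k * (suc n C suc k)
    ≡⟨ cong₂ (λ x y → (2 + k) * x + suc k * y) (nCk+nC[k+1]≡[n+1]C[k+1] n (suc k)) (nCk+nC[k+1]≡[n+1]C[k+1] n k) ⟨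
  (2 + k) * (A₁ + A₂) + suc k * (A₀ + A₁)
    -- The first two brackets are the left sides of the induction hypotheses for k + 1 and k; the
    -- surplus A₀ + A₁ raises the factor n to n + 1.
    ≡⟨ solve 4 (λ κ x y z → (con 2 :+ κ) :* (y :+ z) :+ (con 1 :+ κ) :* (x :+ y) :=
         ((con 2 :+ κ) :* z :+ (con 1 :+ κ) :* y) :+ ((con 1 :+ κ) :* y :+ κ :* x) :+ (x :+ y)) refl k A₀ A₁ A₂ ⟩
  ((2 + k) * A₂ + suc k * A₁) + (suc k * A₁ + k * A₀) + (A₀ + A₁)
    ≡⟨ cong₂ (λ x y → x + y + (A₀ + A₁)) (absorption n (suc k)) (absorption n k) ⟩
  n * A₁ + n * A₀ + (A₀ + A₁)
    ≡⟨ solve 3 (λ ν x y → ν :* y :+ ν :* x :+ (x :+ y) := (con 1 :+ ν) :* (x :+ y)) refl n A₀ A₁ ⟩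
  suc n * (A₀ + A₁)
    ≡⟨ cong (suc n *_) (nCk+nC[k+1]≡[n+1]C[k+1] n k) ⟩
  suc n * (suc n C suc k) ∎
  where
  open ≡-Reasoning
  open +-*-Solver
  A₀ = n C k
  A₁ = n C suc k
  A₂ = n C suc (suc k)

-- By absorption the product on the right is (N-s)·C(N,s), and subtracting one copy of C(N,s) leaves
-- N-s-1 copies. At N = s the truncated left side would be 0 and the right side -1.
dimension-formula : ∀ N s → suc s ≤ N →
  + ((N C s) * (N ∸ s ∸ 1)) ≡ (+ suc s) ℤ.* (+ (N C suc s)) ℤ.- (+ (N C s))
dimension-formula N s s<N = sym (begin
  (+ suc s) ℤ.* (+ (N C suc s)) ℤ.- (+ c)  ≡⟨ cong (ℤ._- (+ c)) (sym (ℤₚ.pos-* (suc s) (N C suc s))) ⟩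
  + (suc s * (N C suc s)) ℤ.- (+ c)        ≡⟨ cong (λ x → + x ℤ.- (+ c)) total ⟩
  + (c * q + c) ℤ.- (+ c)                  ≡⟨ ℤₚ.m-n≡m⊖n (c * q + c) c ⟩
  (c * q + c) ℤ.⊖ c                        ≡⟨ ℤₚ.⊖-≥ (ℕₚ.m≤n+m c (c * q)) ⟩
  + (c * q + c ∸ c)                        ≡⟨ cong +_ (ℕₚ.m+n∸n≡m (c * q) c) ⟩
  + (c * q) ∎)
  where
  open ≡-Reasoning
  open +-*-Solver
  c = N C s
  q = N ∸ s ∸ 1
  N≡ : N ≡ suc (q + s)
  N≡ = trans (sym (ℕₚ.m∸n+n≡m s<N)) (trans (ℕₚ.+-suc (N ∸ suc s) s)
    (cong (λ x → suc (x + s)) (sym (trans (ℕₚ.∸-+-assoc N s 1) (cong (N ∸_) (ℕₚ.+-comm s 1))))))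
  total : suc s * (N C suc s) ≡ c * q + c
  total = ℕₚ.+-cancelʳ-≡ (s * c) _ _ (trans (absorption N s) (trans (cong (_* c) N≡)
    (solve 3 (λ κ x y → (con 1 :+ (y :+ κ)) :* x := x :* y :+ x :+ κ :* x) refl s c q)))

-- Coefficients and syzygies of Stanley-Reisner ideals

module Coefficients {c ℓ : Level} (K : CommutativeRing c ℓ) (n : ℕ) where
  open Polynomials K n
  private
    module K = CommutativeRing K
    module S = CommutativeRing polynomialRing
  open SemiringSum K.semiring using () renaming (sum to ∑)
  open SemiringSum S.semiring using () renaming (sum to ∑ᵖ)

  δ-shift : ∀ h g f → δ (h ⊞ g) (f ⊞ g) K.≈ δ h f
  δ-shift h g f with f ≟ᵉ h
  ... | yes refl = δ-hit (h ⊞ g)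
  ... | no  f≢h    = δ-miss (λ e → f≢h (⊞-cancelʳ f h g e))

  -- The coefficient of x^a in x^g p, in the form in which `extend-*` produces it: a coefficient of
  -- a product is the linear extension of `translate` over the first factor.
  translate : Exponent → Polynomial → Exponent → K.Carrier
  translate g p a = extend (λ f → δ a (g ⊞ f)) p

  translate-hit : ∀ g p h → translate g p (h ⊞ g) K.≈ coefficient p h
  translate-hit g p h = extend-cong
    (λ f → K.trans (K.reflexive (cong (δ (h ⊞ g)) (⊞-comm g f))) (δ-shift h g f)) p

  translate-miss : ∀ g p a → ¬ g ∣ᵉ a → translate g p a K.≈ K.0#
  translate-miss g p a g∤a = K.trans
    (extend-cong (λ f → δ-miss (λ e → g∤a (f , trans (⊞-comm f g) e))) p) (extend-zero p)

  coefficient-* : ∀ p q a → coefficient (p *ᵖ q) a K.≈ extend (λ g → translate g q a) p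
  coefficient-* p q a = extend-* (δ a) p q

  extend-term₁ : ∀ (w : Exponent → K.Carrier) e → extend w (monomial e) K.≈ w e
  extend-term₁ w e = K.trans (K.+-identityʳ _) (K.*-identityˡ (w e))

  coefficient-monomial* : ∀ g p a → coefficient (monomial g *ᵖ p) a K.≈ translate g p a
  coefficient-monomial* g p a = K.trans (coefficient-* (monomial g) p a) (extend-term₁ (λ e → translate e p a) g)

  coefficient-constant* : ∀ k p a → coefficient (constant k *ᵖ p) a K.≈ k K.* coefficient p a
  coefficient-constant* k p a = K.trans (coefficient-* (constant k) p a) (K.trans (K.+-identityʳ _)
    (K.*-congˡ (extend-cong (λ f → extend-reindex (δ a) (+ᵉ-identityˡ f)) p)))

  coefficient-*monomial : ∀ p g h → coefficient (p *ᵖ monomial g) (h ⊞ g) K.≈ coefficient p h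
  coefficient-*monomial p g h = K.trans (coefficients (*ᵖ-comm p (monomial g)) (h ⊞ g))
    (K.trans (coefficient-monomial* g p (h ⊞ g)) (translate-hit g p h))

  coefficient-*monomial-miss : ∀ p g a → ¬ g ∣ᵉ a → coefficient (p *ᵖ monomial g) a K.≈ K.0#
  coefficient-*monomial-miss p g a g∤a = K.trans (coefficients (*ᵖ-comm p (monomial g)) a)
    (K.trans (coefficient-monomial* g p a) (translate-miss g p a g∤a))

  coefficient-monomial : ∀ e a → coefficient (monomial e) a K.≈ δ a e
  coefficient-monomial e a = extend-term₁ (δ a) e

  coefficient-∑ : ∀ {k} (p : Fin k → Polynomial) a →
                  coefficient (∑ᵖ p) a K.≈ ∑ (λ i → coefficient (p i) a)
  coefficient-∑ {zero}  p a = K.refl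
  coefficient-∑ {suc k} p a = K.trans (extend-+ (δ a) (p zero) (∑ᵖ (λ i → p (suc i))))
    (K.+-congˡ (coefficient-∑ (λ i → p (suc i)) a))

  ∑-zero : ∀ {k} (f : Fin k → K.Carrier) → (∀ i → f i K.≈ K.0#) → ∑ f K.≈ K.0#
  ∑-zero {zero}  f f≈0 = K.refl
  ∑-zero {suc k} f f≈0 = K.trans (K.+-cong (f≈0 zero) (∑-zero (λ i → f (suc i)) (λ i → f≈0 (suc i))))
    (K.+-identityˡ K.0#)

  ∑-single : ∀ {k} (j : Fin k) (f : Fin k → K.Carrier) → (∀ i → i ≢ j → f i K.≈ K.0#) → ∑ f K.≈ f j
  ∑-single zero    f f≈0 = K.trans
    (K.+-congˡ (∑-zero (λ i → f (suc i)) (λ i → f≈0 (suc i) λ ()))) (K.+-identityʳ (f zero))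
  ∑-single (suc j) f f≈0 = K.trans
    (K.+-cong (f≈0 zero λ ()) (∑-single j (λ i → f (suc i)) (λ i i≢j → f≈0 (suc i) (λ { refl → i≢j refl }))))
    (K.+-identityˡ _)

  only : ∀ {k} → Fin k → Fin k → K.Carrier → K.Carrier
  only i l x = if does (l Finₚ.≟ i) then x else K.0#

  only-+ : ∀ {k} (i l : Fin k) x y → only i l (x K.+ y) K.≈ only i l x K.+ only i l y
  only-+ i l x y with does (l Finₚ.≟ i)
  ... | true  = K.refl
  ... | false = K.sym (K.+-identityˡ K.0#)

  only-* : ∀ {k} (i l : Fin k) x y → only i l (x K.* y) K.≈ x K.* only i l y
  only-* i l x y with does (l Finₚ.≟ i)
  ... | true  = K.refl
  ... | false = K.sym (K.zeroʳ x)

  only-hit : ∀ {k} (i : Fin k) x → only i i x K.≈ x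
  only-hit i x rewrite proj₂ (dec-yes (i Finₚ.≟ i) refl) = K.refl

  only-miss : ∀ {k} {i l : Fin k} → l ≢ i → ∀ x → only i l x K.≈ K.0#
  only-miss {i = i} {l} l≢i x with l Finₚ.≟ i
  ... | yes l≡i = contradiction l≡i l≢i
  ... | no  _   = K.refl

module Presentation {c ℓ : Level} (𝕂 : Field c ℓ) {n : ℕ} (Δ : SimplicialComplex n) where
  open Field 𝕂 using () renaming (commutativeRing to K)
  open StanleyReisner 𝕂 Δ
  open Coefficients K n
  private
    module K = CommutativeRing K
    module S = CommutativeRing S
    module R = CommutativeRing S/I
    module Sᵐ = Module Sᵐ
    module Syzᴹ = Module (submodule Syz)
    module d = Hom d
  open SemiringSum K.semiring using () renaming (sum to ∑)
  open SemiringSum S.semiring using () renaming (sum to ∑ᵖ)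
  open CommutativeSemigroupProperties K.+-commutativeSemigroup using (interchange)
  open AbelianGroupProperties K.+-abelianGroup using (x≈y⇒x∙y⁻¹≈ε; x∙y⁻¹≈ε⇒x≈y)

  FaceExponent : Exponent → Set
  FaceExponent h = Face Δ (supp h)

  face-∣ᵉ : ∀ {g h} → g ∣ᵉ h → FaceExponent h → FaceExponent g
  face-∣ᵉ g∣h = ⊆-closed Δ (supp-∣ᵉ g∣h)

  -- Divisors of a face monomial are face monomials, so the polynomials without coefficients at face
  -- exponents form an ideal, and it contains the generators of I.
  I⇒coefficient≈0 : ∀ {p} → Contains I p → ∀ {h} → FaceExponent h → coefficient p h K.≈ K.0#
  I⇒coefficient≈0 p∈I {h} h-face = span⊆ vanishing
    (λ { (F , F∉) h h-face → K.trans (coefficient-monomial (sq F) h)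
      (δ-miss {h} {sq F} (λ { refl → F∉ (subst (Face Δ) (supp-sq F) h-face) })) })
    p∈I h h-face
    where
    vanishing : Ideal {R = S} ℓ
    vanishing = record
      { Contains = λ p → ∀ h → FaceExponent h → coefficient p h K.≈ K.0#
      ; resp     = λ p≈q p∈ h h-face → K.trans (K.sym (coefficients p≈q h)) (p∈ h h-face)
      ; 0-closed = λ h h-face → K.refl
      ; +-closed = λ {p} {q} p∈ q∈ h h-face → K.trans (extend-+ (δ h) p q)
          (K.trans (K.+-cong (p∈ h h-face) (q∈ h h-face)) (K.+-identityˡ K.0#))
      ; *-closed = λ q {p} p∈ h h-face → K.trans (coefficient-* q p h)
          (K.trans (extend-cong (shifted {p} p∈ h-face) q) (extend-zero q))
      }
      where
      shifted : ∀ {p} → (∀ h → FaceExponent h → coefficient p h K.≈ K.0#) →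
                ∀ {h} → FaceExponent h → ∀ g → translate g p h K.≈ K.0#
      shifted {p} p∈ {h} h-face g with g ∣ᵉ? h
      ... | yes (f , refl) = K.trans (translate-hit g p f) (p∈ f (face-∣ᵉ (g , ⊞-comm g f) h-face))
      ... | no  g∤h          = translate-miss g p h g∤h

  -- The filter inspects exponents only, since coefficients cannot be tested for zero. Terms at face
  -- exponents that cancel each other are thrown away without being matched.
  nonfacePart : Polynomial → Polynomial
  nonfacePart []            = []
  nonfacePart ((k , e) ∷ p) = if does (Face? Δ (supp e)) then nonfacePart p else (k , e) ∷ nonfacePart p

  nonface∈I : ∀ k e → ¬ FaceExponent e → Contains I ((k , e) ∷ [])
  nonface∈I k e e∉ with ⊆⇒sq-∣ᵉ (supp e) e (λ x∈ → x∈)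
  ... | g , g+e = Submodule.resp I {((k , g) ∷ []) *ᵖ monomial (sq (supp e))}
    (S.trans (extends⇒≈ᵖ (λ w → K.+-congʳ (K.*-congʳ (K.*-identityʳ k))))
      (S.reflexive (cong (λ f → (k , f) ∷ []) g+e)))
    (Submodule.*-closed I ((k , g) ∷ []) (gen (supp e , e∉)))

  nonfacePart∈I : ∀ p → Contains I (nonfacePart p)
  nonfacePart∈I []            = Submodule.0-closed I
  nonfacePart∈I ((k , e) ∷ p) with Face? Δ (supp e)
  ... | yes _  = nonfacePart∈I p
  ... | no  e∉ = Submodule.+-closed I (nonface∈I k e e∉) (nonfacePart∈I p)

  nonfacePart-face : ∀ p {h} → FaceExponent h → coefficient (nonfacePart p) h K.≈ K.0#
  nonfacePart-face p = I⇒coefficient≈0 (nonfacePart∈I p)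

  nonfacePart-nonface : ∀ p {h} → ¬ FaceExponent h → coefficient (nonfacePart p) h K.≈ coefficient p h
  nonfacePart-nonface []            h∉ = K.refl
  nonfacePart-nonface ((k , e) ∷ p) {h} h∉ with Face? Δ (supp e)
  ... | no  _  = K.+-congˡ (nonfacePart-nonface p h∉)
  ... | yes e∈ = K.trans (nonfacePart-nonface p h∉) (K.sym (K.trans
    (K.+-congʳ (K.trans (K.*-congˡ (δ-miss {h} {e} (λ { refl → h∉ e∈ }))) (K.zeroʳ k)))
    (K.+-identityˡ _)))

  coefficient≈0⇒I : ∀ p → (∀ h → FaceExponent h → coefficient p h K.≈ K.0#) → Contains I p
  coefficient≈0⇒I p p≈0 = Submodule.resp I {nonfacePart p} (coefficientwise compare) (nonfacePart∈I p)
    where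
    compare : ∀ h → coefficient (nonfacePart p) h K.≈ coefficient p h
    compare h with Face? Δ (supp h)
    ... | yes h∈ = K.trans (nonfacePart-face p h∈) (K.sym (p≈0 h h∈))
    ... | no  h∉ = nonfacePart-nonface p h∉

  infix 4 _≈ᶠ_
  -- The monomials supported on faces form a K-basis of S/I, so this is equality in S/I, expressed
  -- by scalars.
  record _≈ᶠ_ (p q : Polynomial) : Set ℓ where
    constructor facewise
    field
      faceCoefficient : ∀ {h} → FaceExponent h → coefficient p h K.≈ coefficient q h
  open _≈ᶠ_ public

  coefficient-sub : ∀ p q h → coefficient (p +ᵖ -ᵖ q) h K.≈ coefficient p h K.- coefficient q h
  coefficient-sub p q h = K.trans (extend-+ (δ h) p (-ᵖ q)) (K.+-congˡ (extend-neg (δ h) q))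

  ≈⇒≈ᶠ : ∀ {p q} → p R.≈ q → p ≈ᶠ q
  ≈⇒≈ᶠ {p} {q} p≈q = facewise λ {h} h-face → x∙y⁻¹≈ε⇒x≈y (coefficient p h) (coefficient q h)
    (K.trans (K.sym (coefficient-sub p q h)) (I⇒coefficient≈0 (difference p≈q) h-face))

  ≈ᶠ⇒≈ : ∀ {p q} → p ≈ᶠ q → p R.≈ q
  ≈ᶠ⇒≈ {p} {q} p≈q = congruent (coefficient≈0⇒I (p +ᵖ -ᵖ q) λ h h-face →
    K.trans (coefficient-sub p q h) (x≈y⇒x∙y⁻¹≈ε (faceCoefficient p≈q h-face)))

  𝔣 : Fin m → Subset n
  𝔣 = lookup minimalNonfaces

  𝔣-minimal : ∀ i → SimplicialComplex.IsMinimalNonface Δ (𝔣 i)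
  𝔣-minimal i = All.lookup (all-filter (SimplicialComplex.isMinimalNonface? Δ) (allSubsets n)) (∈-lookup i)

  unit : Exponent → Fin m → Sᵐ.Carrierᴹ
  unit e i = monomial e Sᵐ.*ₗ basisVector i

  coefficient-unit : ∀ e i l h → coefficient (unit e i l) h K.≈ only i l (δ h e)
  coefficient-unit e i l h with l Finₚ.≟ i
  ... | yes _ = K.trans (coefficients (S.*-identityʳ (monomial e)) h) (coefficient-monomial e h)
  ... | no  _ = coefficients (S.zeroʳ (monomial e)) h

  d-unit : ∀ e i → ⟦ d ⟧ (unit e i) S.≈ monomial (e ⊞ generatorExponent i)
  d-unit e i = S.trans (d.*ₗ-homo (monomial e) (basisVector i))
    (S.trans (S.*-congˡ {monomial e} (d-basisVector i)) (monomial-+ e (generatorExponent i)))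

  abstract
    d-binomial : ∀ e i f j → e ⊞ generatorExponent i ≡ f ⊞ generatorExponent j →
                 ⟦ d ⟧ (unit e i Sᵐ.+ᴹ Sᵐ.-ᴹ unit f j) S.≈ S.0#
    d-binomial e i f j eq = S.trans (d.+ᴹ-homo (unit e i) (Sᵐ.-ᴹ unit f j)) (S.trans
      (S.+-cong (d-unit e i) (S.trans (d.-ᴹ-homo (unit f j)) (S.-‿cong (d-unit f j))))
      (S.trans (S.+-congʳ (S.reflexive (cong monomial eq))) (S.-‿inverseʳ (monomial (f ⊞ generatorExponent j)))))

  binomial : ∀ e i f j → e ⊞ generatorExponent i ≡ f ⊞ generatorExponent j → Syzᴹ.Carrierᴹ
  binomial e i f j eq = unit e i Sᵐ.+ᴹ Sᵐ.-ᴹ unit f j , d-binomial e i f j eq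

  record Binomial : Set where
    constructor mkBinomial
    field
      {e f}    : Exponent
      {i j}    : Fin m
      balanced : e ⊞ generatorExponent i ≡ f ⊞ generatorExponent j

  ⟪_⟫ : Binomial → Syzᴹ.Carrierᴹ
  ⟪ mkBinomial {e} {f} {i} {j} eq ⟫ = binomial e i f j eq

  -- The generator found depends on a alone, so all terms of degree a in a syzygy are compared with
  -- the same multiple of a basis vector.
  reference : ∀ a → Dec (∃ λ j → generatorExponent j ∣ᵉ a)
  reference a = Finₚ.any? (λ j → generatorExponent j ∣ᵉ? a)

  private
    preimage : ∀ {a} → Dec (∃ λ j → generatorExponent j ∣ᵉ a) → Fin m → Exponent → K.Carrier
    preimage (yes (j , g , _)) l h = coefficient (unit g j l) h
    preimage (no  _)           l h = K.0#

    -- Coefficient of xʰ in the l-th coordinate of the chosen preimage under d of the monomial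
    -- xʰ⁺ᵍ, where xᵍ is the l-th generator.
    w : Fin m → Exponent → K.Carrier
    w l h = preimage (reference (h ⊞ generatorExponent l)) l h

    target : Fin m → Exponent → Exponent
    target l h = h ⊞ generatorExponent l

  -- The vector x^e e_i is a binomial plus the chosen preimage of its image under d. The second
  -- summand is written as a weight times a coefficient of that image, a form that stays linear when
  -- terms are added up.
  reduce : ∀ e i → ∃ λ b → ∀ l h →
    coefficient (proj₁ ⟪ b ⟫ l) h K.+ (w l h K.* δ (target l h) (e ⊞ generatorExponent i))
      K.≈ only i l (δ h e)
  reduce e i with reference (e ⊞ generatorExponent i) in eq
  ... | no  none        = contradiction (i , e , refl) none
  ... | yes (j , g , balanced) = mkBinomial {e} {g} {i} {j} (sym balanced) , λ l h →
    K.trans (K.+-cong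
      (K.trans (coefficient-sub (unit e i l) (unit g j l) h) (K.+-congʳ (coefficient-unit e i l h)))
      (weight l h))
    (K.trans (K.+-assoc _ _ _) (K.trans (K.+-congˡ (K.-‿inverseˡ _)) (K.+-identityʳ _)))
    where
    weight : ∀ l h → (w l h K.* δ (target l h) (e ⊞ generatorExponent i)) K.≈ coefficient (unit g j l) h
    weight l h with (e ⊞ generatorExponent i) ≟ᵉ target l h
    ... | yes hit = K.trans (K.*-identityʳ _) (K.reflexive (trans
      (cong (λ a → preimage (reference a) l h) (sym hit))
      (cong (λ q → preimage q l h) eq)))
    ... | no  miss = K.trans (K.zeroʳ _) (K.sym (K.trans (coefficient-unit g j l h) zero-off))
      where
      zero-off : only j l (δ h g) K.≈ K.0#
      zero-off with l Finₚ.≟ j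
      ... | no  _      = K.refl
      ... | yes refl = δ-miss {h} {g} (λ { refl → miss (sym balanced) })

  private
    SpannedByBinomials : Syzᴹ.Carrierᴹ → Set (c ⊔ ℓ)
    SpannedByBinomials = Span (submodule Syz) ⟪_⟫

    reduceTerms : ∀ p i → ∃ λ y → SpannedByBinomials y × (∀ l h →
      coefficient (proj₁ y l) h K.+ (w l h K.* coefficient (p *ᵖ generator i) (target l h))
        K.≈ only i l (coefficient p h))
    reduceTerms [] i = Syzᴹ.0ᴹ , zero , λ l h →
      K.trans (K.+-identityˡ _) (K.trans (K.zeroʳ _) (K.sym (only-0 l)))
      where
      only-0 : ∀ l → only i l K.0# K.≈ K.0#
      only-0 l with does (l Finₚ.≟ i)
      ... | true  = K.refl
      ... | false = K.refl
    reduceTerms ((k , e) ∷ p) i =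
      let b , b-coefficients = reduce e i
          y , y∈ , y-coefficients = reduceTerms p i
      in constant k Syzᴹ.*ₗ ⟪ b ⟫ Syzᴹ.+ᴹ y , plus (scale (constant k) (gen b)) y∈ , λ l h →
        let a = target l h
            u = e ⊞ generatorExponent i
        in
        K.trans (K.+-cong
          (K.trans (extend-+ (δ h) (constant k *ᵖ proj₁ ⟪ b ⟫ l) (proj₁ y l))
            (K.+-congʳ (coefficient-constant* k (proj₁ ⟪ b ⟫ l) h)))
          (K.trans (K.*-congˡ (K.+-congʳ (K.*-congʳ (K.*-identityʳ k))))
            (K.distribˡ (w l h) (k K.* δ a u) (coefficient (p *ᵖ generator i) a))))
        (K.trans (interchange _ _ _ _)
        (K.trans (K.+-cong
          (K.trans (K.+-congˡ (x∙yz≈y∙xz (w l h) k (δ a u)))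
          (K.trans (K.sym (K.distribˡ k _ _))
          (K.trans (K.*-congˡ (b-coefficients l h)) (K.sym (only-* i l k (δ h e))))))
          (y-coefficients l h))
        (K.sym (only-+ i l (k K.* δ h e) (coefficient p h)))))
      where open CommutativeSemigroupProperties K.*-commutativeSemigroup using (x∙yz≈y∙xz)

    -- The map σ remembers to which coordinates the k polynomials belong, so that the induction can
    -- remove them one at a time; in the end σ is the identity.
    reduceAll : ∀ {k} (p : Fin k → Polynomial) (σ : Fin k → Fin m) →
      ∃ λ y → SpannedByBinomials y × (∀ l h →
        coefficient (proj₁ y l) h K.+
          (w l h K.* coefficient (∑ᵖ (λ i → p i *ᵖ generator (σ i))) (target l h))
        K.≈ ∑ (λ i → only (σ i) l (coefficient (p i) h)))
    reduceAll {zero}  p σ = Syzᴹ.0ᴹ , zero , λ l h → K.trans (K.+-identityˡ _) (K.zeroʳ _)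
    reduceAll {suc k} p σ =
      let y , y∈ , y-coefficients = reduceTerms (p zero) (σ zero)
          z , z∈ , z-coefficients = reduceAll (λ i → p (suc i)) (λ i → σ (suc i))
      in y Syzᴹ.+ᴹ z , plus y∈ z∈ , λ l h →
        K.trans (K.+-cong (extend-+ (δ h) (proj₁ y l) (proj₁ z l))
          (K.trans (K.*-congˡ (extend-+ (δ (target l h)) (p zero *ᵖ generator (σ zero))
              (∑ᵖ (λ i → p (suc i) *ᵖ generator (σ (suc i))))))
            (K.distribˡ (w l h) _ _)))
        (K.trans (interchange _ _ _ _) (K.+-cong (y-coefficients l h) (z-coefficients l h)))

  -- Over all terms of x, the chosen preimages add up with the coefficients of d(x) as factors.
  -- These are zero, so only the binomials remain.
  binomials-span : ∀ x → SpannedByBinomials x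
  binomials-span x = let y , y∈ , y-coefficients = reduceAll (proj₁ x) (λ i → i) in
    resp (λ l → coefficientwise λ h → K.trans (K.sym (K.+-identityʳ _))
      (K.trans (K.+-congˡ (K.sym (K.trans (K.*-congˡ (coefficients (proj₂ x) (target l h))) (K.zeroʳ _))))
      (K.trans (y-coefficients l h)
      (K.trans (∑-single l _ (λ i i≢l → only-miss {i = i} {l} (λ l≡i → i≢l (sym l≡i)) _)) (only-hit l _)))))
      y∈

  T²-Hom : Set (c ⊔ ℓ)
  T²-Hom = Hom Syz/Kosz (regular {R = S/I})

  Syz-≈⇒ : ∀ (φ : T²-Hom) {x y} → x Syzᴹ.≈ᴹ y → ⟦ φ ⟧ x R.≈ ⟦ φ ⟧ y
  Syz-≈⇒ φ x≈y = Hom.⟦⟧-cong φ (≈⇒congruent Kosz x≈y)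

  equalizer : T²-Hom → T²-Hom → Submodule (submodule Syz) (c ⊔ ℓ)
  equalizer φ φ′ = record
    { Contains = λ x → ⟦ φ ⟧ x R.≈ ⟦ φ′ ⟧ x
    ; resp     = λ {x} {y} x≈y e → R.trans (R.sym (Syz-≈⇒ φ {x} {y} x≈y)) (R.trans e (Syz-≈⇒ φ′ {x} {y} x≈y))
    ; 0-closed = R.trans (Hom.0ᴹ-homo φ) (R.sym (Hom.0ᴹ-homo φ′))
    ; +-closed = λ {x} {y} e f → R.trans (Hom.+ᴹ-homo φ x y)
        (R.trans (R.+-cong e f) (R.sym (Hom.+ᴹ-homo φ′ x y)))
    ; *-closed = λ a {x} e → R.trans (Hom.*ₗ-homo φ a x)
        (R.trans (R.*-congˡ {a} e) (R.sym (Hom.*ₗ-homo φ′ a x)))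
    }

  binomials-determine : ∀ (φ φ′ : T²-Hom) → (∀ b → Contains (equalizer φ φ′) ⟪ b ⟫) → φ ≈ʰ φ′
  binomials-determine φ φ′ agree-on = pointwise λ x → span⊆ (equalizer φ φ′) agree-on (binomials-span x)

-- Degree shifts by -b and values on binomials

neg : ∀ {k} → Subset k → Vec ℤ k
neg = Vec.map (λ s → if s then ℤ.-1ℤ else ℤ.0ℤ)

degree-∸ : ∀ {k} (e g : Vec ℕ k) → Vec.zipWith ℤ._-_ (Vec.map +_ (e ⊞ g)) (Vec.map +_ g) ≡ Vec.map +_ e
degree-∸ []      []      = refl
degree-∸ (x ∷ e) (y ∷ g) = cong₂ _∷_
  (trans (ℤₚ.m-n≡m⊖n (x ℕ.+ y) y) (trans (ℤₚ.⊖-≥ (ℕₚ.m≤n+m y x)) (cong +_ (ℕₚ.m+n∸n≡m x y))))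
  (degree-∸ e g)

-- Moves the degree condition from ℤⁿ to ℕⁿ, where it also shows that x^b divides x^a.
degree-neg : ∀ {k} (h a : Vec ℕ k) (b : Subset k) →
             Vec.map +_ h ≡ Vec.zipWith ℤ._+_ (Vec.map +_ a) (neg b) → h ⊞ sq b ≡ a
degree-neg []      []      []            eq = refl
degree-neg (x ∷ h) (y ∷ a) (outside ∷ b) eq = cong₂ _∷_
  (trans (ℕₚ.+-identityʳ x) (ℤₚ.+-injective (trans (Vecₚ.∷-injectiveˡ eq) (ℤₚ.+-identityʳ (+ y)))))
  (degree-neg h a b (Vecₚ.∷-injectiveʳ eq))
degree-neg (x ∷ h) (suc y ∷ a) (inside ∷ b) eq = cong₂ _∷_
  (trans (ℕₚ.+-comm x 1) (cong suc (ℤₚ.+-injective (Vecₚ.∷-injectiveˡ eq))))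
  (degree-neg h a b (Vecₚ.∷-injectiveʳ eq))
degree-neg (x ∷ h) (zero ∷ a) (inside ∷ b) eq = contradiction (Vecₚ.∷-injectiveˡ eq) λ ()

degree-neg⁻ : ∀ {k} (h : Vec ℕ k) (b : Subset k) →
              Vec.zipWith ℤ._+_ (Vec.map +_ (h ⊞ sq b)) (neg b) ≡ Vec.map +_ h
degree-neg⁻ []      []            = refl
degree-neg⁻ (x ∷ h) (outside ∷ b) = cong₂ _∷_
  (trans (ℤₚ.+-identityʳ _) (cong +_ (ℕₚ.+-identityʳ x))) (degree-neg⁻ h b)
degree-neg⁻ (x ∷ h) (inside  ∷ b) rewrite ℕₚ.+-comm x 1 = cong₂ _∷_ refl (degree-neg⁻ h b)

module Divisors {c ℓ : Level} (𝕂 : Field c ℓ) {n : ℕ} (Δ : SimplicialComplex n) where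
  open Field 𝕂 using () renaming (commutativeRing to K)
  open StanleyReisner 𝕂 Δ
  open Coefficients K n
  open Presentation 𝕂 Δ
  private
    module K = CommutativeRing K
    module S = CommutativeRing S
    module R = CommutativeRing S/I
    module Sᵐ = Module Sᵐ
    module Syzᴹ = Module (submodule Syz)
    module Gᵠ = Graded {K = K} {A = S/I} constant
      (quotient-ι-homo {K = K} {A = S} constant constant-isRingHomomorphism n I) n

  -- Recording the common degree a turns a binomial into the difference D - E of two terms with the
  -- same image x^a under d. Such differences satisfy a cocycle rule, so the values against one
  -- reference E determine all of them.
  Divisor : Exponent → Set
  Divisor a = ∃ λ i → generatorExponent i ∣ᵉ a

  support : ∀ {a} → Divisor a → Subset n
  support (i , _) = 𝔣 i

  infix 8 _−_
  _−_ : ∀ {a} → Divisor a → Divisor a → Syzᴹ.Carrierᴹ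
  (i , e , e+i) − (j , f , f+j) = binomial e i f j (trans e+i (sym f+j))

  coefficient-− : ∀ {a} (D E : Divisor a) l h → coefficient (proj₁ (D − E) l) h K.≈
    only (proj₁ D) l (δ h (proj₁ (proj₂ D))) K.- only (proj₁ E) l (δ h (proj₁ (proj₂ E)))
  coefficient-− (i , e , _) (j , f , _) l h = K.trans (coefficient-sub (unit e i l) (unit f j l) h)
    (K.+-cong (coefficient-unit e i l h) (K.-‿cong (coefficient-unit f j l h)))

  telescope : ∀ x y z → (x K.- y) K.+ (y K.- z) K.≈ x K.- z
  telescope x y z = K.trans (K.+-assoc x (K.- y) (y K.- z)) (K.+-congˡ
    (K.trans (K.sym (K.+-assoc (K.- y) y (K.- z)))
    (K.trans (K.+-congʳ (K.-‿inverseˡ y)) (K.+-identityˡ (K.- z)))))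

  −-cocycle : ∀ {a} (D E F : Divisor a) → ((D − E) Syzᴹ.+ᴹ (E − F)) Syzᴹ.≈ᴹ (D − F)
  −-cocycle D E F l = coefficientwise λ h → K.trans (extend-+ (δ h) (proj₁ (D − E) l) (proj₁ (E − F) l))
    (K.trans (K.+-cong (coefficient-− D E l h) (coefficient-− E F l h))
    (K.trans (telescope _ _ _) (K.sym (coefficient-− D F l h))))

  quotient-irrelevant : ∀ {i a e e′} → e ⊞ generatorExponent i ≡ a → e′ ⊞ generatorExponent i ≡ a → e ≡ e′
  quotient-irrelevant {e = e} {e′} p p′ = ⊞-cancelʳ e e′ _ (trans p (sym p′))

  −-congˡ : ∀ {a} (D D′ E : Divisor a) → proj₁ D ≡ proj₁ D′ → (D − E) Syzᴹ.≈ᴹ (D′ − E)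
  −-congˡ (i , e , p) (.i , e′ , p′) E refl with quotient-irrelevant {i} p p′
  ... | refl = λ l → S.refl

  −-congʳ : ∀ {a} (D E E′ : Divisor a) → proj₁ E ≡ proj₁ E′ → (D − E) Syzᴹ.≈ᴹ (D − E′)
  −-congʳ D (i , e , p) (.i , e′ , p′) refl with quotient-irrelevant {i} p p′
  ... | refl = λ l → S.refl

  _·_ : ∀ {a} g → Divisor a → Divisor (g ⊞ a)
  g · (i , e , e+i) = i , g ⊞ e , trans (⊞-assoc g e (generatorExponent i)) (cong (g ⊞_) e+i)

  monomial*unit : ∀ g e i l → monomial g *ᵖ unit e i l S.≈ unit (g ⊞ e) i l
  monomial*unit g e i l = S.trans (S.sym (S.*-assoc (monomial g) (monomial e) (basisVector i l)))
    (S.*-congʳ (monomial-+ g e))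

  ·-− : ∀ {a} g (D E : Divisor a) → (g · D − g · E) Syzᴹ.≈ᴹ (monomial g Syzᴹ.*ₗ (D − E))
  ·-− g (i , e , _) (j , f , _) l = S.sym (S.trans
    (S.distribˡ (monomial g) (unit e i l) (S.- unit f j l))
    (S.+-cong (monomial*unit g e i l) (S.trans (S.sym (-‿distribʳ-* (monomial g) (unit f j l)))
      (S.-‿cong (monomial*unit g f j l)))))
    where open RingProperties S.ring using (-‿distribʳ-*)

  value : ∀ {a} → T²-Hom → Divisor a → Divisor a → Exponent → K.Carrier
  value φ D E h = coefficient (⟦ φ ⟧ (D − E)) h

  module _ (φ : T²-Hom) {h} (h-face : FaceExponent h) where

    value-≈ : ∀ {x y} → x Syzᴹ.≈ᴹ y → coefficient (⟦ φ ⟧ x) h K.≈ coefficient (⟦ φ ⟧ y) h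
    value-≈ {x} {y} x≈y = faceCoefficient (≈⇒≈ᶠ (Syz-≈⇒ φ {x} {y} x≈y)) h-face

    value-cocycle : ∀ {a} (D E F : Divisor a) → value φ D E h K.+ value φ E F h K.≈ value φ D F h
    value-cocycle D E F = K.trans (K.sym (extend-+ (δ h) (⟦ φ ⟧ (D − E)) (⟦ φ ⟧ (E − F))))
      (K.trans (K.sym (faceCoefficient (≈⇒≈ᶠ (Hom.+ᴹ-homo φ (D − E) (E − F))) h-face))
      (value-≈ {(D − E) Syzᴹ.+ᴹ (E − F)} {D − F} (−-cocycle D E F)))

    value-self : ∀ {a} (D : Divisor a) → value φ D D h K.≈ K.0#
    value-self D = identityˡ-unique _ _ (value-cocycle D D D)
      where open AbelianGroupProperties K.+-abelianGroup using (identityˡ-unique)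

    value-congˡ : ∀ {a} (D D′ E : Divisor a) → proj₁ D ≡ proj₁ D′ → value φ D E h K.≈ value φ D′ E h
    value-congˡ D D′ E i≡i′ = value-≈ {D − E} {D′ − E} (−-congˡ D D′ E i≡i′)

    value-congʳ : ∀ {a} (D E E′ : Divisor a) → proj₁ E ≡ proj₁ E′ → value φ D E h K.≈ value φ D E′ h
    value-congʳ D E E′ i≡i′ = value-≈ {D − E} {D − E′} (−-congʳ D E E′ i≡i′)

    value-· : ∀ {a} g (D E : Divisor a) → value φ (g · D) (g · E) h K.≈ translate g (⟦ φ ⟧ (D − E)) h
    value-· g D E = K.trans (value-≈ {g · D − g · E} {monomial g Syzᴹ.*ₗ (D − E)} (·-− g D E))
      (K.trans (faceCoefficient (≈⇒≈ᶠ (Hom.*ₗ-homo φ (monomial g) (D − E))) h-face)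
        (coefficient-monomial* g (⟦ φ ⟧ (D − E)) h))

    value-multiple : ∀ {a a′} g → g ⊞ a ≡ a′ → (D E : Divisor a) (D′ E′ : Divisor a′) →
      proj₁ D ≡ proj₁ D′ → proj₁ E ≡ proj₁ E′ → value φ D′ E′ h K.≈ translate g (⟦ φ ⟧ (D − E)) h
    value-multiple g refl D E D′ E′ i≡i′ j≡j′ = K.trans
      (value-congˡ D′ (g · D) E′ (sym i≡i′)) (K.trans
      (value-congʳ (g · D) E′ (g · E) (sym j≡j′)) (value-· g D E))

  -- The syzygy xᵍ (D − E) is, up to sign, a Koszul relation.
  value-koszul : ∀ (φ : T²-Hom) {a} (D E : Divisor a) g →
    g ⊞ proj₁ (proj₂ D) ≡ generatorExponent (proj₁ E) →
    g ⊞ proj₁ (proj₂ E) ≡ generatorExponent (proj₁ D) →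
    ∀ {h} → FaceExponent (h ⊞ g) → value φ D E h K.≈ K.0#
  value-koszul φ D@(i , e , _) E@(j , f , _) g g+e g+f {h} face =
    K.trans (K.sym (translate-hit g (⟦ φ ⟧ (D − E)) h))
    (K.trans (K.sym (value-· φ face g D E))
    (K.trans (value-≈ φ face {g · D − g · E} {koszulSyzygy (basisVector j , basisVector i)} compare)
    (faceCoefficient (≈⇒≈ᶠ (R.trans (Hom.⟦⟧-cong φ koszul≈0) (Hom.0ᴹ-homo φ))) face)))
    where
    compare : (g · D − g · E) Syzᴹ.≈ᴹ koszulSyzygy (basisVector j , basisVector i)
    compare l = S.+-cong
      (S.*-congʳ (S.trans (S.reflexive (cong monomial g+e)) (S.sym (d-basisVector j))))
      (S.-‿cong (S.*-congʳ (S.trans (S.reflexive (cong monomial g+f)) (S.sym (d-basisVector i)))))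
    koszul≈0 : Congruent Kosz (koszulSyzygy (basisVector j , basisVector i)) Syzᴹ.0ᴹ
    koszul≈0 = congruent (resp
      (λ l → S.sym (S.+-identityʳ (proj₁ (koszulSyzygy (basisVector j , basisVector i)) l)))
      (gen (basisVector j , basisVector i)))

  HomogeneousHom : Subset n → T²-Hom → Set (c ⊔ ℓ)
  HomogeneousHom b = Contains (Gᵠ.component (Gᵠ.homGrading Syz/Kosz-grading S/I-grading) (neg b))

  −-homogeneous : ∀ {a} (D E : Divisor a) → Contains (Gᵠ.component Syz/Kosz-grading (degree a)) (D − E)
  −-homogeneous D@(i , e , refl) E@(j , f , f+j) = D − E , homogeneous ,
    ≈⇒congruent Kosz {D − E} {D − E} (λ l → S.refl)
    where
    homogeneous : ∀ l u → degree u ≢ Vec.zipWith ℤ._-_ (degree (e ⊞ generatorExponent i)) (degree (generatorExponent l)) →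
                  coefficient (proj₁ (D − E) l) u K.≈ K.0#
    homogeneous l u u≢ = K.trans (coefficient-− D E l u) (K.trans (K.+-cong (vanish D) (K.-‿cong (vanish E)))
      (K.-‿inverseʳ K.0#))
      where
      vanish : (D : Divisor (e ⊞ generatorExponent i)) → only (proj₁ D) l (δ u (proj₁ (proj₂ D))) K.≈ K.0#
      vanish (i′ , e′ , eq) with l Finₚ.≟ i′
      ... | no _ = K.refl
      ... | yes refl = δ-miss {u} {e′} (λ { refl → u≢ (trans
        (sym (degree-∸ u (generatorExponent l)))
        (cong (λ a → Vec.zipWith ℤ._-_ (degree a) (degree (generatorExponent l))) eq)) })

  value-homogeneous : ∀ {b φ} → HomogeneousHom b φ → ∀ {a} (D E : Divisor a) {h} → FaceExponent h →
                      h ⊞ sq b ≢ a → value φ D E h K.≈ K.0#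
  value-homogeneous {b} {φ} φ∈ {a} D E {h} h-face h+b≢a =
    let y , y∈ , y≈ = φ∈ (degree a) (D − E) (−-homogeneous D E) in
    K.trans (K.sym (faceCoefficient (≈⇒≈ᶠ y≈) h-face)) (y∈ h (λ eq → h+b≢a (degree-neg h a b eq)))

  value-restriction : ∀ ψ {a} (D E : Divisor a) {h} → FaceExponent h →
    value (restriction ψ) D E h K.≈
      translate (proj₁ (proj₂ D)) (⟦ ψ ⟧ (basisVector (proj₁ D))) h K.-
      translate (proj₁ (proj₂ E)) (⟦ ψ ⟧ (basisVector (proj₁ E))) h
  value-restriction ψ D@(i , e , _) E@(j , f , _) {h} h-face = K.trans
    (faceCoefficient (≈⇒≈ᶠ (R.trans (Hom.+ᴹ-homo ψ (unit e i) (Sᵐ.-ᴹ unit f j))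
      (R.+-cong (Hom.*ₗ-homo ψ (monomial e) (basisVector i))
        (R.trans (Hom.-ᴹ-homo ψ (unit f j)) (R.-‿cong (Hom.*ₗ-homo ψ (monomial f) (basisVector j))))))) h-face)
    (K.trans (coefficient-sub (monomial e *ᵖ ⟦ ψ ⟧ (basisVector i)) (monomial f *ᵖ ⟦ ψ ⟧ (basisVector j)) h)
      (K.+-cong (coefficient-monomial* e (⟦ ψ ⟧ (basisVector i)) h)
        (K.-‿cong (coefficient-monomial* f (⟦ ψ ⟧ (basisVector j)) h))))

-- Linear syzygies of uniform matroids

lookup-injective : ∀ {a} {A : Set a} {xs : List A} → Unique xs → ∀ i j → lookup xs i ≡ lookup xs j → i ≡ j
lookup-injective (x∉ ∷ u) zero    zero    eq = refl
lookup-injective (x∉ ∷ u) (suc i) (suc j) eq = cong suc (lookup-injective u i j eq)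
lookup-injective {xs = _ ∷ xs} (x∉ ∷ u) zero (suc j) eq = contradiction eq (All.lookup x∉ (∈-lookup {xs = xs} j))
lookup-injective {xs = _ ∷ xs} (x∉ ∷ u) (suc i) zero eq = contradiction (sym eq) (All.lookup x∉ (∈-lookup {xs = xs} i))

allSubsets-unique : ∀ n → Unique (allSubsets n)
allSubsets-unique zero    = All.[] ∷ []
allSubsets-unique (suc n) = Uniqueₚ.++⁺
  (Uniqueₚ.map⁺ Vecₚ.∷-injectiveʳ (allSubsets-unique n))
  (Uniqueₚ.map⁺ Vecₚ.∷-injectiveʳ (allSubsets-unique n)) out∷≢in∷

sq-modular : ∀ {k} (F G : Subset k) → sq (F ∩ G) ⊞ sq (F ∪ G) ≡ sq F ⊞ sq G
sq-modular []            []            = refl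
sq-modular (outside ∷ F) (outside ∷ G) = cong (0 ∷_) (sq-modular F G)
sq-modular (outside ∷ F) (inside  ∷ G) = cong (1 ∷_) (sq-modular F G)
sq-modular (inside  ∷ F) (outside ∷ G) = cong (1 ∷_) (sq-modular F G)
sq-modular (inside  ∷ F) (inside  ∷ G) = cong (2 ∷_) (sq-modular F G)


module UniformComplex {c ℓ : Level} (𝕂 : Field c ℓ) {n r : ℕ}
  (Δ : SimplicialComplex n) (Δ≐ : Δ ≐ᶜ uniform n r) where
  open Field 𝕂 using () renaming (commutativeRing to K)
  open StanleyReisner 𝕂 Δ
  open Coefficients K n
  open Presentation 𝕂 Δ
  open Divisors 𝕂 Δ
  private
    module K = CommutativeRing K
    module S = CommutativeRing S
    module Syzᴹ = Module (submodule Syz)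

  face⁻ : ∀ F → Face Δ F → ∣ F ∣ ≤ r
  face⁻ F = proj₁ Δ≐

  face⁺ : ∀ F → ∣ F ∣ ≤ r → Face Δ F
  face⁺ F = proj₂ Δ≐

  abstract
    ∣𝔣∣ : ∀ i → ∣ 𝔣 i ∣ ≡ suc r
    ∣𝔣∣ i = ℕₚ.≤-antisym (bound (𝔣 i) (λ G G⊂ → face⁻ G (proj₂ (𝔣-minimal i) G G⊂)) {∣ 𝔣 i ∣} refl)
      (ℕₚ.≰⇒> (λ ∣F∣≤r → proj₁ (𝔣-minimal i) (face⁺ (𝔣 i) ∣F∣≤r)))
      where
      bound : ∀ (F : Subset n) → (∀ G → G ⊂ F → ∣ G ∣ ≤ r) → ∀ {s} → ∣ F ∣ ≡ s → s ≤ suc r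
      bound F minimal {zero}  _   = z≤n
      bound F minimal {suc s} ∣F∣ with nonempty F (subst (0 <_) (sym ∣F∣) (s≤s z≤n))
      ... | x , x∈F = s≤s (subst (_≤ r) (ℕₚ.suc-injective (trans (suc∣p-x∣ F x∈F) ∣F∣))
        (minimal (F - x) (x∈p⇒p-x⊂p x∈F)))

    index : ∀ F → ∣ F ∣ ≡ suc r → ∃ λ i → 𝔣 i ≡ F
    index F ∣F∣ = Any.index F∈ , sym (Anyₚ.lookup-index F∈)
      where
      F∈ : F ∈ˡ minimalNonfaces
      F∈ = ∈-filter⁺ (SimplicialComplex.isMinimalNonface? Δ) (∈-allSubsets F)
        ((λ F∈ → ℕₚ.<⇒≱ (ℕₚ.≤-reflexive (sym ∣F∣)) (face⁻ F F∈)) ,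
         λ G G⊂F → face⁺ G (ℕₚ.≤-pred (ℕₚ.≤-trans (p⊂q⇒∣p∣<∣q∣ G⊂F) (ℕₚ.≤-reflexive ∣F∣))))

    𝔣-injective : ∀ i j → 𝔣 i ≡ 𝔣 j → i ≡ j
    𝔣-injective = lookup-injective
      (Uniqueₚ.filter⁺ (SimplicialComplex.isMinimalNonface? Δ) (allSubsets-unique n))

  𝔣⊆𝔣⇒≡ : ∀ {i j} → 𝔣 i ⊆ 𝔣 j → i ≡ j
  𝔣⊆𝔣⇒≡ {i} {j} i⊆j = 𝔣-injective i j
    (⊆∧∣≥∣⇒≡ i⊆j (ℕₚ.≤-reflexive (trans (∣𝔣∣ j) (sym (∣𝔣∣ i)))))

  divisor : ∀ i U → 𝔣 i ⊆ U → Divisor (sq U)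
  divisor i U i⊆U = i , sq-∣ᵉ-sq i⊆U

  support⊆ : ∀ {U} (D : Divisor (sq U)) → support D ⊆ U
  support⊆ {U} (i , i∣U) x∈ = subst (_ ∈_) (supp-sq U) (sq-∣ᵉ⇒⊆ i∣U x∈)

  -- The generators dividing x^a are the (r+1)-subsets of its support. Along a chain of exchanges
  -- between two of them, their binomial telescopes into monomial multiples of binomials in degrees
  -- U with r + 2 elements.
  linear-syzygies-determine : ∀ (φ φ′ : T²-Hom) →
    (∀ U → ∣ U ∣ ≡ 2 + r → (D E : Divisor (sq U)) → Contains (equalizer φ φ′) (D − E)) → φ ≈ʰ φ′
  linear-syzygies-determine φ φ′ linear = binomials-determine φ φ′
    λ { (mkBinomial {e} {f} {i} {j} eq) → along i j e f eq }
    where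
    module A = Submodule (equalizer φ φ′)

    adjacent : ∀ {a} (D E : Divisor a) → ∣ support D ∪ support E ∣ ≡ 2 + r → A.Contains (D − E)
    adjacent {a} D E ∣U∣ = multiple (⊆⇒sq-∣ᵉ U a
      (λ x∈ → [ sq-∣ᵉ⇒⊆ (proj₂ D) , sq-∣ᵉ⇒⊆ (proj₂ E) ]′ (x∈p∪q⁻ (support D) (support E) x∈))) D E refl refl
      where
      U = support D ∪ support E
      D₀ = divisor (proj₁ D) U (p⊆p∪q (support E))
      E₀ = divisor (proj₁ E) U (q⊆p∪q (support D) (support E))
      multiple : ∀ {a} → sq U ∣ᵉ a → (D′ E′ : Divisor a) → proj₁ D ≡ proj₁ D′ → proj₁ E ≡ proj₁ E′ →
                 A.Contains (D′ − E′)
      multiple (g , refl) D E i≡ j≡ =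
        A.resp {g · D₀ − g · E₀} {D − E} (λ l → S.trans (−-congˡ (g · D₀) D (g · E₀) i≡ l) (−-congʳ D (g · E₀) E j≡ l))
        (A.resp {monomial g Syzᴹ.*ₗ (D₀ − E₀)} {g · D₀ − g · E₀} (λ l → S.sym (·-− g D₀ E₀ l))
        (A.*-closed (monomial g) {D₀ − E₀} (linear U ∣U∣ D₀ E₀)))

    walk : ∀ {a A F G} → A ≡ supp a → Chain A F G → (D E : Divisor a) →
           support D ≡ F → support E ≡ G → A.Contains (D − E)
    -- Equal supports give equal generators; the binomial is then zero, and so are its values under
    -- both homomorphisms.
    walk _ done D E D≡F E≡F = ≈ᶠ⇒≈ (facewise λ {h} h-face →
      K.trans (trivial φ h-face) (K.sym (trivial φ′ h-face)))
      where
      trivial : ∀ φ {h} → FaceExponent h → value φ D E h K.≈ K.0#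
      trivial φ h-face = K.trans
        (value-congˡ φ h-face D E E (𝔣-injective (proj₁ D) (proj₁ E) (trans D≡F (sym E≡F))))
        (value-self φ h-face E)
    walk {a} refl (step {F′ = F′} F′⊆A ∣F′∣ ∣F∪F′∣ path) D E refl E≡G =
      A.resp {(D − D′) Syzᴹ.+ᴹ (D′ − E)} {D − E} (−-cocycle D D′ E)
        (A.+-closed {D − D′} {D′ − E}
          (adjacent D D′ (trans (cong (λ F → ∣ support D ∪ F ∣) 𝔣i′≡F′)
            (trans ∣F∪F′∣ (cong suc (∣𝔣∣ (proj₁ D))))))
          (walk refl path D′ E 𝔣i′≡F′ E≡G))
      where
      i′ = proj₁ (index F′ (trans ∣F′∣ (∣𝔣∣ (proj₁ D))))
      𝔣i′≡F′ = proj₂ (index F′ (trans ∣F′∣ (∣𝔣∣ (proj₁ D))))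
      D′ : Divisor a
      D′ = i′ , ⊆⇒sq-∣ᵉ (𝔣 i′) a (subst (_⊆ supp a) (sym 𝔣i′≡F′) F′⊆A)

    along : ∀ i j e f (eq : e ⊞ generatorExponent i ≡ f ⊞ generatorExponent j) →
            A.Contains (binomial e i f j eq)
    along i j e f eq = A.resp {D − E} {binomial e i f j eq} (λ l → S.refl)
      (walk refl (chain (supp a) (𝔣 i) (𝔣 j) (sq-∣ᵉ⇒⊆ (proj₂ D)) (sq-∣ᵉ⇒⊆ (proj₂ E))
        (trans (∣𝔣∣ i) (sym (∣𝔣∣ j)))) D E refl refl)
      where
      a = e ⊞ generatorExponent i
      D E : Divisor a
      D = i , e , refl
      E = j , f , sym eq

  degree-face : ∀ {b U h} → h ⊞ sq b ≡ sq U → ∣ U ∣ ≤ ∣ b ∣ + r → FaceExponent h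
  degree-face {b} {U} {h} h+b ∣U∣≤ = face⁺ (supp h) (ℕₚ.+-cancelʳ-≤ ∣ b ∣ ∣ supp h ∣ r
    (subst₂ _≤_ (sym (∣supp∣+∣b∣ h b U h+b)) (ℕₚ.+-comm ∣ b ∣ r) ∣U∣≤))

  face⇒2≤∣b∣ : ∀ {b U h} → ∣ U ∣ ≡ 2 + r → h ⊞ sq b ≡ sq U → FaceExponent h → 2 ≤ ∣ b ∣
  face⇒2≤∣b∣ {b} {U} {h} ∣U∣ h+b h-face = ℕₚ.+-cancelˡ-≤ r 2 ∣ b ∣ (subst (_≤ r + ∣ b ∣)
    (trans (∣supp∣+∣b∣ h b U h+b) (trans ∣U∣ (ℕₚ.+-comm 2 r))) (ℕₚ.+-monoˡ-≤ ∣ b ∣ (face⁻ (supp h) h-face)))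

  -- U has a single element outside F. Since b ⊆ U and b is not contained in F, this element lies in
  -- b, where h is zero.
  missing⇒supp⊆ : ∀ {b U F : Subset n} {h} → ∣ U ∣ ≡ 2 + r → h ⊞ sq b ≡ sq U → F ⊆ U → ∣ F ∣ ≡ suc r → ¬ b ⊆ F → supp h ⊆ F
  missing⇒supp⊆ {b} {U} {F} {h} ∣U∣ h+b F⊆U ∣F∣ b⊈F with ⊈⇒∃∉ b F b⊈F
  ... | x , x∈b , x∉F = λ y∈ → ⊆∧∣≥∣⇒⊇ (p⊆p∪q (supp h)) ∣∪∣≤ (q⊆p∪q F (supp h) y∈)
    where
    supp⊆U : supp h ⊆ U
    supp⊆U y∈ = subst (_ ∈_) (supp-sq U) (supp-∣ᵉ {a = sq U} (sq b , trans (⊞-comm (sq b) h) h+b) y∈)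
    x∈U : x ∈ U
    x∈U = subst (_ ∈_) (supp-sq U) (sq-∣ᵉ⇒⊆ {F = b} (h , h+b) x∈b)
    ∪⊂U : F ∪ supp h ⊂ U
    ∪⊂U = (λ y∈ → [ (λ y∈F → F⊆U y∈F) , (λ y∈h → supp⊆U y∈h) ]′ (x∈p∪q⁻ F (supp h) y∈)) ,
      x , x∈U , λ x∈ → [ x∉F , x∈b⇒x∉supp h h+b x∈b ]′ (x∈p∪q⁻ F (supp h) x∈)
    ∣∪∣≤ : ∣ F ∪ supp h ∣ ≤ ∣ F ∣
    ∣∪∣≤ = subst (∣ F ∪ supp h ∣ ≤_) (sym ∣F∣)
      (ℕₚ.≤-pred (ℕₚ.≤-trans (p⊂q⇒∣p∣<∣q∣ ∪⊂U) (ℕₚ.≤-reflexive ∣U∣)))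

  -- xᵍ times the syzygy is Koszul for g = F ∩ G, and h + g is still supported on F ∩ G.
  value-missing : ∀ (φ : T²-Hom) {b U} → ∣ U ∣ ≡ 2 + r → (D E : Divisor (sq U)) →
    ¬ b ⊆ support D → ¬ b ⊆ support E → ∀ {h} → h ⊞ sq b ≡ sq U → FaceExponent h → value φ D E h K.≈ K.0#
  value-missing φ {b} {U} ∣U∣ D@(i , e , e+i) E@(j , f , f+j) b⊈F b⊈G {h} h+b h-face = cases (i Finₚ.≟ j)
    where
    cases : Dec (i ≡ j) → value φ D E h K.≈ K.0#
    cases (yes i≡j) = K.trans (value-congˡ φ h-face D E E i≡j) (value-self φ h-face E)
    cases (no  i≢j) = value-koszul φ D E (sq (F ∩ G))
      (⊞-cancelʳ _ _ (sq F) (trans (⊞-assoc _ e (sq F)) (trans (cong (sq (F ∩ G) ⊞_) e+i)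
        (trans g+U (⊞-comm (sq F) (sq G))))))
      (⊞-cancelʳ _ _ (sq G) (trans (⊞-assoc _ f (sq G)) (trans (cong (sq (F ∩ G) ⊞_) f+j) g+U)))
      (face⁺ _ (subst (λ s → ∣ s ∣ ≤ r) (sym (trans (supp-⊞ h (sq (F ∩ G))) (cong (supp h ∪_) (supp-sq (F ∩ G)))))
        (ℕₚ.≤-trans (p⊆q⇒∣p∣≤∣q∣ within) (ℕₚ.≤-reflexive ∣F∩G∣))))
      where
      F = 𝔣 i
      G = 𝔣 j
      F⊆U = support⊆ D
      G⊆U = support⊆ E
      F∪G⊆U : F ∪ G ⊆ U
      F∪G⊆U x∈ = [ (λ x∈F → F⊆U x∈F) , (λ x∈G → G⊆U x∈G) ]′ (x∈p∪q⁻ F G x∈)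
      -- Two different (r+1)-subsets of a set with r + 2 elements cover it.
      F∪G≡U : F ∪ G ≡ U
      F∪G≡U = ⊆∧∣≥∣⇒≡ F∪G⊆U (ℕₚ.≤-trans (ℕₚ.≤-reflexive ∣U∣) (ℕₚ.≰⇒> λ ∣F∪G∣≤ → i≢j (sym (𝔣⊆𝔣⇒≡ λ x∈G →
        ⊆∧∣≥∣⇒⊇ (p⊆p∪q G) (ℕₚ.≤-trans ∣F∪G∣≤ (ℕₚ.≤-reflexive (sym (∣𝔣∣ i)))) (q⊆p∪q F G x∈G)))))
      g+U : sq (F ∩ G) ⊞ sq U ≡ sq F ⊞ sq G
      g+U = trans (cong (λ V → sq (F ∩ G) ⊞ sq V) (sym F∪G≡U)) (sq-modular F G)
      ∣F∩G∣ : ∣ F ∩ G ∣ ≡ r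
      ∣F∩G∣ = ℕₚ.+-cancelˡ-≡ (2 + r) ∣ F ∩ G ∣ r (trans
        (cong (_+ ∣ F ∩ G ∣) (sym (trans (cong ∣_∣ F∪G≡U) ∣U∣)))
        (trans (∣p∪q∣+∣p∩q∣ F G) (trans (cong₂ _+_ (∣𝔣∣ i) (∣𝔣∣ j)) (ℕₚ.+-suc (suc r) r))))
      within : supp h ∪ (F ∩ G) ⊆ F ∩ G
      within x∈ = [ (λ x∈h → x∈p∩q⁺ (missing⇒supp⊆ {h = h} ∣U∣ h+b F⊆U (∣𝔣∣ i) b⊈F x∈h ,
                                      missing⇒supp⊆ {h = h} ∣U∣ h+b G⊆U (∣𝔣∣ j) b⊈G x∈h))
                  , (λ x∈g → x∈g) ]′ (x∈p∪q⁻ (supp h) (F ∩ G) x∈)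

-- Homogeneous homomorphisms

x∉p-x : ∀ {k} (p : Subset k) {x} → x ∈ p → x ∉ p - x
x∉p-x p {x} x∈p x∈p-x = ℕₚ.<⇒≱ (x∈p⇒∣p-x∣<∣p∣ x∈p)
  (p⊆q⇒∣p∣≤∣q∣ λ {y} y∈p → stays y y∈p)
  where
  stays : ∀ y → y ∈ p → y ∈ p - x
  stays y y∈p with y Finₚ.≟ x
  ... | yes refl = x∈p-x
  ... | no  y≢x    = x∈p∧x≢y⇒x∈p-y y∈p y≢x

p-x⊆p : ∀ {k} (p : Subset k) x → p - x ⊆ p
p-x⊆p p x = p─q⊆p p ⁅ x ⁆

-x-mono : ∀ {k} {p q : Subset k} x → x ∈ p → p ⊆ q → p - x ⊆ q - x
-x-mono {p = p} x x∈p p⊆q {y} y∈ with y Finₚ.≟ x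
... | yes refl = contradiction y∈ (x∉p-x p x∈p)
... | no  y≢x    = x∈p∧x≢y⇒x∈p-y (p⊆q (p-x⊆p p x y∈)) y≢x

module HomogeneousHoms {c ℓ : Level} (𝕂 : Field c ℓ) {n r : ℕ}
  (Δ : SimplicialComplex n) (Δ≐ : Δ ≐ᶜ uniform n r) (b : Subset n) where
  open Field 𝕂 using () renaming (commutativeRing to K)
  open StanleyReisner 𝕂 Δ
  open Coefficients K n
  open Presentation 𝕂 Δ
  open Divisors 𝕂 Δ
  open UniformComplex 𝕂 Δ Δ≐
  private
    module K = CommutativeRing K
    module S = CommutativeRing S
  open SemiringSum S.semiring using (sum-cong-≋; ∑-distrib-+; *-distribˡ-sum) renaming (sum to ∑ᵖ)
  open AbelianGroupProperties K.+-abelianGroup using (∙-cancelʳ) renaming (ε⁻¹≈ε to -0≈0)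

  -- The only consequence of being homogeneous of degree −b that is needed.
  Homogeneous : T²-Hom → Set ℓ
  Homogeneous φ = ∀ {a} (D E : Divisor a) {h} → FaceExponent h → h ⊞ sq b ≢ a → value φ D E h K.≈ K.0#

  -- At every other exponent both values vanish by homogeneity, so for each U only h = U - b has to
  -- be compared.
  degreewise-determined : ∀ {φ φ′} → Homogeneous φ → Homogeneous φ′ →
    (∀ {U} → ∣ U ∣ ≡ 2 + r → (D E : Divisor (sq U)) → ∀ {h} → h ⊞ sq b ≡ sq U → FaceExponent h →
      value φ D E h K.≈ value φ′ D E h) →
    φ ≈ʰ φ′
  degreewise-determined {φ} {φ′} φ-hom φ′-hom agrees = linear-syzygies-determine φ φ′ λ U ∣U∣ D E →
    ≈ᶠ⇒≈ (facewise λ {h} h-face → compare U ∣U∣ D E h-face ((h ⊞ sq b) ≟ᵉ sq U))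
    where
    compare : ∀ U → ∣ U ∣ ≡ 2 + r → (D E : Divisor (sq U)) → ∀ {h} → FaceExponent h →
              Dec (h ⊞ sq b ≡ sq U) → value φ D E h K.≈ value φ′ D E h
    compare U ∣U∣ D E h-face (yes h+b) = agrees ∣U∣ D E h+b h-face
    compare U ∣U∣ D E h-face (no h+b≢) = K.trans (φ-hom D E h-face h+b≢) (K.sym (φ′-hom D E h-face h+b≢))

  small-degree : ∣ b ∣ < 2 → ∀ {φ φ′} → Homogeneous φ → Homogeneous φ′ → φ ≈ʰ φ′
  small-degree ∣b∣<2 φ-hom φ′-hom = degreewise-determined φ-hom φ′-hom λ ∣U∣ D E h+b h-face →
    contradiction (face⇒2≤∣b∣ ∣U∣ h+b h-face) (ℕₚ.<⇒≱ ∣b∣<2)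

  few-vertices : n ≤ r + 1 → ∀ {φ φ′ : T²-Hom} → φ ≈ʰ φ′
  few-vertices n≤r+1 {φ} {φ′} = linear-syzygies-determine φ φ′ λ U ∣U∣ → contradiction
    (ℕₚ.≤-trans (ℕₚ.≤-reflexive (sym ∣U∣)) (ℕₚ.≤-trans (∣p∣≤n U) n≤r+1))
    (ℕₚ.<⇒≱ (ℕₚ.≤-reflexive (cong suc (ℕₚ.+-comm r 1))))

  free : (Fin m → Polynomial) → Hom Sᵐ (quotient I)
  free q = makeHom (λ x → ∑ᵖ (λ i → x i *ᵖ q i))
    (λ x≈y → ≈⇒congruent I (sum-cong-≋ (λ i → S.*-congʳ {q i} (x≈y i))))
    (λ x y → ≈⇒congruent I (S.trans (sum-cong-≋ (λ i → S.distribʳ (q i) (x i) (y i)))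
      (∑-distrib-+ (λ i → x i *ᵖ q i) (λ i → y i *ᵖ q i))))
    (λ a x → ≈⇒congruent I (S.trans (sum-cong-≋ (λ i → S.*-assoc a (x i) (q i)))
      (S.sym (*-distribˡ-sum a (λ i → x i *ᵖ q i)))))

  free-basisVector : ∀ q i h → coefficient (⟦ free q ⟧ (basisVector i)) h K.≈ coefficient (q i) h
  free-basisVector q i h = coefficients (sum-basisVector i q) h

  value-free : ∀ q {a} (D E : Divisor a) {h} → FaceExponent h → value (restriction (free q)) D E h K.≈
    translate (proj₁ (proj₂ D)) (q (proj₁ D)) h K.- translate (proj₁ (proj₂ E)) (q (proj₁ E)) h
  value-free q D E {h} h-face = K.trans (value-restriction (free q) D E h-face)
    (K.+-cong (at D) (K.-‿cong (at E)))
    where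
    at : ∀ {a} (D : Divisor a) → translate (proj₁ (proj₂ D)) (∑ᵖ (λ i → basisVector (proj₁ D) i *ᵖ q i)) h
         K.≈ translate (proj₁ (proj₂ D)) (q (proj₁ D)) h
    at (i , e , _) = extend-shift (sum-basisVector i q) h e

  module _ (2≤∣b∣ : 2 ≤ ∣ b ∣) where

    -- One element of b serves all U at once: U - x₀ is a generator not containing b, and for U, U′
    -- ⊆ V both U - x₀ and U′ - x₀ lie in V - x₀. The independence of θ from U rests on this
    -- compatibility.
    x₀ : Fin n
    x₀ = proj₁ (nonempty b (ℕₚ.≤-trans (s≤s z≤n) 2≤∣b∣))

    x₀∈b : x₀ ∈ b
    x₀∈b = proj₂ (nonempty b (ℕₚ.≤-trans (s≤s z≤n) 2≤∣b∣))

    abstract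
      omit : ∀ U → ∣ U ∣ ≡ 2 + r → b ⊆ U → ∃ λ j → 𝔣 j ≡ U - x₀
      omit U ∣U∣ b⊆U = index (U - x₀) (ℕₚ.suc-injective (trans (suc∣p-x∣ U (b⊆U x₀∈b)) ∣U∣))

    omitted : ∀ U → ∣ U ∣ ≡ 2 + r → b ⊆ U → Divisor (sq U)
    omitted U ∣U∣ b⊆U = divisor (proj₁ (omit U ∣U∣ b⊆U)) U
      (subst (_⊆ U) (sym (proj₂ (omit U ∣U∣ b⊆U))) (p-x⊆p U x₀))

    omitted-missing : ∀ U (∣U∣ : ∣ U ∣ ≡ 2 + r) (b⊆U : b ⊆ U) → ¬ b ⊆ support (omitted U ∣U∣ b⊆U)
    omitted-missing U ∣U∣ b⊆U b⊆ =
      x∉p-x U (b⊆U x₀∈b) (subst (x₀ ∈_) (proj₂ (omit U ∣U∣ b⊆U)) (b⊆ x₀∈b))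

    ∣ᵉ⇒⊆ : ∀ {F} → sq b ∣ᵉ sq F → b ⊆ F
    ∣ᵉ⇒⊆ {F} b∣F x∈b = subst (_ ∈_) (supp-sq F) (sq-∣ᵉ⇒⊆ {F = b} b∣F x∈b)

    degree⇒b⊆U : ∀ {h U} → h ⊞ sq b ≡ sq U → b ⊆ U
    degree⇒b⊆U {h} h+b = ∣ᵉ⇒⊆ (h , h+b)

    -- By the cocycle rule it is enough to compare every D with the generator U - x₀. If D does not
    -- contain b either, both values vanish by `value-missing`; the other case is the hypothesis.
    determined : ∀ {φ φ′} → Homogeneous φ → Homogeneous φ′ →
      (∀ {U} → ∣ U ∣ ≡ 2 + r → (D E : Divisor (sq U)) → b ⊆ support D → ¬ b ⊆ support E →
        ∀ {h} → h ⊞ sq b ≡ sq U → FaceExponent h → value φ D E h K.≈ value φ′ D E h) →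
      φ ≈ʰ φ′
    determined {φ} {φ′} φ-hom φ′-hom agrees = degreewise-determined φ-hom φ′-hom λ {U} ∣U∣ D E {h} h+b h-face →
      let E₀ = omitted U ∣U∣ (degree⇒b⊆U h+b)
          at = λ D → toOmitted ∣U∣ D h+b h-face (b ⊆? support D)
      in ∙-cancelʳ (value φ E E₀ h) (value φ D E h) (value φ′ D E h)
        (K.trans (value-cocycle φ h-face D E E₀) (K.trans (at D)
        (K.trans (K.sym (value-cocycle φ′ h-face D E E₀)) (K.+-congˡ (K.sym (at E))))))
      where
      toOmitted : ∀ {U} (∣U∣ : ∣ U ∣ ≡ 2 + r) (D : Divisor (sq U)) {h} (h+b : h ⊞ sq b ≡ sq U) → FaceExponent h →
        Dec (b ⊆ support D) →
        let E₀ = omitted U ∣U∣ (degree⇒b⊆U h+b) in value φ D E₀ h K.≈ value φ′ D E₀ h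
      toOmitted {U} ∣U∣ D h+b h-face (yes b⊆D) =
        agrees ∣U∣ D _ b⊆D (omitted-missing U ∣U∣ (degree⇒b⊆U h+b)) h+b h-face
      toOmitted {U} ∣U∣ D h+b h-face (no b⊈D) = K.trans
        (value-missing φ ∣U∣ D _ b⊈D (omitted-missing U ∣U∣ (degree⇒b⊆U h+b)) h+b h-face)
        (K.sym (value-missing φ′ ∣U∣ D _ b⊈D (omitted-missing U ∣U∣ (degree⇒b⊆U h+b)) h+b h-face))

    record Flag (i : Fin m) (U : Subset n) : Set where
      constructor flag
      field
        ∣U∣ : ∣ U ∣ ≡ 2 + r
        b⊆F : b ⊆ 𝔣 i
        F⊆U : 𝔣 i ⊆ U
      b⊆U : b ⊆ U
      b⊆U x∈ = F⊆U (b⊆F x∈)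
      exponent : Exponent
      exponent = proj₁ (sq-∣ᵉ-sq b⊆U)
      exponent-face : FaceExponent exponent
      exponent-face = degree-face {U = U} (proj₂ (sq-∣ᵉ-sq b⊆U))
        (ℕₚ.≤-trans (ℕₚ.≤-reflexive ∣U∣) (ℕₚ.+-monoˡ-≤ r 2≤∣b∣))

    θ : T²-Hom → ∀ {i U} → Flag i U → K.Carrier
    θ φ {i} {U} fl = value φ (divisor i U F⊆U) (omitted U ∣U∣ b⊆U) exponent
      where open Flag fl

    -- Replacing E by U - x₀ changes the value by that of a binomial whose two generators both fail
    -- to contain b, which is zero.
    value≈θ : ∀ φ {U} (D E : Divisor (sq U)) → ¬ b ⊆ support E → ∀ {h} → h ⊞ sq b ≡ sq U → FaceExponent h →
              (fl : Flag (proj₁ D) U) → value φ D E h K.≈ θ φ fl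
    value≈θ φ {U} D E b⊈E {h} h+b h-face fl = K.trans (K.sym (value-cocycle φ h-face D E₀ E))
      (K.trans (K.+-cong (value-congˡ φ h-face D D₀ E₀ refl)
        (value-missing φ ∣U∣ E₀ E (omitted-missing U ∣U∣ b⊆U) b⊈E h+b h-face))
      (K.trans (K.+-identityʳ _) (K.reflexive (cong (value φ D₀ E₀) h≡))))
      where
      open Flag fl
      D₀ = divisor (proj₁ D) U F⊆U
      E₀ = omitted U ∣U∣ b⊆U
      h≡ : h ≡ exponent
      h≡ = ⊞-cancelʳ h exponent (sq b) (trans h+b (sym (proj₂ (sq-∣ᵉ-sq b⊆U))))

    -- The term from E cannot reach x^(U-b), since its cofactor does not divide it. What is left is
    -- the coefficient of x^(F-b) in ψ(e_F), where U no longer occurs: this is why a restriction has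
    -- θ depending on F only.
    restriction-value : ∀ ψ {U} (D E : Divisor (sq U)) → ¬ b ⊆ support E →
      ∀ {h} → h ⊞ sq b ≡ sq U → FaceExponent h → ∀ h′ → h′ ⊞ sq b ≡ generatorExponent (proj₁ D) →
      value (restriction ψ) D E h K.≈ coefficient (⟦ ψ ⟧ (basisVector (proj₁ D))) h′
    restriction-value ψ {U} D@(i , e , e+i) E@(j , f , f+j) b⊈E {h} h+b h-face h′ h′+b = K.trans
      (value-restriction ψ D E h-face) (K.trans (K.+-cong hit (K.trans (K.-‿cong miss) -0≈0)) (K.+-identityʳ _))
      where
      h≡ : h ≡ h′ ⊞ e
      h≡ = quotient-shift {e = e} {generatorExponent i} {sq U} {h} {sq b} {h′} e+i h+b h′+b
      hit : translate e (⟦ ψ ⟧ (basisVector i)) h K.≈ coefficient (⟦ ψ ⟧ (basisVector i)) h′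
      hit = K.trans (K.reflexive (cong (translate e (⟦ ψ ⟧ (basisVector i))) h≡))
        (translate-hit e (⟦ ψ ⟧ (basisVector i)) h′)
      miss : translate f (⟦ ψ ⟧ (basisVector j)) h K.≈ K.0#
      miss = translate-miss f (⟦ ψ ⟧ (basisVector j)) h λ f∣h →
        b⊈E (∣ᵉ⇒⊆ (quotient-∣ᵉ {f = f} {generatorExponent j} {sq U} {h} {sq b} f+j h+b f∣h))

    module _ (coefficientOf : ∀ i → b ⊆ 𝔣 i → K.Carrier) where

      private
        term : ∀ i → Dec (b ⊆ 𝔣 i) → Polynomial
        term i (yes b⊆F) = (coefficientOf i b⊆F , proj₁ (sq-∣ᵉ-sq b⊆F)) ∷ []
        term i (no  _)   = []

      -- Every homomorphism of degree -b on Sᵐ has this shape, because the part of S/I in degree F -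
      -- b is spanned by x^(F-b) if b ⊆ F and is zero otherwise.
      monomialHom : Hom Sᵐ (quotient I)
      monomialHom = free (λ i → term i (b ⊆? 𝔣 i))

      private
        translate-term-miss : ∀ e i (d : Dec (b ⊆ 𝔣 i)) {a h} → e ⊞ generatorExponent i ≡ a → h ⊞ sq b ≢ a →
                              translate e (term i d) h K.≈ K.0#
        translate-term-miss e i (no _) _ _ = K.refl
        translate-term-miss e i (yes b⊆F) {a} {h} e+i h+b≢ = K.trans (K.+-identityʳ _) (K.trans
          (K.*-congˡ (δ-miss {h} {e ⊞ proj₁ (sq-∣ᵉ-sq b⊆F)} (λ { refl → h+b≢ (trans (⊞-assoc e _ (sq b))
            (trans (cong (e ⊞_) (proj₂ (sq-∣ᵉ-sq b⊆F))) e+i)) })))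
          (K.zeroʳ _))

      monomialHom-homogeneous : Homogeneous (restriction monomialHom)
      monomialHom-homogeneous D@(i , e , e+i) E@(j , f , f+j) h-face h+b≢ = K.trans (value-free _ D E h-face)
        (K.trans (K.+-cong (translate-term-miss e i (b ⊆? 𝔣 i) e+i h+b≢)
          (K.-‿cong (translate-term-miss f j (b ⊆? 𝔣 j) f+j h+b≢))) (K.-‿inverseʳ K.0#))

      -- The inclusion is returned because `coefficientOf` may depend on it: inclusions are
      -- functions, and the one found by `b ⊆? 𝔣 i` need not be the given one.
      monomialHom-value : ∀ {U} (D E : Divisor (sq U)) (b⊆D : b ⊆ support D) → ¬ b ⊆ support E →
        ∀ {h} → h ⊞ sq b ≡ sq U → FaceExponent h →
        Σ (b ⊆ support D) λ b⊆F → value (restriction monomialHom) D E h K.≈ coefficientOf (proj₁ D) b⊆F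
      monomialHom-value {U} D@(i , _) E b⊆D b⊈E {h} h+b h-face =
        evaluate (b ⊆? 𝔣 i) λ h′ h′+b → K.trans (restriction-value monomialHom D E b⊈E h+b h-face h′ h′+b)
          (free-basisVector (λ l → term l (b ⊆? 𝔣 l)) i h′)
        where
        evaluate : ∀ d → (∀ h′ → h′ ⊞ sq b ≡ generatorExponent i →
            value (restriction monomialHom) D E h K.≈ coefficient (term i d) h′) →
          Σ (b ⊆ 𝔣 i) λ b⊆F → value (restriction monomialHom) D E h K.≈ coefficientOf i b⊆F
        evaluate (no b⊈D)  _  = contradiction (λ {x} → b⊆D {x}) b⊈D
        evaluate (yes b⊆F) eq = b⊆F , K.trans (eq _ (proj₂ (sq-∣ᵉ-sq b⊆F)))
          (K.trans (K.+-identityʳ _) (K.trans (K.*-congˡ (δ-hit (proj₁ (sq-∣ᵉ-sq b⊆F)))) (K.*-identityʳ _)))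

    module _ (3≤∣b∣ : 3 ≤ ∣ b ∣) (φ : T²-Hom) where

      -- Multiplication by x^(V-U) carries the binomial that defines θ into degree V and the
      -- exponent U - b to V - b.
      θ-inside : ∀ {i U V} (fl : Flag i U) (U⊆V : U ⊆ V) (E : Divisor (sq V)) →
        support E ≡ U - x₀ → ∀ {h} → h ⊞ sq b ≡ sq V → FaceExponent h →
        value φ (divisor i V (λ x∈ → U⊆V (Flag.F⊆U fl x∈))) E h K.≈ θ φ fl
      θ-inside {i} {U} {V} fl U⊆V E E≡ {h} h+b h-face = K.trans
        (value-multiple φ h-face g g+U (divisor i U F⊆U) E₀ (divisor i V _) E refl
          (𝔣-injective _ _ (trans (proj₂ (omit U ∣U∣ b⊆U)) (sym E≡))))
        (K.trans (K.reflexive (cong (translate g (⟦ φ ⟧ (divisor i U F⊆U − E₀))) h≡))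
          (translate-hit g (⟦ φ ⟧ (divisor i U F⊆U − E₀)) exponent))
        where
        open Flag fl
        E₀ = omitted U ∣U∣ b⊆U
        g = proj₁ (sq-∣ᵉ-sq U⊆V)
        g+U = proj₂ (sq-∣ᵉ-sq U⊆V)
        h≡ : h ≡ exponent ⊞ g
        h≡ = ⊞-cancelʳ h _ (sq b) (trans h+b (trans (sym g+U) (trans (⊞-comm g (sq U))
          (trans (cong (_⊞ g) (sym (proj₂ (sq-∣ᵉ-sq b⊆U)))) (⊞-swapʳ exponent (sq b) g)))))

      -- This binomial is a multiple of one in degree V − x₀, which does not contain b.
      both-omit : ∀ {V} → b ⊆ V → (E E′ : Divisor (sq V)) → support E ⊆ V - x₀ → support E′ ⊆ V - x₀ →
        ∀ {h} → h ⊞ sq b ≡ sq V → FaceExponent h → value φ E E′ h K.≈ K.0#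
      both-omit {V} b⊆V (j , j∣) (j′ , j′∣) j⊆W j′⊆W {h} h+b h-face = K.trans
        (value-multiple φ h-face g g+W (divisor j W j⊆W) (divisor j′ W j′⊆W) (j , j∣) (j′ , j′∣) refl refl)
        (translate-miss g (⟦ φ ⟧ (divisor j W j⊆W − divisor j′ W j′⊆W)) h g∤h)
        where
        W = V - x₀
        g = proj₁ (sq-∣ᵉ-sq (p-x⊆p V x₀))
        g+W : g ⊞ sq W ≡ sq V
        g+W = proj₂ (sq-∣ᵉ-sq (p-x⊆p V x₀))
        g∤h : ¬ g ∣ᵉ h
        g∤h g∣h = x∉p-x V (b⊆V x₀∈b) (∣ᵉ⇒⊆ (quotient-∣ᵉ {f = g} {sq W} {sq V} {h} {sq b} g+W h+b g∣h) x₀∈b)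

      -- In degree V = U ∪ U′ the two scalars are the values of F against U - x₀ and against U′ -
      -- x₀, and these differ by a value that `both-omit` kills. As U ∩ U′ contains F, V has at most
      -- r + 3 elements, so ∣b∣ ≥ 3 makes V - b a face.
      θ-independent : ∀ {i U U′} (fl : Flag i U) (fl′ : Flag i U′) → θ φ fl K.≈ θ φ fl′
      θ-independent {i} {U} {U′} fl fl′ = K.trans (K.sym (θ-inside fl U⊆V E (proj₂ om) h+b h-face))
        (K.trans (K.sym (value-cocycle φ h-face D E′ E))
        (K.trans (K.trans (K.+-congˡ (both-omit b⊆V E′ E W′⊆ W⊆ h+b h-face)) (K.+-identityʳ _))
        (K.trans (value-congˡ φ h-face D (divisor i V _) E′ refl) (θ-inside fl′ U′⊆V E′ (proj₂ om′) h+b h-face))))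
        where
        open Flag fl
        V = U ∪ U′
        U⊆V : U ⊆ V
        U⊆V = p⊆p∪q U′
        U′⊆V : U′ ⊆ V
        U′⊆V = q⊆p∪q U U′
        b⊆V : b ⊆ V
        b⊆V x∈ = U⊆V (b⊆U x∈)
        D = divisor i V (λ x∈ → U⊆V (F⊆U x∈))
        om = omit U ∣U∣ b⊆U
        om′ = omit U′ (Flag.∣U∣ fl′) (Flag.b⊆U fl′)
        W⊆ : 𝔣 (proj₁ om) ⊆ V - x₀
        W⊆ = subst (_⊆ V - x₀) (sym (proj₂ om)) (-x-mono x₀ (b⊆U x₀∈b) U⊆V)
        W′⊆ : 𝔣 (proj₁ om′) ⊆ V - x₀
        W′⊆ = subst (_⊆ V - x₀) (sym (proj₂ om′)) (-x-mono x₀ (Flag.b⊆U fl′ x₀∈b) U′⊆V)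
        E E′ : Divisor (sq V)
        E  = divisor (proj₁ om) V (λ x∈ → p-x⊆p V x₀ (W⊆ x∈))
        E′ = divisor (proj₁ om′) V (λ x∈ → p-x⊆p V x₀ (W′⊆ x∈))
        h+b = proj₂ (sq-∣ᵉ-sq b⊆V)
        F⊆U∩U′ : 𝔣 i ⊆ U ∩ U′
        F⊆U∩U′ x∈ = x∈p∩q⁺ (F⊆U x∈ , Flag.F⊆U fl′ x∈)
        ∣V∣ : ∣ V ∣ ≤ 3 + r
        ∣V∣ = ℕₚ.+-cancelʳ-≤ (suc r) ∣ V ∣ (3 + r) (ℕₚ.≤-trans
          (ℕₚ.+-monoʳ-≤ ∣ V ∣ (ℕₚ.≤-trans (ℕₚ.≤-reflexive (sym (∣𝔣∣ i))) (p⊆q⇒∣p∣≤∣q∣ F⊆U∩U′)))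
          (ℕₚ.≤-reflexive (trans (∣p∪q∣+∣p∩q∣ U U′) (trans (cong₂ _+_ ∣U∣ (Flag.∣U∣ fl′)) (ℕₚ.+-suc (2 + r) (suc r))))))
        h-face : FaceExponent (proj₁ (sq-∣ᵉ-sq b⊆V))
        h-face = degree-face {U = V} h+b (ℕₚ.≤-trans ∣V∣ (ℕₚ.+-monoˡ-≤ r 3≤∣b∣))

    extension : 2 + r ≤ n → ∀ i → b ⊆ 𝔣 i → ∃ (Flag i)
    extension 2+r≤n i b⊆F = let U , F⊆U , _ , ∣U∣ = enlarge (𝔣 i) ⊤ ⊆⊤
                                  (subst₂ _<_ (sym (∣𝔣∣ i)) (sym (∣⊤∣≡n n)) 2+r≤n)
                            in U , flag (trans ∣U∣ (cong suc (∣𝔣∣ i))) b⊆F F⊆U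

    -- The scalar at F is read off at an arbitrary U over F, which exists because r + 2 ≤ n; by
    -- `θ-independent` it is right for every U.
    large-degree : 3 ≤ ∣ b ∣ → 2 + r ≤ n → ∀ φ → Homogeneous φ → ∃ λ ψ → restriction ψ ≈ʰ φ
    large-degree 3≤∣b∣ 2+r≤n φ φ-hom = monomialHom coefficientOf ,
      determined (monomialHom-homogeneous coefficientOf) φ-hom λ {U} ∣U∣ D E b⊆D b⊈E h+b h-face →
        let p  = monomialHom-value coefficientOf D E b⊆D b⊈E h+b h-face
            fl = flag ∣U∣ b⊆D (support⊆ D)
        in K.trans (proj₂ p) (K.trans
          (θ-independent 3≤∣b∣ φ (proj₂ (extension 2+r≤n (proj₁ D) (proj₁ p))) fl)
          (K.sym (value≈θ φ D E b⊈E h+b h-face fl)))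
      where
      coefficientOf : ∀ i → b ⊆ 𝔣 i → K.Carrier
      coefficientOf i b⊆F = θ φ (proj₂ (extension 2+r≤n i b⊆F))

-- Homomorphisms of degree −b with two variables in b

degree-⊞ : ∀ {k} (f g : Vec ℕ k) (a : Vec ℤ k) →
           Vec.map +_ f ≡ Vec.zipWith ℤ._-_ a (Vec.map +_ g) → a ≡ Vec.map +_ (f ⊞ g)
degree-⊞ []      []      []      eq = refl
degree-⊞ (x ∷ f) (y ∷ g) (z ∷ a) eq = cong₂ _∷_
  (sym (trans (cong (λ u → u ℤ.+ (+ y)) (Vecₚ.∷-injectiveˡ eq))
    (trans (ℤₚ.+-assoc z (ℤ.- (+ y)) (+ y))
    (trans (cong (λ u → z ℤ.+ u) (ℤₚ.+-inverseˡ (+ y))) (ℤₚ.+-identityʳ z)))))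
  (degree-⊞ f g a (Vecₚ.∷-injectiveʳ eq))

∣p∪q∣≤∣p∣+∣q∣ : ∀ {k} (p q : Subset k) → ∣ p ∪ q ∣ ≤ ∣ p ∣ + ∣ q ∣
∣p∪q∣≤∣p∣+∣q∣ p q = ℕₚ.≤-trans (ℕₚ.m≤m+n _ _) (ℕₚ.≤-reflexive (∣p∪q∣+∣p∩q∣ p q))

module ConstructedHoms {c ℓ : Level} (𝕂 : Field c ℓ) {n r : ℕ}
  (Δ : SimplicialComplex n) (Δ≐ : Δ ≐ᶜ uniform n r) (b : Subset n) (∣b∣≤2 : ∣ b ∣ ≤ 2) where
  open Field 𝕂 using () renaming (commutativeRing to K)
  open StanleyReisner 𝕂 Δ
  open Coefficients K n
  open Presentation 𝕂 Δ
  open Divisors 𝕂 Δ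
  open UniformComplex 𝕂 Δ Δ≐
  private
    module K = CommutativeRing K
    module S = CommutativeRing S
    module R = CommutativeRing S/I
    module Syzᴹ = Module (submodule Syz)
    module Sᵐ = Module Sᵐ
    module S/Iᴹ = Module (quotient I)
  open SemiringSum K.semiring using (∑-distrib-+; *-distribˡ-sum) renaming (sum to ∑; sum-cong-≋ to ∑-cong)
  open SemiringSum S.semiring using () renaming (sum to ∑ᵖ)
  open AbelianGroupProperties K.+-abelianGroup using () renaming (ε⁻¹≈ε to -0≈0)

  extend-∑ : ∀ {k} (x : Fin k → K.Carrier) (w : Fin k → Exponent → K.Carrier) p →
             ∑ (λ l → x l K.* extend (w l) p) K.≈ extend (λ e → ∑ (λ l → x l K.* w l e)) p
  extend-∑ {zero}  x w p = K.sym (extend-zero p)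
  extend-∑ {suc k} x w p = K.trans (K.+-congˡ (extend-∑ (λ l → x (suc l)) (λ l → w (suc l)) p))
    (K.sym (extend-linear (w zero) (λ e → ∑ (λ l → x (suc l) K.* w (suc l) e)) (x zero) p))

  lowerTerm : K.Carrier → ∀ {e} → Dec (sq b ∣ᵉ e) → Polynomial
  lowerTerm k (yes (g , _)) = (k , g) ∷ []
  lowerTerm k (no  _)       = []

  -- Division by x^b with weights; terms that x^b does not divide are dropped. Dropping does not
  -- commute with multiplication by monomials, but `image-shift` shows that no term of nonzero
  -- weight is affected.
  lower : (Exponent → K.Carrier) → Polynomial → Polynomial
  lower w []            = []
  lower w ((k , e) ∷ p) = lowerTerm (k K.* w e) (sq b ∣ᵉ? e) +ᵖ lower w p

  coefficient-lowerTerm : ∀ (w : Exponent → K.Carrier) k e (d : Dec (sq b ∣ᵉ e)) h →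
    coefficient (lowerTerm (k K.* w e) d) h K.≈ w (h ⊞ sq b) K.* (k K.* δ (h ⊞ sq b) e)
  coefficient-lowerTerm w k e (yes (g , refl)) h = K.trans (K.+-identityʳ _) (compare (g ≟ᵉ h))
    where
    compare : Dec (g ≡ h) → (k K.* w (g ⊞ sq b)) K.* δ h g K.≈ w (h ⊞ sq b) K.* (k K.* δ (h ⊞ sq b) (g ⊞ sq b))
    compare (yes refl) = K.trans (K.*-congʳ (K.*-comm k _)) (K.trans (K.*-assoc _ k (δ h h))
      (K.*-congˡ (K.*-congˡ (K.sym (δ-shift h (sq b) h)))))
    compare (no g≢h) = K.trans (K.trans (K.*-congˡ (δ-miss g≢h)) (K.zeroʳ _)) (K.sym
      (K.trans (K.*-congˡ (K.trans (K.*-congˡ (K.trans (δ-shift h (sq b) g) (δ-miss g≢h))) (K.zeroʳ k))) (K.zeroʳ _)))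
  coefficient-lowerTerm w k e (no b∤e) h = K.sym (K.trans
    (K.*-congˡ (K.trans (K.*-congˡ (δ-miss {h ⊞ sq b} {e} (λ { refl → b∤e (h , refl) }))) (K.zeroʳ k))) (K.zeroʳ _))

  coefficient-lower : ∀ w p h → coefficient (lower w p) h K.≈ w (h ⊞ sq b) K.* coefficient p (h ⊞ sq b)
  coefficient-lower w []            h = K.sym (K.zeroʳ _)
  coefficient-lower w ((k , e) ∷ p) h = K.trans
    (extend-+ (δ h) (lowerTerm (k K.* w e) (sq b ∣ᵉ? e)) (lower w p))
    (K.trans (K.+-cong (coefficient-lowerTerm w k e (sq b ∣ᵉ? e) h) (coefficient-lower w p h))
    (K.sym (K.distribˡ _ _ _)))

  module _ (θ : Fin m → Subset n → K.Carrier)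
    (θ-missing : ∀ l U → ¬ b ⊆ 𝔣 l → θ l U K.≈ K.0#)
    (θ-size : ∀ l U → ∣ U ∣ ≢ 2 + r → θ l U K.≈ K.0#) where

    -- This is S-linear on Syz(I) only: in degrees supported on a single minimal nonface θ is not
    -- prescribed, and there every syzygy is zero.
    image : (Fin m → Polynomial) → Polynomial
    image x = ∑ᵖ (λ l → lower (λ e → θ l (supp e)) (x l *ᵖ generator l))

    component-at : (Fin m → Polynomial) → Exponent → Fin m → K.Carrier
    component-at x a l = coefficient (x l *ᵖ generator l) a

    coefficient-image : ∀ x h → coefficient (image x) h K.≈
      ∑ (λ l → θ l (supp (h ⊞ sq b)) K.* component-at x (h ⊞ sq b) l)
    coefficient-image x h = K.trans (coefficient-∑ (λ l → lower (λ e → θ l (supp e)) (x l *ᵖ generator l)) h)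
      (∑-cong (λ l → coefficient-lower (λ e → θ l (supp e)) (x l *ᵖ generator l) h))

    component-at-miss : ∀ x {a} l → ¬ 𝔣 l ⊆ supp a → component-at x a l K.≈ K.0#
    component-at-miss x {a} l F⊈a = coefficient-*monomial-miss (x l) (generatorExponent l) a
      (λ l∣a → F⊈a (sq-∣ᵉ⇒⊆ l∣a))

    ∑-component-at : ∀ {x} → Contains Syz x → ∀ a → ∑ (component-at x a) K.≈ K.0#
    ∑-component-at {x} x∈ a = K.trans (K.sym (coefficient-∑ (λ l → x l *ᵖ generator l) a)) (coefficients x∈ a)

    -- Syz(I) vanishes in such a degree, because at most one generator divides xᵃ.
    small-support : ∀ {x} → Contains Syz x → ∀ {a} → ∣ supp a ∣ ≤ suc r → ∀ U →
                    ∑ (λ l → θ l U K.* component-at x a l) K.≈ K.0#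
    small-support {x} x∈ {a} ∣a∣≤ U = cases (Finₚ.any? (λ l → 𝔣 l ⊆? supp a))
      where
      cases : Dec (∃ λ l → 𝔣 l ⊆ supp a) → ∑ (λ l → θ l U K.* component-at x a l) K.≈ K.0#
      cases (no none) = ∑-zero _ (λ l → K.trans (K.*-congˡ (component-at-miss x {a} l (λ F⊆a → none (l , F⊆a)))) (K.zeroʳ _))
      cases (yes (l₀ , F₀⊆a)) = K.trans (∑-cong constant-weight)
        (K.trans (K.sym (*-distribˡ-sum (θ l₀ U) (component-at x a)))
        (K.trans (K.*-congˡ (∑-component-at {x} x∈ a)) (K.zeroʳ _)))
        where
        a⊆F₀ : supp a ⊆ 𝔣 l₀
        a⊆F₀ = ⊆∧∣≥∣⇒⊇ F₀⊆a (ℕₚ.≤-trans ∣a∣≤ (ℕₚ.≤-reflexive (sym (∣𝔣∣ l₀))))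
        constant-weight : ∀ l → θ l U K.* component-at x a l K.≈ θ l₀ U K.* component-at x a l
        constant-weight l with l Finₚ.≟ l₀
        ... | yes refl = K.refl
        ... | no  l≢l₀   = K.trans (K.trans (K.*-congˡ off) (K.zeroʳ _)) (K.sym (K.trans (K.*-congˡ off) (K.zeroʳ _)))
          where off = component-at-miss x {a} l (λ F⊆a → l≢l₀ (𝔣⊆𝔣⇒≡ (λ y∈ → a⊆F₀ (F⊆a y∈))))

    supp-size : ∀ {h} → FaceExponent h → ∣ supp (h ⊞ sq b) ∣ ≤ 2 + r
    supp-size {h} h-face = subst (λ s → ∣ s ∣ ≤ 2 + r)
      (sym (trans (supp-⊞ h (sq b)) (cong (supp h ∪_) (supp-sq b))))
      (ℕₚ.≤-trans (∣p∪q∣≤∣p∣+∣q∣ (supp h) b) (ℕₚ.≤-trans (ℕₚ.+-mono-≤ (face⁻ (supp h) h-face) ∣b∣≤2)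
        (ℕₚ.≤-reflexive (ℕₚ.+-comm r 2))))

    -- Multiplying by a monomial may enlarge the support from supp a to V and thereby change the
    -- weights. Either supp a has at most r + 1 elements, where both sums vanish, or it has r + 2
    -- and equals V. The bound on V is where ∣b∣ ≤ 2 enters, through `supp-size`.
    weight-constant : ∀ {x} → Contains Syz x → ∀ {a} V → supp a ⊆ V → ∣ V ∣ ≤ 2 + r →
      ∑ (λ l → θ l V K.* component-at x a l) K.≈ ∑ (λ l → θ l (supp a) K.* component-at x a l)
    weight-constant {x} x∈ {a} V a⊆V ∣V∣≤ = cases (∣ supp a ∣ ℕₚ.≤? suc r)
      where
      cases : Dec (∣ supp a ∣ ≤ suc r) →
        ∑ (λ l → θ l V K.* component-at x a l) K.≈ ∑ (λ l → θ l (supp a) K.* component-at x a l)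
      cases (yes ∣a∣≤) = K.trans (small-support {x} x∈ {a} ∣a∣≤ V) (K.sym (small-support {x} x∈ {a} ∣a∣≤ (supp a)))
      cases (no  ∣a∣≰) = K.reflexive (cong (λ U → ∑ (λ l → θ l U K.* component-at x a l))
        (sym (⊆∧∣≥∣⇒≡ a⊆V (ℕₚ.≤-trans ∣V∣≤ (ℕₚ.≰⇒> ∣a∣≰)))))

    -- Linearity could fail in two ways. A term could become divisible by x^b only after
    -- multiplication by x^g; but a generator of nonzero weight contains b, so its multiples are
    -- divisible from the start. And the weights could change with the support, which
    -- `weight-constant` excludes.
    image-shift : ∀ {x} → Contains Syz x → ∀ {h} → FaceExponent h → ∀ g →
      ∑ (λ l → θ l (supp (h ⊞ sq b)) K.* translate g (x l *ᵖ generator l) (h ⊞ sq b))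
        K.≈ translate g (image x) h
    image-shift {x} x∈ {h} h-face g = cases (g ∣ᵉ? h)
      where
      cases : Dec (g ∣ᵉ h) → ∑ (λ l → θ l (supp (h ⊞ sq b)) K.* translate g (x l *ᵖ generator l) (h ⊞ sq b))
        K.≈ translate g (image x) h
      cases (yes (f , refl)) = K.trans
        (∑-cong (λ l → K.*-congˡ (K.trans
          (K.reflexive (cong (translate g (x l *ᵖ generator l)) (⊞-swapʳ f g (sq b))))
          (translate-hit g (x l *ᵖ generator l) (f ⊞ sq b)))))
        (K.trans (weight-constant {x} x∈ (supp (f ⊞ g ⊞ sq b))
          (supp-∣ᵉ (g , trans (⊞-comm g (f ⊞ sq b)) (⊞-swapʳ f (sq b) g))) (supp-size {f ⊞ g} h-face))
        (K.sym (K.trans (translate-hit g (image x) f) (coefficient-image x f))))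
      cases (no g∤h) = K.trans (∑-zero _ vanish) (K.sym (translate-miss g (image x) h g∤h))
        where
        vanish : ∀ l → θ l (supp (h ⊞ sq b)) K.* translate g (x l *ᵖ generator l) (h ⊞ sq b) K.≈ K.0#
        vanish l with b ⊆? 𝔣 l
        ... | no b⊈F  = K.trans (K.*-congʳ (θ-missing l _ b⊈F)) (K.zeroˡ _)
        ... | yes b⊆F = K.trans (K.*-congˡ (off (g ∣ᵉ? (h ⊞ sq b)))) (K.zeroʳ _)
          where
          off : Dec (g ∣ᵉ (h ⊞ sq b)) → translate g (x l *ᵖ generator l) (h ⊞ sq b) K.≈ K.0#
          off (no g∤)          = translate-miss g (x l *ᵖ generator l) (h ⊞ sq b) g∤
          off (yes (a , a+g)) = K.trans
            (K.reflexive (cong (translate g (x l *ᵖ generator l)) (sym a+g)))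
            (K.trans (translate-hit g (x l *ᵖ generator l) a)
            (coefficient-*monomial-miss (x l) (generatorExponent l) a λ { (f , refl) →
              let f′ , f′+b = sq-∣ᵉ-sq b⊆F in
              g∤h (f ⊞ f′ , ⊞-cancelʳ _ h (sq b) (trans (⊞-swapʳ (f ⊞ f′) g (sq b))
                (trans (cong (_⊞ g) (trans (⊞-assoc f f′ (sq b)) (cong (f ⊞_) f′+b))) a+g))) }))

    image-* : ∀ p {x} → Contains Syz x → (image (p Sᵐ.*ₗ x)) R.≈ (p *ᵖ image x)
    image-* p {x} x∈ = ≈ᶠ⇒≈ (facewise λ {h} h-face →
      let a = h ⊞ sq b in
      K.trans (coefficient-image (p Sᵐ.*ₗ x) h)
      (K.trans (∑-cong (λ l → K.*-congˡ (K.trans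
        (coefficients (*ᵖ-assoc p (x l) (generator l)) a) (coefficient-* p (x l *ᵖ generator l) a))))
      (K.trans (extend-∑ (λ l → θ l (supp a)) (λ l g → translate g (x l *ᵖ generator l) a) p)
      (K.trans (extend-cong (image-shift {x} x∈ {h} h-face) p) (K.sym (coefficient-* p (image x) h))))))

    image-cong : ∀ {x y} → x Sᵐ.≈ᴹ y → image x R.≈ image y
    image-cong {x} {y} x≈y = ≈ᶠ⇒≈ (facewise λ {h} h-face → K.trans (coefficient-image x h)
      (K.trans (∑-cong (λ l → K.*-congˡ (coefficients (S.*-congʳ {generator l} (x≈y l)) (h ⊞ sq b))))
        (K.sym (coefficient-image y h))))

    image-+ : ∀ x y → image (x Sᵐ.+ᴹ y) R.≈ (image x +ᵖ image y)
    image-+ x y = ≈ᶠ⇒≈ (facewise λ {h} h-face →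
      let a = h ⊞ sq b in K.trans (coefficient-image (x Sᵐ.+ᴹ y) h)
      (K.trans (∑-cong (λ l → K.trans
        (K.*-congˡ (K.trans (coefficients (S.distribʳ (generator l) (x l) (y l)) a)
          (extend-+ (δ a) (x l *ᵖ generator l) (y l *ᵖ generator l))))
        (K.distribˡ (θ l (supp a)) _ _)))
      (K.trans (∑-distrib-+ (λ l → θ l (supp a) K.* component-at x a l) (λ l → θ l (supp a) K.* component-at y a l))
      (K.trans (K.+-cong (K.sym (coefficient-image x h)) (K.sym (coefficient-image y h)))
        (K.sym (extend-+ (δ h) (image x) (image y)))))))

    imageHom : Hom (submodule Syz) (quotient I)
    imageHom = makeHom (λ x → image (proj₁ x)) (λ {x} {y} x≈y → image-cong {proj₁ x} {proj₁ y} x≈y)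
      (λ x y → image-+ (proj₁ x) (proj₁ y)) (λ p x → image-* p {proj₁ x} (proj₂ x))

    -- If b ⊆ F, the cofactor of x^F in x^(h+b) divides x^h, so it is a face exponent, and there the
    -- elements of I have no coefficient. Hence all of I·Sᵐ is killed, and it contains the Koszul
    -- relations.
    image-I : ∀ q x → Contains I q → ∀ {h} → FaceExponent h →
      ∀ l → θ l (supp (h ⊞ sq b)) K.* component-at (q Sᵐ.*ₗ x) (h ⊞ sq b) l K.≈ K.0#
    image-I q x q∈ {h} h-face l with b ⊆? 𝔣 l
    ... | no b⊈F  = K.trans (K.*-congʳ (θ-missing l _ b⊈F)) (K.zeroˡ _)
    ... | yes b⊆F = K.trans (K.*-congˡ (off (generatorExponent l ∣ᵉ? (h ⊞ sq b)))) (K.zeroʳ _)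
      where
      off : Dec (generatorExponent l ∣ᵉ (h ⊞ sq b)) → component-at (q Sᵐ.*ₗ x) (h ⊞ sq b) l K.≈ K.0#
      off (no l∤) = coefficient-*monomial-miss (q *ᵖ x l) (generatorExponent l) _ l∤
      off (yes (f , f+l)) = K.trans
        (K.reflexive (cong (coefficient ((q *ᵖ x l) *ᵖ generator l)) (sym f+l)))
        (K.trans (coefficient-*monomial (q *ᵖ x l) (generatorExponent l) f)
        (I⇒coefficient≈0 (Submodule.resp I {x l *ᵖ q} {q *ᵖ x l} (S.*-comm (x l) q) (Submodule.*-closed I (x l) q∈))
          (face-∣ᵉ f∣h h-face)))
        where
        f∣h : f ∣ᵉ h
        f∣h = let f′ , f′+b = sq-∣ᵉ-sq b⊆F in
          f′ , ⊞-cancelʳ _ h (sq b) (trans (cong (_⊞ sq b) (⊞-comm f′ f))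
            (trans (⊞-assoc f f′ (sq b)) (trans (cong (f ⊞_) f′+b) f+l)))

    image-I≈0 : ∀ q x → Contains I q → image (q Sᵐ.*ₗ x) R.≈ R.0#
    image-I≈0 q x q∈ = ≈ᶠ⇒≈ (facewise λ {h} h-face → K.trans (coefficient-image (q Sᵐ.*ₗ x) h)
      (∑-zero _ (image-I q x q∈ h-face)))

    image-koszul : ∀ fg → image (proj₁ (koszulSyzygy fg)) R.≈ R.0#
    image-koszul (f , g) = R.trans (image-+ (⟦ d ⟧ f Sᵐ.*ₗ g) (Sᵐ.-ᴹ (⟦ d ⟧ g Sᵐ.*ₗ f)))
      (R.trans (R.+-cong (image-I≈0 (⟦ d ⟧ f) g (d∈I f))
        (R.trans (image-cong {Sᵐ.-ᴹ (⟦ d ⟧ g Sᵐ.*ₗ f)} {⟦ d ⟧ g Sᵐ.*ₗ Sᵐ.-ᴹ f} (λ l → -‿distribʳ-* (⟦ d ⟧ g) (f l)))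
          (image-I≈0 (⟦ d ⟧ g) (Sᵐ.-ᴹ f) (d∈I g))))
      (R.+-identityˡ R.0#))
      where open RingProperties S.ring using (-‿distribʳ-*)

    constructed : T²-Hom
    constructed = makeHom (λ x → image (proj₁ x)) (λ {x} {y} → well-defined {x} {y})
      (λ x y → image-+ (proj₁ x) (proj₁ y)) (λ p x → image-* p {proj₁ x} (proj₂ x))
      where
      open AbelianGroupProperties S/Iᴹ.+ᴹ-abelianGroup using (x∙y⁻¹≈ε⇒x≈y)
      module φ = Hom imageHom
      well-defined : ∀ {x y} → Congruent Kosz x y → image (proj₁ x) R.≈ image (proj₁ y)
      well-defined {x} {y} x≈y = x∙y⁻¹≈ε⇒x≈y (image (proj₁ x)) (image (proj₁ y))
        (R.trans (R.+-congˡ {image (proj₁ x)} (R.sym (φ.-ᴹ-homo y)))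
        (R.trans (R.sym (φ.+ᴹ-homo x (Syzᴹ.-ᴹ y)))
        (span⊆ (kernel imageHom) image-koszul (difference x≈y))))

    constructed-homogeneous : HomogeneousHom b constructed
    constructed-homogeneous a x (y , y∈ , y≈x) = image (proj₁ y) , homogeneous , Hom.⟦⟧-cong constructed {y} {x} y≈x
      where
      homogeneous : ∀ h → degree h ≢ Vec.zipWith ℤ._+_ a (neg b) → coefficient (image (proj₁ y)) h K.≈ K.0#
      homogeneous h h≢ = K.trans (coefficient-image (proj₁ y) h)
        (∑-zero _ (λ l → K.trans (K.*-congˡ (off l (generatorExponent l ∣ᵉ? (h ⊞ sq b)))) (K.zeroʳ _)))
        where
        off : ∀ l → Dec (generatorExponent l ∣ᵉ (h ⊞ sq b)) → component-at (proj₁ y) (h ⊞ sq b) l K.≈ K.0#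
        off l (no l∤) = coefficient-*monomial-miss (proj₁ y l) (generatorExponent l) (h ⊞ sq b) l∤
        off l (yes (f , f+l)) = K.trans
          (K.reflexive (cong (coefficient (proj₁ y l *ᵖ generator l)) (sym f+l)))
          (K.trans (coefficient-*monomial (proj₁ y l) (generatorExponent l) f)
          (y∈ l f λ eq → h≢ (trans (sym (degree-neg⁻ h b))
            (cong (λ u → Vec.zipWith ℤ._+_ u (neg b)) (trans (cong degree (sym f+l))
              (sym (degree-⊞ f (generatorExponent l) a eq)))))))

    constructed-value : ∀ {U} (D E : Divisor (sq U)) → b ⊆ support D → ¬ b ⊆ support E →
      ∀ {h} → h ⊞ sq b ≡ sq U → value constructed D E h K.≈ θ (proj₁ D) U
    constructed-value {U} D@(i , e , e+i) E@(j , f , f+j) b⊆D b⊈E {h} h+b = K.trans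
      (coefficient-image x h) (K.trans
      (K.reflexive (cong (λ a → ∑ (λ l → θ l (supp a) K.* component-at x a l)) h+b))
      (K.trans (∑-single i _ others) (K.trans
        (K.*-cong (K.reflexive (cong (θ i) (supp-sq U)))
          (K.trans (K.reflexive (cong (coefficient (x i *ᵖ generator i)) (sym e+i)))
          (K.trans (coefficient-*monomial (x i) (generatorExponent i) e)
          (K.trans (coefficient-− D E i e) (K.trans
            (K.+-cong (K.trans (only-hit i _) (δ-hit e)) (K.trans (K.-‿cong (only-miss i≢j _)) -0≈0))
            (K.+-identityʳ _))))))
        (K.*-identityʳ _))))
      where
      x = proj₁ (D − E)
      i≢j : i ≢ j
      i≢j i≡j = b⊈E (λ y∈ → subst (λ l → _ ∈ 𝔣 l) i≡j (b⊆D y∈))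
      off : ∀ l → l ≢ i → l ≢ j → Dec (generatorExponent l ∣ᵉ sq U) → component-at x (sq U) l K.≈ K.0#
      off l l≢i l≢j (no l∤) = coefficient-*monomial-miss (x l) (generatorExponent l) (sq U) l∤
      off l l≢i l≢j (yes (g , g+l)) = K.trans
        (K.reflexive (cong (coefficient (x l *ᵖ generator l)) (sym g+l)))
        (K.trans (coefficient-*monomial (x l) (generatorExponent l) g)
        (K.trans (coefficient-− D E l g) (K.trans
          (K.+-cong (only-miss l≢i _) (K.trans (K.-‿cong (only-miss l≢j _)) -0≈0))
          (K.+-identityʳ K.0#))))
      others : ∀ l → l ≢ i → θ l (supp (sq U)) K.* component-at x (sq U) l K.≈ K.0#
      others l l≢i = cases (l Finₚ.≟ j)
        where
        cases : Dec (l ≡ j) → θ l (supp (sq U)) K.* component-at x (sq U) l K.≈ K.0#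
        cases (yes refl) = K.trans (K.*-congʳ (θ-missing j _ b⊈E)) (K.zeroˡ _)
        cases (no  l≢j)    = K.trans (K.*-congˡ (off l l≢i l≢j (generatorExponent l ∣ᵉ? sq U))) (K.zeroʳ _)

-- Components of T²

module Component {c ℓ : Level} (𝕂 : Field c ℓ) {n r : ℕ}
  (Δ : SimplicialComplex n) (Δ≐ : Δ ≐ᶜ uniform n r) (b : Subset n) where
  open Field 𝕂 using () renaming (commutativeRing to K)
  open StanleyReisner 𝕂 Δ
  open Coefficients K n
  open Presentation 𝕂 Δ
  open Divisors 𝕂 Δ
  open UniformComplex 𝕂 Δ Δ≐
  open HomogeneousHoms 𝕂 Δ Δ≐ b
  private
    module K = CommutativeRing K
    module R = CommutativeRing S/I
    module T = Module T²
    module Tb = Module (T²₋ 𝕂 Δ b)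
    module P = Submodule restrictions
  open SemiringSum K.semiring using () renaming (sum to ∑)

  homogeneous : ∀ {φ} → HomogeneousHom b φ → Homogeneous φ
  homogeneous {φ} φ∈ = value-homogeneous {b} {φ} φ∈

  representative : (x : Tb.Carrierᴹ) → ∃ λ φ → Homogeneous φ × φ T.≈ᴹ proj₁ x
  representative (φ , φ′ , φ′∈ , φ′≈φ) = φ′ , homogeneous {φ′} φ′∈ , φ′≈φ

  restriction⇒zero : (∀ φ → Homogeneous φ → ∃ λ ψ → restriction ψ ≈ʰ φ) → IsZero (T²₋ 𝕂 Δ b)
  restriction⇒zero restricts x = let φ , φ-hom , φ≈x = representative x in
    T.≈ᴹ-trans (T.≈ᴹ-sym φ≈x) (congruent (P.resp
      (pointwise λ y → R.sym (R.trans (R.+-congˡ {⟦ φ ⟧ y} (≈⇒congruent I (coefficientwise λ _ → K.refl)))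
        (R.+-identityʳ (⟦ φ ⟧ y))))
      (restricts φ φ-hom)))

  component-zero : ∣ b ∣ ≢ 2 ⊎ n ≤ r + 1 → IsZero (T²₋ 𝕂 Δ b)
  component-zero cases = restriction⇒zero (go cases)
    where
    0ᴴ : Hom Sᵐ (quotient I)
    0ᴴ = Module.0ᴹ Hom-S[Sᵐ,S/I]
    large : ∣ b ∣ ≢ 2 → Dec (∣ b ∣ < 2) → Dec (2 + r ≤ n) → ∀ φ → Homogeneous φ → ∃ λ ψ → restriction ψ ≈ʰ φ
    large ∣b∣≢2 (yes ∣b∣<2) _            φ φ-hom =
      0ᴴ , small-degree ∣b∣<2 {restriction 0ᴴ} {φ} (λ D E h-face h+b≢ → K.refl) φ-hom
    large ∣b∣≢2 (no  ∣b∣≮2) (yes 2+r≤n) φ φ-hom = large-degree (ℕₚ.≮⇒≥ ∣b∣≮2)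
      (ℕₚ.≤∧≢⇒< (ℕₚ.≮⇒≥ ∣b∣≮2) (λ eq → ∣b∣≢2 (sym eq))) 2+r≤n φ φ-hom
    large ∣b∣≢2 (no  _)     (no  2+r≰n) φ φ-hom = 0ᴴ , few-vertices
      (ℕₚ.≤-trans (ℕₚ.≤-pred (ℕₚ.≰⇒> 2+r≰n)) (ℕₚ.≤-reflexive (ℕₚ.+-comm 1 r))) {restriction 0ᴴ} {φ}
    go : ∣ b ∣ ≢ 2 ⊎ n ≤ r + 1 → ∀ φ → Homogeneous φ → ∃ λ ψ → restriction ψ ≈ʰ φ
    go (inj₂ n≤r+1) φ φ-hom = 0ᴴ , few-vertices n≤r+1 {restriction 0ᴴ} {φ}
    go (inj₁ ∣b∣≢2) φ φ-hom = large ∣b∣≢2 (∣ b ∣ ℕₚ.<? 2) ((2 + r) ℕₚ.≤? n) φ φ-hom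

  coefficient-combination : ∀ {d} (k : Fin d → K.Carrier) (φ : Fin d → Tb.Carrierᴹ) x h →
    coefficient (⟦ proj₁ (linearCombination (T²₋ 𝕂 Δ b) k φ) ⟧ x) h K.≈
      ∑ (λ q → k q K.* coefficient (⟦ proj₁ (φ q) ⟧ x) h)
  coefficient-combination {zero}  k φ x h = K.refl
  coefficient-combination {suc d} k φ x h = K.trans
    (extend-+ (δ h) (constant (k zero) *ᵖ ⟦ proj₁ (φ zero) ⟧ x)
      (⟦ proj₁ (linearCombination (T²₋ 𝕂 Δ b) (λ q → k (suc q)) (λ q → φ (suc q))) ⟧ x))
    (K.+-cong (coefficient-constant* (k zero) (⟦ proj₁ (φ zero) ⟧ x) h)
      (coefficient-combination (λ q → k (suc q)) (λ q → φ (suc q)) x h))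

-- A basis of the component when b has two elements

module Dimension {c ℓ : Level} (𝕂 : Field c ℓ) {n s : ℕ}
  (Δ : SimplicialComplex n) (Δ≐ : Δ ≐ᶜ uniform n (suc s)) (b : Subset n)
  (∣b∣≡2 : ∣ b ∣ ≡ 2) (3+s≤n : 3 + s ≤ n) where
  open Field 𝕂 using () renaming (commutativeRing to K)
  open StanleyReisner 𝕂 Δ
  open Coefficients K n
  open Presentation 𝕂 Δ
  open Divisors 𝕂 Δ
  open UniformComplex 𝕂 Δ Δ≐
  open HomogeneousHoms 𝕂 Δ Δ≐ b
  open Component 𝕂 Δ Δ≐ b
  open ConstructedHoms 𝕂 Δ Δ≐ b (ℕₚ.≤-reflexive ∣b∣≡2)
  private
    module K = CommutativeRing K
    module H = Module Hom-S/I[Syz/Kosz,S/I]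
    module T = Module T²
    module Tb = Module (T²₋ 𝕂 Δ b)

    2≤∣b∣ : 2 ≤ ∣ b ∣
    2≤∣b∣ = ℕₚ.≤-reflexive (sym ∣b∣≡2)
  open SemiringSum K.semiring using () renaming (sum to ∑; sum-cong-≋ to ∑-cong)
  open AbelianGroupProperties K.+-abelianGroup using () renaming (ε⁻¹≈ε to -0≈0)

  _≟ᵖ_ : (p q : Subset n × Subset n) → Dec (p ≡ q)
  _≟ᵖ_ = Productₚ.≡-dec (Vecₚ.≡-dec Boolₚ._≟_) (Vecₚ.≡-dec Boolₚ._≟_)

  L : List (Subset n × Subset n)
  L = flags b s

  dimension : ℕ
  dimension = length L

  F-of U-of : Fin dimension → Subset n
  F-of q = proj₁ (lookup L q)
  U-of q = proj₂ (lookup L q)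

  abstract
    flagAt : ∀ {F U} → F ∈ˡ over b s → U ∈ˡ over F 1 → ∃ λ i → 𝔣 i ≡ F × Flag 2≤∣b∣ i U
    flagAt {F} {U} F∈ U∈ = i , 𝔣i≡F , flag
      (trans (proj₂ (∈-over⁻ F 1 U∈)) (trans (cong (_+ 1) ∣F∣) (ℕₚ.+-comm (2 + s) 1)))
      (λ x∈ → subst (_ ∈_) (sym 𝔣i≡F) (proj₁ (∈-over⁻ b s F∈) x∈))
      (λ x∈ → proj₁ (∈-over⁻ F 1 U∈) (subst (_ ∈_) 𝔣i≡F x∈))
      where
      ∣F∣ : ∣ F ∣ ≡ 2 + s
      ∣F∣ = trans (proj₂ (∈-over⁻ b s F∈)) (cong (_+ s) ∣b∣≡2)
      i : Fin m
      i = proj₁ (index F ∣F∣)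
      𝔣i≡F : 𝔣 i ≡ F
      𝔣i≡F = proj₂ (index F ∣F∣)

    flag-of : ∀ q → ∃ λ i → 𝔣 i ≡ F-of q × Flag 2≤∣b∣ i (U-of q)
    flag-of q = flagAt (proj₁ member) (∈-drop (over (F-of q) 1) (proj₂ member))
      where
      member : F-of q ∈ˡ over b s × U-of q ∈ˡ drop 1 (over (F-of q) 1)
      member = ∈-pairs⁻ (λ F → drop 1 (over F 1)) (over b s) (∈-lookup {xs = L} q)

    𝔣∈over : ∀ {i} → b ⊆ 𝔣 i → 𝔣 i ∈ˡ over b s
    𝔣∈over {i} b⊆F = ∈-over⁺ b (𝔣 i) s b⊆F (trans (∣𝔣∣ i) (cong (_+ s) (sym ∣b∣≡2)))

    U∈over : ∀ {i U} → Flag 2≤∣b∣ i U → U ∈ˡ over (𝔣 i) 1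
    U∈over {i} {U} (flag ∣U∣ _ F⊆U) = ∈-over⁺ (𝔣 i) U 1 F⊆U
      (trans ∣U∣ (trans (ℕₚ.+-comm 1 (2 + s)) (cong (_+ 1) (sym (∣𝔣∣ i)))))

    over-nonempty : ∀ i → 0 < length (over (𝔣 i) 1)
    over-nonempty i = 0<length-over (𝔣 i) (subst (_< n) (sym (∣𝔣∣ i)) 3+s≤n)

  -- The set over F that `flags` drops; there is one because ∣F∣ = r + 1 < n.
  first : Fin m → Subset n
  first i = firstOf (over (𝔣 i) 1) (over-nonempty i)

  abstract
    firstFlag : ∀ i → b ⊆ 𝔣 i → Flag 2≤∣b∣ i (first i)
    firstFlag i b⊆F = flag (trans (proj₂ first∈) (trans (cong (_+ 1) (∣𝔣∣ i)) (ℕₚ.+-comm (2 + s) 1)))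
      b⊆F (proj₁ first∈)
      where
      first∈ : 𝔣 i ⊆ first i × ∣ first i ∣ ≡ ∣ 𝔣 i ∣ + 1
      first∈ = ∈-over⁻ (𝔣 i) 1 (firstOf-∈ (over (𝔣 i) 1) (over-nonempty i))

    first∉L : ∀ i q → (𝔣 i , first i) ≢ lookup L q
    first∉L i q eq = firstOf∉drop (over-unique (𝔣 i) 1) (over-nonempty i)
      (proj₂ (∈-pairs⁻ (λ F → drop 1 (over F 1)) (over b s) (subst (_∈ˡ L) (sym eq) (∈-lookup {xs = L} q))))

    first⊎∈L : ∀ {i U} → Flag 2≤∣b∣ i U → U ≡ first i ⊎ ∃ λ q → (𝔣 i , U) ≡ lookup L q
    first⊎∈L {i} {U} fl = cases (∈⇒first⊎drop (over-nonempty i) (U∈over fl))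
      where
      cases : U ≡ first i ⊎ U ∈ˡ drop 1 (over (𝔣 i) 1) → U ≡ first i ⊎ ∃ λ q → (𝔣 i , U) ≡ lookup L q
      cases (inj₁ U≡) = inj₁ U≡
      cases (inj₂ U∈) = inj₂ (Any.index ∈L , Anyₚ.lookup-index ∈L)
        where
        ∈L : (𝔣 i , U) ∈ˡ L
        ∈L = ∈-pairs⁺ (λ F → drop 1 (over F 1)) (𝔣∈over (Flag.b⊆F fl)) U∈

  indicator : Fin dimension → Fin m → Subset n → K.Carrier
  indicator q l V = if does ((𝔣 l , V) ≟ᵖ lookup L q) then K.1# else K.0#

  indicator-hit : ∀ q {l V} → (𝔣 l , V) ≡ lookup L q → indicator q l V K.≈ K.1#
  indicator-hit q {l} {V} eq with (𝔣 l , V) ≟ᵖ lookup L q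
  ... | yes _ = K.refl
  ... | no ne = contradiction eq ne

  indicator-miss : ∀ q {l V} → (𝔣 l , V) ≢ lookup L q → indicator q l V K.≈ K.0#
  indicator-miss q {l} {V} ne with (𝔣 l , V) ≟ᵖ lookup L q
  ... | yes eq = contradiction eq ne
  ... | no _   = K.refl

  indicator-missing : ∀ q l V → ¬ b ⊆ 𝔣 l → indicator q l V K.≈ K.0#
  indicator-missing q l V b⊈F = indicator-miss q λ eq →
    let i , 𝔣i≡ , fl = flag-of q in
    b⊈F (subst (b ⊆_) (trans 𝔣i≡ (sym (cong proj₁ eq))) (Flag.b⊆F fl))

  indicator-size : ∀ q l V → ∣ V ∣ ≢ 2 + suc s → indicator q l V K.≈ K.0#
  indicator-size q l V ∣V∣≢ = indicator-miss q λ eq →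
    let i , 𝔣i≡ , fl = flag-of q in
    ∣V∣≢ (trans (cong (λ p → ∣ proj₂ p ∣) eq) (Flag.∣U∣ fl))

  basisHom : Fin dimension → T²-Hom
  basisHom q = constructed (indicator q) (indicator-missing q) (indicator-size q)

  basisHom-homogeneous : ∀ q → HomogeneousHom b (basisHom q)
  basisHom-homogeneous q = constructed-homogeneous (indicator q) (indicator-missing q) (indicator-size q)

  basisElement : Fin dimension → Tb.Carrierᴹ
  basisElement q = basisHom q , basisHom q , basisHom-homogeneous q , T.≈ᴹ-refl

  ∑-hit : ∀ (k : Fin dimension → K.Carrier) q {l V} → (𝔣 l , V) ≡ lookup L q → ∑ (λ p → k p K.* indicator p l V) K.≈ k q
  ∑-hit k q {l} {V} eq = K.trans (∑-single q _ λ p p≢q → K.trans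
      (K.*-congˡ (indicator-miss p λ eq′ → p≢q (lookup-injective (flags-unique b s) p q (trans (sym eq′) eq))))
      (K.zeroʳ (k p)))
    (K.trans (K.*-congˡ (indicator-hit q eq)) (K.*-identityʳ (k q)))

  ∑-miss : ∀ (k : Fin dimension → K.Carrier) {l V} → (∀ p → (𝔣 l , V) ≢ lookup L p) → ∑ (λ p → k p K.* indicator p l V) K.≈ K.0#
  ∑-miss k ne = ∑-zero _ λ p → K.trans (K.*-congˡ (indicator-miss p (ne p))) (K.zeroʳ (k p))

  combination : (Fin dimension → K.Carrier) → T²-Hom
  combination k = proj₁ (linearCombination (T²₋ 𝕂 Δ b) k basisElement)

  value-combination : ∀ k {U} (D E : Divisor (sq U)) → b ⊆ support D → ¬ b ⊆ support E →
    ∀ {h} → h ⊞ sq b ≡ sq U → value (combination k) D E h K.≈ ∑ (λ p → k p K.* indicator p (proj₁ D) U)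
  value-combination k D E b⊆D b⊈E {h} h+b = K.trans (coefficient-combination k basisElement (D − E) h)
    (∑-cong λ p → K.*-congˡ {k p} (constructed-value (indicator p) (indicator-missing p) (indicator-size p) D E b⊆D b⊈E h+b))

  combination-homogeneous : ∀ k → Homogeneous (combination k)
  combination-homogeneous k D E {h} h-face h+b≢ = K.trans (coefficient-combination k basisElement (D − E) h)
    (∑-zero _ λ p → K.trans (K.*-congˡ (homogeneous {basisHom p} (basisHom-homogeneous p) D E h-face h+b≢)) (K.zeroʳ (k p)))

  -- A `Flag` contains inclusions, which are functions and thus not unique as proofs, and the
  -- divisors and exponents in θ are built from them. `value≈θ` shows that the scalar does not
  -- notice.
  θ-irrelevant : ∀ φ {i i′ U U′} → i ≡ i′ → U ≡ U′ → (fl : Flag 2≤∣b∣ i U) (fl′ : Flag 2≤∣b∣ i′ U′) →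
                 θ 2≤∣b∣ φ fl K.≈ θ 2≤∣b∣ φ fl′
  θ-irrelevant φ {i} {_} {U} refl refl fl fl′ = value≈θ 2≤∣b∣ φ (divisor i U F⊆U) (omitted 2≤∣b∣ U ∣U∣ b⊆U)
    (omitted-missing 2≤∣b∣ U ∣U∣ b⊆U) (proj₂ (sq-∣ᵉ-sq b⊆U)) exponent-face fl′
    where open Flag fl

  θ-combination : ∀ k {i U} (fl : Flag 2≤∣b∣ i U) →
                  θ 2≤∣b∣ (combination k) fl K.≈ ∑ (λ p → k p K.* indicator p i U)
  θ-combination k {i} {U} fl = value-combination k (divisor i U F⊆U) (omitted 2≤∣b∣ U ∣U∣ b⊆U) b⊆F
    (omitted-missing 2≤∣b∣ U ∣U∣ b⊆U) (proj₂ (sq-∣ᵉ-sq b⊆U))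
    where open Flag fl

  value-sub : ∀ φ φ′ {a} (D E : Divisor a) h → value (φ H.+ᴹ H.-ᴹ φ′) D E h K.≈ value φ D E h K.- value φ′ D E h
  value-sub φ φ′ D E h = coefficient-sub (⟦ φ ⟧ (D − E)) (⟦ φ′ ⟧ (D − E)) h

  module Spanning (φ : T²-Hom) (φ-hom : Homogeneous φ) where

    firstθ : ∀ i → b ⊆ 𝔣 i → K.Carrier
    firstθ i b⊆F = θ 2≤∣b∣ φ (firstFlag i b⊆F)

    -- Subtracting a restriction normalises θ to vanish on the first flag over each F.
    coordinate : Fin dimension → K.Carrier
    coordinate q = let i , _ , fl = flag-of q in θ 2≤∣b∣ φ fl K.- firstθ i (Flag.b⊆F fl)

    remainder : T²-Hom
    remainder = φ H.+ᴹ H.-ᴹ combination coordinate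

    remainder-homogeneous : Homogeneous remainder
    remainder-homogeneous D E {h} h-face h+b≢ = K.trans (value-sub φ (combination coordinate) D E h)
      (K.trans (K.+-cong (φ-hom D E h-face h+b≢) (K.-‿cong (combination-homogeneous coordinate D E h-face h+b≢)))
        (K.-‿inverseʳ K.0#))

    x-[x-y] : ∀ x y → x K.- (x K.- y) K.≈ y
    x-[x-y] x y = K.trans (K.+-congˡ (⁻¹-anti-homo‿- x y)) (K.trans (K.+-comm x (y K.- x))
      (K.trans (K.+-assoc y (K.- x) x) (K.trans (K.+-congˡ (K.-‿inverseˡ x)) (K.+-identityʳ y))))
      where open AbelianGroupProperties K.+-abelianGroup using (⁻¹-anti-homo‿-)

    -- The combination takes the value θ(F,U) - θ(F,first) on a listed flag and 0 on the first one.
    -- Either way θ(F,first) remains, which depends on F alone, so the remainder is a restriction.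
    coordinates-correct : ∀ {i U} (fl : Flag 2≤∣b∣ i U) (b⊆F : b ⊆ 𝔣 i) →
      θ 2≤∣b∣ φ fl K.- ∑ (λ p → coordinate p K.* indicator p i U) K.≈ firstθ i b⊆F
    coordinates-correct {i} {U} fl b⊆F = cases (first⊎∈L fl)
      where
      cases : U ≡ first i ⊎ (∃ λ q → (𝔣 i , U) ≡ lookup L q) →
        θ 2≤∣b∣ φ fl K.- ∑ (λ p → coordinate p K.* indicator p i U) K.≈ firstθ i b⊆F
      cases (inj₁ U≡) = K.trans (K.+-cong (θ-irrelevant φ refl U≡ fl (firstFlag i b⊆F))
        (K.trans (K.-‿cong (∑-miss coordinate λ p eq → first∉L i p (trans (cong (𝔣 i ,_) (sym U≡)) eq))) -0≈0))
        (K.+-identityʳ _)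
      cases (inj₂ (q , eq)) = K.trans
        (K.+-congˡ (K.-‿cong (K.trans (∑-hit coordinate q eq) (K.+-cong
          (θ-irrelevant φ iq≡i (sym (cong proj₂ eq)) flq fl)
          (K.-‿cong (θ-irrelevant φ iq≡i (cong first iq≡i) (firstFlag iq (Flag.b⊆F flq)) (firstFlag i b⊆F)))))))
        (x-[x-y] _ _)
        where
        iq = proj₁ (flag-of q)
        flq = proj₂ (proj₂ (flag-of q))
        iq≡i : iq ≡ i
        iq≡i = 𝔣-injective iq i (trans (proj₁ (proj₂ (flag-of q))) (sym (cong proj₁ eq)))

    remainder-restricted : Contains restrictions remainder
    remainder-restricted = monomialHom 2≤∣b∣ firstθ ,
      determined 2≤∣b∣ (monomialHom-homogeneous 2≤∣b∣ firstθ) remainder-homogeneous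
        λ {U} ∣U∣ D E b⊆D b⊈E {h} h+b h-face →
          let p  = monomialHom-value 2≤∣b∣ firstθ D E b⊆D b⊈E h+b h-face
              fl = flag ∣U∣ b⊆D (support⊆ D)
          in K.trans (proj₂ p) (K.sym (K.trans (value-sub φ (combination coordinate) D E h)
            (K.trans (K.+-cong (value≈θ 2≤∣b∣ φ D E b⊈E h+b h-face fl)
              (K.-‿cong (value-combination coordinate D E b⊆D b⊈E h+b)))
            (coordinates-correct fl (proj₁ p)))))

    representative-spanned : ∀ {φ′} → φ T.≈ᴹ φ′ → φ′ T.≈ᴹ combination coordinate
    representative-spanned {φ′} φ≈φ′ = T.≈ᴹ-trans {φ′} {φ} {combination coordinate}
      (T.≈ᴹ-sym {φ} {φ′} φ≈φ′) (congruent remainder-restricted)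

  spanning : ∀ x → ∃ λ k → x Tb.≈ᴹ linearCombination (T²₋ 𝕂 Δ b) k basisElement
  spanning x = Spanning.coordinate φ φ-hom , Spanning.representative-spanned φ φ-hom (proj₂ (proj₂ (representative x)))
    where
    φ = proj₁ (representative x)
    φ-hom : Homogeneous φ
    φ-hom = proj₁ (proj₂ (representative x))

  θ-restriction : ∀ ψ {i U} (fl : Flag 2≤∣b∣ i U) (b⊆F : b ⊆ 𝔣 i) →
    θ 2≤∣b∣ (restriction ψ) fl K.≈ coefficient (⟦ ψ ⟧ (basisVector i)) (proj₁ (sq-∣ᵉ-sq b⊆F))
  θ-restriction ψ {i} {U} fl b⊆F = restriction-value 2≤∣b∣ ψ (divisor i U F⊆U) (omitted 2≤∣b∣ U ∣U∣ b⊆U)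
    (omitted-missing 2≤∣b∣ U ∣U∣ b⊆U) (proj₂ (sq-∣ᵉ-sq b⊆U)) exponent-face
    (proj₁ (sq-∣ᵉ-sq b⊆F)) (proj₂ (sq-∣ᵉ-sq b⊆F))
    where open Flag fl hiding (b⊆F)

  -- A combination that is a restriction has the same scalar at every U over F. At the U of flag q
  -- this is `k q`; at the first U it is 0, because no basis element is supported there.
  independent : ∀ k → linearCombination (T²₋ 𝕂 Δ b) k basisElement Tb.≈ᴹ Tb.0ᴹ → ∀ q → k q K.≈ K.0#
  independent k dependence q = K.trans (K.sym (∑-hit k q {iq} (cong (_, U-of q) 𝔣iq≡)))
    (K.trans (θ-ψ flq) (K.trans (K.sym (θ-ψ (firstFlag iq b⊆F))) (∑-miss k (first∉L iq))))
    where
    iq = proj₁ (flag-of q)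
    𝔣iq≡ = proj₁ (proj₂ (flag-of q))
    flq = proj₂ (proj₂ (flag-of q))
    b⊆F : b ⊆ 𝔣 iq
    b⊆F = Flag.b⊆F flq
    ψ = proj₁ (difference dependence)
    θ-ψ : ∀ {U} (fl : Flag 2≤∣b∣ iq U) → ∑ (λ p → k p K.* indicator p iq U) K.≈
      coefficient (⟦ ψ ⟧ (basisVector iq)) (proj₁ (sq-∣ᵉ-sq b⊆F))
    θ-ψ {U} fl = K.trans (K.sym (θ-combination k fl))
      (K.trans (K.sym (K.trans (value-sub (combination k) H.0ᴹ D E exponent) (K.trans (K.+-congˡ -0≈0) (K.+-identityʳ _))))
      (K.trans (K.sym (faceCoefficient (≈⇒≈ᶠ (agree (proj₂ (difference dependence)) (D − E))) exponent-face))
        (θ-restriction ψ fl b⊆F)))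
      where
      open Flag fl hiding (b⊆F)
      D = divisor iq U F⊆U
      E = omitted 2≤∣b∣ U ∣U∣ b⊆U

  hasDimension : HasDimension (T²₋ 𝕂 Δ b) dimension
  hasDimension = record { basis = basisElement ; spanning = spanning ; independent = independent }

-- Dimensions and the classification

module _ {r ℓr m ℓm} {R : CommutativeRing r ℓr} {M : Module R m ℓm} where
  open Module M

  isZero⇒dimension0 : IsZero M → HasDimension M 0
  isZero⇒dimension0 M≈0 = record
    { basis       = λ ()
    ; spanning    = λ x → (λ ()) , M≈0 x
    ; independent = λ _ _ ()
    }

  dimension0⇒isZero : ∀ {d} → d ≡ 0 → HasDimension M d → IsZero M
  dimension0⇒isZero refl dim x = proj₂ (HasDimension.spanning dim x)

module _ {c ℓ m ℓm} (𝕂 : Field c ℓ) {M : Module (Field.commutativeRing 𝕂) m ℓm} where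
  open Field 𝕂 using (1#; 1≉0)

  isZero⇒dimension≡0 : ∀ {d} → IsZero M → HasDimension M d → d ≡ 0
  isZero⇒dimension≡0 {zero}  M≈0 dim = refl
  isZero⇒dimension≡0 {suc d} M≈0 dim =
    contradiction (HasDimension.independent dim (λ _ → 1#) (M≈0 _) zero) 1≉0

0<nCk : ∀ {n k} → k ≤ n → 0 < n C k
0<nCk {n}     {zero}  _         = subst (0 <_) (sym (nC0≡1 n)) (s≤s z≤n)
0<nCk {suc n} {suc k} (s≤s k≤n) = subst (0 <_) (nCk+nC[k+1]≡[n+1]C[k+1] n k)
  (ℕₚ.<-≤-trans (0<nCk k≤n) (ℕₚ.m≤m+n (n C k) (n C suc k)))

subsetOfSize : ∀ {n} k → k ≤ n → ∃ λ (F : Subset n) → ∣ F ∣ ≡ k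
subsetOfSize {zero}  zero    z≤n       = [] , refl
subsetOfSize {suc n} zero    z≤n       = let F , ∣F∣ = subsetOfSize zero z≤n in outside ∷ F , ∣F∣
subsetOfSize {suc n} (suc k) (s≤s k≤n) = let F , ∣F∣ = subsetOfSize k k≤n in inside ∷ F , cong suc ∣F∣

module _ {c ℓ : Level} (𝕂 : Field c ℓ) {n s : ℕ} (Δ : SimplicialComplex n) (Δ≐ : Δ ≐ᶜ uniform n (suc s)) where

  edge-dimension : ∀ b → ∣ b ∣ ≡ 2 → 3 + s ≤ n →
    HasDimension (T²₋ 𝕂 Δ b) (((n ∸ 2) C s) * (n ∸ 2 ∸ s ∸ 1))
  edge-dimension b ∣b∣ 3+s≤n = subst (HasDimension (T²₋ 𝕂 Δ b))
    (trans (length-flags b s) (cong₂ (λ x y → ((n ∸ x) C s) * (y ∸ 1)) ∣b∣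
      (trans (cong (λ x → n ∸ (x + s)) ∣b∣) (sym (ℕₚ.∸-+-assoc n 2 s)))))
    (Dimension.hasDimension 𝕂 Δ Δ≐ b ∣b∣ 3+s≤n)

  -- The dimension count is needed only for #b = 2 and n = r + 2: there is one U over each F, and
  -- the factor n - r - 2 is zero.
  all-zero : n ≤ 3 + s → ∀ b → IsZero (T²₋ 𝕂 Δ b)
  all-zero n≤3+s b = cases (∣ b ∣ ℕₚ.≟ 2) ((3 + s) ℕₚ.≤? n)
    where
    cases : Dec (∣ b ∣ ≡ 2) → Dec (3 + s ≤ n) → IsZero (T²₋ 𝕂 Δ b)
    cases (no ∣b∣≢2) _ = Component.component-zero 𝕂 Δ Δ≐ b (inj₁ ∣b∣≢2)
    cases (yes ∣b∣) (no 3+s≰n) = Component.component-zero 𝕂 Δ Δ≐ b (inj₂ (subst (n ≤_) (sym (ℕₚ.+-comm (suc s) 1))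
      (ℕₚ.≤-pred (ℕₚ.≰⇒> 3+s≰n))))
    cases (yes ∣b∣) (yes 3+s≤n) = dimension0⇒isZero d≡0 (edge-dimension b ∣b∣ 3+s≤n)
      where
      d≡0 : ((n ∸ 2) C s) * (n ∸ 2 ∸ s ∸ 1) ≡ 0
      d≡0 = trans (cong (((n ∸ 2) C s) *_) (ℕₚ.m≤n⇒m∸n≡0 {n ∸ 2 ∸ s} {1}
        (ℕₚ.m≤n+o⇒m∸n≤o (n ∸ 2) s (ℕₚ.m≤n+o⇒m∸n≤o n 2 (subst (λ x → n ≤ 2 + x) (ℕₚ.+-comm 1 s) n≤3+s)))))
        (ℕₚ.*-zeroʳ ((n ∸ 2) C s))

  -- For n ≥ r + 3 any b with two elements gives a nonzero component: there is an F over b, and at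
  -- least two sets U over it, so both factors of the dimension are positive.
  zero⇒few : (∀ b → IsZero (T²₋ 𝕂 Δ b)) → n ≤ 3 + s
  zero⇒few vanish = ℕₚ.≮⇒≥ λ 4+s≤n →
    let 2≤n    = ℕₚ.≤-trans (s≤s (s≤s z≤n)) 4+s≤n
        b , ∣b∣ = subsetOfSize 2 2≤n
        2+s≤N  = ℕₚ.∸-monoˡ-≤ 2 4+s≤n
        0<q    = ℕₚ.m<n⇒0<n∸m {1} (ℕₚ.≤-trans (ℕₚ.≤-reflexive (sym (ℕₚ.m+n∸n≡m 2 s))) (ℕₚ.∸-monoˡ-≤ s 2+s≤N))
    in ℕₚ.<⇒≢ (ℕₚ.*-mono-≤ (0<nCk (ℕₚ.≤-trans (ℕₚ.m≤n+m s 2) 2+s≤N)) 0<q)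
      (sym (isZero⇒dimension≡0 𝕂 (vanish b) (edge-dimension b ∣b∣ (ℕₚ.≤-trans (ℕₚ.n≤1+n (3 + s)) 4+s≤n))))

module _ {n r : ℕ} (0<n : 0 < n) (r≤n : r ≤ n) where

  -- The alternatives correspond to n ≤ r, n = r + 1 and n = r + 2. In the last one k + 2 = n stands
  -- for k = n - 2 without truncated subtraction.
  classify : n ≤ r + 2 → uniform n r ≐ᶜ fullSimplex n ⊎ uniform n r ≐ᶜ boundary n ⊎
                         (∃ λ k → k + 2 ≡ n × uniform n r ≐ᶜ uniform n k)
  classify n≤r+2 with n ℕₚ.≤? r | n ℕₚ.≤? suc r
  ... | yes n≤r | _ = inj₁ ((λ _ → tt) , λ {F} _ → ℕₚ.≤-trans (∣p∣≤n F) n≤r)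
  ... | no  n≰r | yes n≤1+r = inj₂ (inj₁
    ((λ { ∣F∣≤r refl → n≰r (subst (_≤ r) (∣⊤∣≡n n) ∣F∣≤r) }) ,
     λ {F} F≢⊤ → ℕₚ.≤-pred (ℕₚ.≤-trans (ℕₚ.≤∧≢⇒< (∣p∣≤n F) (λ ∣F∣≡n → F≢⊤ (∣p∣≡n⇒p≡⊤ ∣F∣≡n))) n≤1+r)))
  ... | no  _   | no  n≰1+r = inj₂ (inj₂ (r ,
    ℕₚ.≤-antisym (ℕₚ.≤-trans (ℕₚ.≤-reflexive (ℕₚ.+-comm r 2)) (ℕₚ.≰⇒> n≰1+r)) n≤r+2 , (λ x → x) , (λ x → x)))

  -- One face of largest size decides each alternative: it has n, n - 1 or n - 2 elements, and its
  -- size bounds r from below.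
  classify⁻ : uniform n r ≐ᶜ fullSimplex n ⊎ uniform n r ≐ᶜ boundary n ⊎
              (∃ λ k → k + 2 ≡ n × uniform n r ≐ᶜ uniform n k) → n ≤ r + 2
  classify⁻ (inj₁ (_ , face)) = ℕₚ.≤-trans (subst (_≤ r) (∣⊤∣≡n n) (face {⊤} tt)) (ℕₚ.m≤m+n r 2)
  classify⁻ (inj₂ (inj₁ (_ , face))) = facet n 0<n (λ F → face {F})
    where
    facet : ∀ n → 0 < n → (∀ (F : Subset n) → F ≢ ⊤ → ∣ F ∣ ≤ r) → n ≤ r + 2
    facet (suc n) _ face = let F , ∣F∣ = subsetOfSize {suc n} n (ℕₚ.n≤1+n n) in
      ℕₚ.≤-trans (s≤s (subst (_≤ r) ∣F∣
        (face F (λ F≡⊤ → ℕₚ.1+n≢n (trans (sym (trans (cong ∣_∣ F≡⊤) (∣⊤∣≡n (suc n)))) ∣F∣)))))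
      (ℕₚ.≤-trans (ℕₚ.n≤1+n (suc r)) (ℕₚ.≤-reflexive (ℕₚ.+-comm 2 r)))
  classify⁻ (inj₂ (inj₂ (k , refl , _ , face))) =
    let F , ∣F∣ = subsetOfSize {k + 2} k (ℕₚ.m≤m+n k 2) in
    ℕₚ.+-monoˡ-≤ 2 (subst (_≤ r) ∣F∣ (face {F} (ℕₚ.≤-reflexive ∣F∣)))

proposition4p1 : ∀ {c ℓ : Level} (𝕂 : Field c ℓ) (n r : ℕ) → 0 < n → 1 ≤ r → r ≤ n →
    (∀ (b : Subset n) →
    (∣ b ∣ ≢ 2 ⊎ n ≤ r + 1 → HasDimension (T²₋ 𝕂 (uniform n r) b) 0) ×
    (∣ b ∣ ≡ 2 → r + 2 ≤ n →
    ∃ λ d → HasDimension (T²₋ 𝕂 (uniform n r) b) d ×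
    + d ≡ (+ r) ℤ.* (+ ((n ∸ 2) C r)) ℤ.- (+ ((n ∸ 2) C (r ∸ 1))))) ×
    ((∀ (b : Subset n) → IsZero (T²₋ 𝕂 (uniform n r) b)) ⇔ n ≤ r + 2) ×
    (n ≤ r + 2 ⇔
    (uniform n r ≐ᶜ fullSimplex n ⊎
    uniform n r ≐ᶜ boundary n ⊎
    (∃ λ k → k + 2 ≡ n × uniform n r ≐ᶜ uniform n k)))
proposition4p1 𝕂 n r@(suc s) 0<n 1≤r r≤n =
  (λ b →
    (λ cases → isZero⇒dimension0 (Component.component-zero 𝕂 (uniform n r) ≐-refl b cases)) ,
    λ ∣b∣ r+2≤n → let 3+s≤n = subst (_≤ n) r+2 r+2≤n in
      _ , edge-dimension 𝕂 (uniform n r) ≐-refl b ∣b∣ 3+s≤n , dimension-formula (n ∸ 2) s (ℕₚ.∸-monoˡ-≤ 2 3+s≤n)) ,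
  mk⇔ (λ vanish → subst (n ≤_) (sym r+2) (zero⇒few 𝕂 (uniform n r) ≐-refl vanish))
      (λ n≤r+2 → all-zero 𝕂 (uniform n r) ≐-refl (subst (n ≤_) r+2 n≤r+2)) ,
  mk⇔ (classify 0<n r≤n) (classify⁻ 0<n r≤n)
  where
  r+2 : r + 2 ≡ 3 + s
  r+2 = ℕₚ.+-comm r 2
  ≐-refl : uniform n r ≐ᶜ uniform n r
  ≐-refl = (λ x → x) , (λ x → x)
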